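{- For any $\epsilon>0$, there is an algorithm that, given any instance of the day-invariant fair repetitive scheduling problem with $n$ clients and an arbitrary number of days, computes a schedule $\pi$ with $K(\pi)\le(1+\epsilon)K^*$, where $K^*$ is the optimal objective value of the instance. The algorithm can be implemented in $O\left(n^{\tilde O\left(\frac{\log\log n}{\epsilon^9}\right)}\right)$ time.
   Context: Notation: $[k]=\{1,\dots,k\}$; $\tilde O$ suppresses polylogarithmic factors, i.e., $\tilde O(f)=O(f\cdot\log^{O(1)}f)$. An instance of the day-invariant fair repetitive scheduling problem consists of $n$ clients, $m$ days, and a positive integer processing time $p_j$ for each client $j\in[n]$; on every day $i\in[m]$ client $j$ has a job $(i,j)$ of processing time $p_{i,j}=p_j$. On each day all $n$ jobs of that day are available at time $0$ and are processed non-preemptively on a single machine. A schedule is a sequence $\pi=(\pi_1,\dots,\pi_m)$ of permutations of $[n]$, where $\pi_i(j)$ is the position of job $(i,j)$ in the processing order of day $i$. The completion time of job $(i,j)$ is $C_{i,j}(\pi)=\sum_{\ell\in[n]:\,\pi_i(\ell)\le\pi_i(j)}p_{\ell}$, the total completion time of client $j$ is $C_j(\pi)=\sum_{i\in[m]}C_{i,j}(\pi)$, and the objective is to minimize $K(\pi)=\max_{j\in[n]}C_j(\pi)$. The optimal value is $K^*=\min_\pi K(\pi)$. -}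

module Defs where

open import Algebra.Definitions.RawSemiring using () renaming (_^_ to _⟨_⟩^_)
open import Data.Bool.Base using (if_then_else_)
open import Data.Fin.Base as Fin using (Fin; toℕ; finToFun; funToFin; combine; remQuot)
open import Data.Fin.Permutation as Perm using (Permutation′; permutation; _⟨$⟩ʳ_; _⟨$⟩ˡ_; inverseˡ; inverseʳ)
import Data.Fin.Properties as Fin
open import Data.Integer.Base as ℤ using (+_)
open import Data.List.Base using (List; []; _∷_; map; filter; length; replicate; concatMap; allFin; tabulate)
import Data.List.Extrema.Nat as Extrema
open import Data.List.Extrema.Nat using (max)
open import Data.List.Membership.Propositional.Properties using (∈-allFin)
open import Data.List.Properties using (map-cong; filter-≐)
import Data.List.Relation.Unary.All as All
open import Data.Nat.Base using (ℕ; zero; suc; NonZero; _+_; _*_; _∸_; _/_; _^_; _⊔_; _≤_; _<_)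
open import Data.Nat.ListAction using (sum)
open import Data.Nat.Logarithm using (⌈log₂_⌉)
open import Data.Nat.Properties using (_≟_; ≤-trans; ≤-reflexive)
open import Data.Product.Base using (Σ-syntax; ∃-syntax; _×_; _,_; proj₁; proj₂)
open import Data.Rational.Base as ℚ using (ℚ; Positive; 1ℚ; ceiling)
open import Data.Rational.Properties using (pos⇒nonZero)
open import Data.Unit.Base using (⊤)
open import Relation.Binary.PropositionalEquality using (_≡_; _≢_; _≗_; refl; sym; trans; cong)
open import Relation.Nullary.Decidable using (Dec; yes; no; does; _×-dec_)
open import Relation.Nullary.Negation using (contradiction)

------------------------------------------------------------------------
-- Day-invariant fair repetitive scheduling

record Instance (n m : ℕ) : Set where
  field
    p   : Fin n → ℕ
    p>0 : ∀ j → 0 < p j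

open Instance public

-- `π i ⟨$⟩ʳ j` is the position of client j on day i.
-- Positions (like clients and days) are numbered from 0.
Schedule : ℕ → ℕ → Set
Schedule n m = Fin m → Permutation′ n

module _ {n m : ℕ} (I : Instance n m) where

  jobCompletion : Schedule n m → Fin m → Fin n → ℕ
  jobCompletion π i j =
    sum (map (p I) (filter (λ ℓ → (π i ⟨$⟩ʳ ℓ) Fin.≤? (π i ⟨$⟩ʳ j)) (allFin n)))

  clientCompletion : Schedule n m → Fin n → ℕ
  clientCompletion π j = sum (map (λ i → jobCompletion π i j) (allFin m))

  objective : Schedule n m → ℕ
  objective π = max 0 (map (clientCompletion π) (allFin n))

  IsOptimum : ℕ → Set
  IsOptimum K* = (∃[ π ] objective π ≡ K*) × (∀ π → K* ≤ objective π)

------------------------------------------------------------------------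
-- The optimum exists: a schedule is determined, up to pointwise equality,
-- by a code in a finite set.

private
  Inverses : ∀ {n} → (f g : Fin n → Fin n) → Set
  Inverses f g = (∀ x → f (g x) ≡ x) × (∀ x → g (f x) ≡ x)

  inverses? : ∀ {n} (f g : Fin n → Fin n) → Dec (Inverses f g)
  inverses? f g = Fin.all? (λ x → f (g x) Fin.≟ x) ×-dec Fin.all? (λ x → g (f x) Fin.≟ x)

  mkPerm : ∀ {n} (f g : Fin n → Fin n) → Permutation′ n
  mkPerm f g with inverses? f g
  ... | yes (fg , gf) = permutation f g fg gf
  ... | no _          = Perm.id

  mkPerm-to : ∀ {n} (f g : Fin n → Fin n) → Inverses f g → ∀ x → mkPerm f g ⟨$⟩ʳ x ≡ f x
  mkPerm-to f g inv x with inverses? f g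
  ... | yes _ = refl
  ... | no ¬i = contradiction inv ¬i

  PermCode : ℕ → ℕ
  PermCode n = n ^ n * n ^ n

  pairPerm : ∀ {n} → Fin (n ^ n) × Fin (n ^ n) → Permutation′ n
  pairPerm (f , g) = mkPerm (finToFun f) (finToFun g)

  decodePerm : ∀ n → Fin (PermCode n) → Permutation′ n
  decodePerm n c = pairPerm (remQuot {n ^ n} (n ^ n) c)

  encodePerm : ∀ {n} → Permutation′ n → Fin (PermCode n)
  encodePerm σ = combine (funToFin (σ ⟨$⟩ʳ_)) (funToFin (σ ⟨$⟩ˡ_))

  decode-encode : ∀ {n} (σ : Permutation′ n) x → decodePerm n (encodePerm σ) ⟨$⟩ʳ x ≡ σ ⟨$⟩ʳ x
  decode-encode {n} σ x = trans
    (cong (λ c → pairPerm c ⟨$⟩ʳ x) (Fin.remQuot-combine {n ^ n} (funToFin (σ ⟨$⟩ʳ_)) (funToFin (σ ⟨$⟩ˡ_))))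
    (trans (mkPerm-to f g (fg , gf) x) (f≗ x))
    where
    f  = finToFun (funToFin (σ ⟨$⟩ʳ_))
    g  = finToFun (funToFin (σ ⟨$⟩ˡ_))
    f≗ : f ≗ (σ ⟨$⟩ʳ_)
    f≗ = Fin.finToFun-funToFin (σ ⟨$⟩ʳ_)
    g≗ : g ≗ (σ ⟨$⟩ˡ_)
    g≗ = Fin.finToFun-funToFin (σ ⟨$⟩ˡ_)
    fg : ∀ y → f (g y) ≡ y
    fg y = trans (f≗ (g y)) (trans (cong (σ ⟨$⟩ʳ_) (g≗ y)) (inverseʳ σ))
    gf : ∀ y → g (f y) ≡ y
    gf y = trans (g≗ (f y)) (trans (cong (σ ⟨$⟩ˡ_) (f≗ y)) (inverseˡ σ))

  decode : ∀ n m → Fin (PermCode n ^ m) → Schedule n m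
  decode n m c i = decodePerm n (finToFun c i)

  encode : ∀ {n m} → Schedule n m → Fin (PermCode n ^ m)
  encode π = funToFin (λ i → encodePerm (π i))

  decode-encode′ : ∀ {n m} (π : Schedule n m) i x → decode n m (encode π) i ⟨$⟩ʳ x ≡ π i ⟨$⟩ʳ x
  decode-encode′ π i x
    rewrite Fin.finToFun-funToFin (λ i → encodePerm (π i)) i = decode-encode (π i) x

objective-cong : ∀ {n m} (I : Instance n m) (π ρ : Schedule n m) →
                 (∀ i j → π i ⟨$⟩ʳ j ≡ ρ i ⟨$⟩ʳ j) → objective I π ≡ objective I ρ
objective-cong {n} {m} I π ρ eq =
  cong (max 0) (map-cong (λ j → cong sum (map-cong (λ i → job i j) (allFin m))) (allFin n))
  where
  job : ∀ i j → jobCompletion I π i j ≡ jobCompletion I ρ i j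
  job i j = cong (λ xs → sum (map (p I) xs)) (filter-≐ _ _
    ( (λ {ℓ} le → subst₂′ (eq i ℓ) (eq i j) le)
    , (λ {ℓ} le → subst₂′ (sym (eq i ℓ)) (sym (eq i j)) le)) (allFin n))
    where
    subst₂′ : ∀ {a b c d : Fin n} → a ≡ b → c ≡ d → a Fin.≤ c → b Fin.≤ d
    subst₂′ refl refl le = le

optimum-exists : ∀ {n m} (I : Instance n m) → ∃[ K* ] IsOptimum I K*
optimum-exists {n} {m} I = value best , (decode n m best , refl) , λ π →
  ≤-trans (best≤ (encode π))
          (≤-reflexive (objective-cong I (decode n m (encode π)) π (decode-encode′ π)))
  where
  value : Fin (PermCode n ^ m) → ℕ
  value c = objective I (decode n m c)
  start best : Fin (PermCode n ^ m)
  start = encode {n} {m} (λ _ → Perm.id)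
  best  = Extrema.argmin value start (allFin _)
  best≤ : ∀ c → value best ≤ value c
  best≤ c = All.lookup (Extrema.f[argmin]≤f[xs] {f = value} start (allFin _)) (∈-allFin c)

------------------------------------------------------------------------
-- Model of computation: structured programs on a word RAM, with finitely
-- many named registers and an indirectly addressed memory. Arithmetic on
-- words costs one step, and an execution is only defined if every value
-- it computes fits in a word, i.e. is at most W.

data Op : Set where
  add sub mul div : Op

⟦_⟧ : Op → ℕ → ℕ → ℕ
⟦ add ⟧ a b       = a + b
⟦ sub ⟧ a b       = a ∸ b
⟦ mul ⟧ a b       = a * b
⟦ div ⟧ a zero    = 0
⟦ div ⟧ a (suc b) = a / suc b

data Expr : Set where
  lit  : ℕ → Expr
  reg  : ℕ → Expr
  load : Expr → Expr
  op   : Op → Expr → Expr → Expr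

infixr 5 _⨾_
data Cmd : Set where
  skip  : Cmd
  set   : ℕ → Expr → Cmd
  store : Expr → Expr → Cmd
  _⨾_   : Cmd → Cmd → Cmd
  ifnz  : Expr → Cmd → Cmd → Cmd
  while : Expr → Cmd → Cmd

record State : Set where
  constructor ⟨_,_⟩
  field
    regs : ℕ → ℕ
    mem  : ℕ → ℕ

open State public

_[_↦_] : (ℕ → ℕ) → ℕ → ℕ → (ℕ → ℕ)
(f [ x ↦ v ]) y = if does (x ≟ y) then v else f y

eval : State → Expr → ℕ
eval s (lit k)    = k
eval s (reg x)    = regs s x
eval s (load e)   = mem s (eval s e)
eval s (op o a b) = ⟦ o ⟧ (eval s a) (eval s b)

cost : Expr → ℕ
cost (lit _)    = 1
cost (reg _)    = 1
cost (load e)   = 1 + cost e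
cost (op _ a b) = 1 + cost a + cost b

-- Every intermediate value fits, not only the final one.
Fits : ℕ → State → Expr → Set
Fits W s (lit k)      = k ≤ W
Fits W s (reg x)      = regs s x ≤ W
Fits W s e@(load a)   = Fits W s a × eval s e ≤ W
Fits W s e@(op _ a b) = Fits W s a × Fits W s b × eval s e ≤ W

-- W ⊢ c , s ⇓[ t ] s′ : with words bounded by W, running c from s halts
-- in s′ after t steps.
data _⊢_,_⇓[_]_ (W : ℕ) : Cmd → State → ℕ → State → Set where
  ⇓skip  : ∀ {s} → W ⊢ skip , s ⇓[ 1 ] s
  ⇓set   : ∀ {s x e} → Fits W s e →
           W ⊢ set x e , s ⇓[ 1 + cost e ] ⟨ regs s [ x ↦ eval s e ] , mem s ⟩
  ⇓store : ∀ {s a e} → Fits W s a → Fits W s e →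
           W ⊢ store a e , s ⇓[ 1 + cost a + cost e ] ⟨ regs s , mem s [ eval s a ↦ eval s e ] ⟩
  ⇓seq   : ∀ {s s₁ s₂ c₁ c₂ t₁ t₂} →
           W ⊢ c₁ , s ⇓[ t₁ ] s₁ → W ⊢ c₂ , s₁ ⇓[ t₂ ] s₂ →
           W ⊢ c₁ ⨾ c₂ , s ⇓[ t₁ + t₂ ] s₂
  ⇓then  : ∀ {s s′ e c₁ c₂ t} → Fits W s e → eval s e ≢ 0 →
           W ⊢ c₁ , s ⇓[ t ] s′ →
           W ⊢ ifnz e c₁ c₂ , s ⇓[ 1 + cost e + t ] s′
  ⇓else  : ∀ {s s′ e c₁ c₂ t} → Fits W s e → eval s e ≡ 0 →
           W ⊢ c₂ , s ⇓[ t ] s′ →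
           W ⊢ ifnz e c₁ c₂ , s ⇓[ 1 + cost e + t ] s′
  ⇓loop  : ∀ {s s₁ s₂ e c t₁ t₂} → Fits W s e → eval s e ≢ 0 →
           W ⊢ c , s ⇓[ t₁ ] s₁ → W ⊢ while e c , s₁ ⇓[ t₂ ] s₂ →
           W ⊢ while e c , s ⇓[ 1 + cost e + t₁ + t₂ ] s₂
  ⇓exit  : ∀ {s e c} → Fits W s e → eval s e ≡ 0 →
           W ⊢ while e c , s ⇓[ 1 + cost e ] s

------------------------------------------------------------------------
-- Input and output conventions

-- Registers 0 and 1 hold n and m, memory cells 0, …, n - 1 hold the
-- processing times, and everything else is 0.
input : ∀ {n m} → Instance n m → State
input {n} {m} I = ⟨ (λ { 0 → n ; 1 → m ; _ → 0 }) , cells n (p I) ⟩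
  where
  cells : ∀ k → (Fin k → ℕ) → ℕ → ℕ
  cells zero    f _       = 0
  cells (suc k) f zero    = f Fin.zero
  cells (suc k) f (suc a) = cells k (λ j → f (Fin.suc j)) a

-- The running time does not depend on the number m of days, so a schedule
-- cannot be written out day by day. It is output run-length encoded: a
-- block (k , σ) stands for k consecutive days on which the order is σ.
Block : ℕ → Set
Block n = ℕ × Permutation′ n

expand : ∀ {n} → List (Block n) → List (Permutation′ n)
expand = concatMap (λ (k , σ) → replicate k σ)

-- A block occupies n + 1 cells: k, then the positions of clients 0, …, n - 1.
StoredAt : ∀ {n} → (ℕ → ℕ) → ℕ → List (Block n) → Set
StoredAt         μ a []             = ⊤
StoredAt {n = n} μ a ((k , σ) ∷ bs) =
  μ a ≡ k × (∀ j → μ (a + suc (toℕ j)) ≡ toℕ (σ ⟨$⟩ʳ j)) × StoredAt μ (a + suc n) bs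

-- Register 0 holds the address of the first block, register 1 the number
-- of blocks.
Outputs : ∀ {n m} → State → Schedule n m → Set
Outputs {n} s π = Σ[ bs ∈ List (Block n) ]
  regs s 1 ≡ length bs × StoredAt (mem s) (regs s 0) bs × expand bs ≡ tabulate π

-- Words have O(log (N + T)) bits, where N is the largest number in the input
-- and T the running time.
wordBound : ∀ {n m} → ℕ → ℕ → Instance n m → ℕ
wordBound {n} {m} d T I = (2 + (N + T)) ^ d
  where N = n ⊔ m ⊔ max 0 (map (p I) (allFin n))

-- On input I, `prog` outputs π within T steps.
Computes : ∀ {n m} → ℕ → ℕ → Cmd → Instance n m → Schedule n m → Set
Computes d T prog I π = ∃[ t ] ∃[ s ]
  wordBound d T I ⊢ prog , input I ⇓[ t ] s × t ≤ T × Outputs s π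

------------------------------------------------------------------------
-- The running time

-- log log n, rounded up and replaced by 1 where it is smaller than 1.
loglog : ℕ → ℕ
loglog n = 1 ⊔ ⌈log₂ ⌈log₂ n ⌉ ⌉

-- ⌈ log log n / ε⁹ ⌉, which is at least 1 because loglog n is.
ratio : (ε : ℚ) → .{{Positive ε}} → ℕ → ℕ
ratio ε n = ℤ.∣ ceiling ((+ loglog n ℚ./ 1) ℚ.* (ℚ.+-*-rawSemiring ⟨ 1/ε ⟩^ 9)) ∣
  where 1/ε = (ℚ.1/ ε) {{pos⇒nonZero ε}}

-- A function is Õ(f) iff it is at most softO C c f for some constants C, c.
-- (log f is replaced by 1 where it is smaller, so that softO C c 1 ≠ 0.)
softO : ℕ → ℕ → ℕ → ℕ
softO C c f = C * (f * (1 ⊔ ⌈log₂ f ⌉) ^ c)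

timeBound : (A C c : ℕ) (ε : ℚ) → .{{Positive ε}} → ℕ → ℕ
timeBound A C c ε n = A * n ^ softO C c (ratio ε n)

{-# OPTIONS --safe #-}
module Submission where

-- Client j belongs to the cell ⌊L S / P⌋, where S is the processing time of the
-- clients before j and P that of all clients. It suffices to consider
-- schedules that, on each day, order the clients by a rank of their cells:
-- draw a representative of each cell, with probabilities proportional to the
-- processing times, and rank the cells by the completion times of their
-- representatives in an optimal schedule, rounded to H levels. Since a cell
-- without its last client has mass at most P / L, the mass scheduled up to a
-- given level on a given day has variance at most P² / L, and conditional
-- expectations make the choice deterministic. In the same way, boundedly many
-- days represent all m of them. Errors of order m P / H in a total completion
-- time are harmless because m P ≤ 2 K*.
--
-- So a near-optimal schedule is determined by the sizes of the cells, rounded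
-- to multiples of P / V, and by min(m, M₀). For fixed ε this leaves boundedly
-- many cases: the program measures the cells and descends a decision tree, at
-- the leaves of which optimal solutions of the rounded instances are
-- hard-wired. It takes O(n ⌈1/ε⌉¹⁸) steps.

open import Defs
import Algebra.Properties.CommutativeSemigroup as CSG
open import Algebra.Definitions.RawSemiring using () renaming (_^_ to _⟨_⟩^_)
open import Data.Bool.Base as Bool using (true; false)
open import Data.Fin.Base as Fin using (Fin; toℕ)
open import Data.Fin.Permutation as Perm using (Permutation′; _⟨$⟩ʳ_)
import Data.Fin.Properties as Fin
import Data.Integer.Base as ℤ
open ℤ using (ℤ; 0ℤ)
import Data.Integer.DivMod as ℤ
import Data.Integer.Properties as ℤ
import Data.Integer.Tactic.RingSolver as ℤ-Solver
open import Data.List.Base using (List; []; _∷_; _++_; map; filter; length; allFin; cartesianProduct; replicate; lookup; tabulate)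
import Data.List.Extrema.Nat as Extrema
open Extrema using (max)
open import Data.List.Membership.Propositional using (_∈_)
open import Data.List.Membership.Propositional.Properties using (∈-allFin)
open import Data.List.Properties using (map-tabulate; length-tabulate; length-++; length-map; tabulate-lookup; map-++; map-∘; ++-identityʳ)
open import Data.List.Relation.Unary.All as All using (All; []; _∷_)
import Data.List.Relation.Unary.All.Properties as All
open import Data.List.Relation.Unary.Any using (here; there)
open import Data.Product.Base using (∃-syntax; Σ-syntax; _×_; _,_; proj₁; proj₂)
import Data.Rational.Base as ℚ
open ℚ using (ℚ; mkℚ; 1ℚ; Positive; ↥_; ↧_; toℚᵘ)
import Data.Rational.Properties as ℚ
import Data.Rational.Unnormalised.Base as ℚᵘ
import Data.Rational.Unnormalised.Properties as ℚᵘ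
open import Data.Sum.Base using (_⊎_; inj₁; inj₂; map₂)
import Data.Vec.Functional as Vector
open import Function.Base using (_∘_; id)
open import Level using (0ℓ)
open import Relation.Binary.Definitions using (tri<; tri≈; tri>)
open import Relation.Binary.PropositionalEquality
open import Relation.Nullary.Decidable using (Dec; yes; no)
open import Relation.Nullary.Negation using (¬_; contradiction)
open import Relation.Unary using (Pred; Decidable)

-- Five approximations are made, each costing at most `m * P / H` in a total completion time:
-- rounding completion times to levels, letting representatives stand for their cells, sampling
-- days, rounding sizes, and ordering the leftover days of a periodic schedule arbitrarily. As
-- `m * P` is at most twice the optimum, together they cost a fraction `10 / H` of it, whence
-- `H = 10 * inverse ε`. The other parameters follow. `L = suc H * (H * H)`: a variance of `P² / L`
-- on each of `suc H` levels and `m` days leaves `m * P² / H²` for all squared deviations, hence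
-- `m * P / H` for a sum of one deviation per day. `M = L * (H * H)`: the sampled days must serve
-- `L` cells at once. `V = L * H`: each of `L` cells is off by less than `P / V`. `M₀ = H * M`:
-- fewer than `M` out of at least `M₀` days are left over. All inequalities are multiplied out, so
-- that they live in the natural numbers or the integers; rationals occur only in the final
-- comparison with `1 + ε` and in `ratio`.

module Scheme where

  open import Data.Nat.Base
  open import Data.Nat.DivMod hiding (_div_; _mod_)
  open import Data.Nat.ListAction using (sum)
  open import Data.Nat.Logarithm using (⌈log₂_⌉)
  open import Data.Nat.Properties
  open import Data.Nat.Tactic.RingSolver using (solve-∀)

  private
    variable
      A B : Set

  -- Finite sums of natural numbers

  ∑ : List A → (A → ℕ) → ℕ
  ∑ xs f = sum (map f xs)

  syntax ∑ xs (λ x → e) = ∑[ x ← xs ] e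

  ind : ∀ {P : Set} → Dec P → ℕ
  ind (yes _) = 1
  ind (no  _) = 0

  ind-yes : ∀ {P : Set} (d : Dec P) → P → ind d ≡ 1
  ind-yes (yes _) _ = refl
  ind-yes (no ¬p) p = contradiction p ¬p

  ind-no : ∀ {P : Set} (d : Dec P) → ¬ P → ind d ≡ 0
  ind-no (yes p) ¬p = contradiction p ¬p
  ind-no (no _)  _  = refl

  ind≤1 : ∀ {P : Set} (d : Dec P) → ind d ≤ 1
  ind≤1 (yes _) = ≤-refl
  ind≤1 (no _)  = z≤n

  ind*≤ : ∀ {P : Set} (d : Dec P) k → ind d * k ≤ k
  ind*≤ (yes _) k = ≤-reflexive (+-identityʳ k)
  ind*≤ (no _)  k = z≤n

  ind-idem : ∀ {P : Set} (d : Dec P) → ind d * ind d ≡ ind d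
  ind-idem (yes _) = refl
  ind-idem (no _)  = refl

  ind-mono : ∀ {P Q : Set} (d : Dec P) (e : Dec Q) → (P → Q) → ind d ≤ ind e
  ind-mono (yes p) e f = ≤-reflexive (sym (ind-yes e (f p)))
  ind-mono (no _)  e f = z≤n

  ind-⇔ : ∀ {P Q : Set} (d : Dec P) (e : Dec Q) → (P → Q) → (Q → P) → ind d ≡ ind e
  ind-⇔ d e f g = ≤-antisym (ind-mono d e f) (ind-mono e d g)

  ∑-cong : ∀ (xs : List A) {f g} → (∀ x → f x ≡ g x) → ∑ xs f ≡ ∑ xs g
  ∑-cong []       eq = refl
  ∑-cong (x ∷ xs) eq = cong₂ _+_ (eq x) (∑-cong xs eq)

  ∑-mono : ∀ (xs : List A) {f g} → (∀ x → f x ≤ g x) → ∑ xs f ≤ ∑ xs g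
  ∑-mono []       le = z≤n
  ∑-mono (x ∷ xs) le = +-mono-≤ (le x) (∑-mono xs le)

  ∑-+ : ∀ (xs : List A) f g → ∑[ x ← xs ] (f x + g x) ≡ ∑ xs f + ∑ xs g
  ∑-+ []       f g = refl
  ∑-+ (x ∷ xs) f g rewrite ∑-+ xs f g = CSG.interchange +-commutativeSemigroup (f x) (g x) _ _

  ∑-*ˡ : ∀ (xs : List A) c f → ∑[ x ← xs ] (c * f x) ≡ c * ∑ xs f
  ∑-*ˡ []       c f = sym (*-zeroʳ c)
  ∑-*ˡ (x ∷ xs) c f rewrite ∑-*ˡ xs c f = sym (*-distribˡ-+ c (f x) _)

  ∑-*ʳ : ∀ (xs : List A) c f → ∑[ x ← xs ] (f x * c) ≡ ∑ xs f * c
  ∑-*ʳ []       c f = refl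
  ∑-*ʳ (x ∷ xs) c f rewrite ∑-*ʳ xs c f = sym (*-distribʳ-+ c (f x) _)

  ∑-const : ∀ (xs : List A) c → ∑[ _ ← xs ] c ≡ length xs * c
  ∑-const []       c = refl
  ∑-const (x ∷ xs) c = cong (c +_) (∑-const xs c)

  ∑-zero : ∀ (xs : List A) → ∑[ _ ← xs ] 0 ≡ 0
  ∑-zero xs = trans (∑-const xs 0) (*-zeroʳ (length xs))

  ∑-swap : ∀ (xs : List A) (ys : List B) (f : A → B → ℕ) →
           ∑[ x ← xs ] ∑[ y ← ys ] f x y ≡ ∑[ y ← ys ] ∑[ x ← xs ] f x y
  ∑-swap []       ys f = sym (∑-zero ys)
  ∑-swap (x ∷ xs) ys f =
    trans (cong (∑ ys (f x) +_) (∑-swap xs ys f)) (sym (∑-+ ys (f x) _))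

  ∑-++ : ∀ (xs ys : List A) f → ∑ (xs ++ ys) f ≡ ∑ xs f + ∑ ys f
  ∑-++ []       ys f = refl
  ∑-++ (x ∷ xs) ys f rewrite ∑-++ xs ys f = sym (+-assoc (f x) _ _)

  ∑-replicate : ∀ k (x : A) f → ∑ (replicate k x) f ≡ k * f x
  ∑-replicate zero    x f = refl
  ∑-replicate (suc k) x f = cong (f x +_) (∑-replicate k x f)

  ∑-∈ : ∀ {xs : List A} {x} f → x ∈ xs → f x ≤ ∑ xs f
  ∑-∈ {xs = _ ∷ xs} f (here refl) = m≤m+n _ _
  ∑-∈ {xs = y ∷ xs} f (there x∈)  = ≤-trans (∑-∈ f x∈) (m≤n+m _ (f y))

  ∑-filter : ∀ {P : Pred A 0ℓ} (P? : Decidable P) xs f →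
             sum (map f (filter P? xs)) ≡ ∑[ x ← xs ] (ind (P? x) * f x)
  ∑-filter P? []       f = refl
  ∑-filter P? (x ∷ xs) f with P? x
  ... | yes _ = cong₂ _+_ (sym (+-identityʳ (f x))) (∑-filter P? xs f)
  ... | no  _ = ∑-filter P? xs f

  length-allFin : ∀ n → length (allFin n) ≡ n
  length-allFin n = length-tabulate {n = n} (λ i → i)

  ∑-const-Fin : ∀ n c → ∑[ _ ← allFin n ] c ≡ n * c
  ∑-const-Fin n c = trans (∑-const (allFin n) c) (cong (_* c) (length-allFin n))

  ∑-≤-const : ∀ n f c → (∀ i → f i ≤ c) → ∑ (allFin n) f ≤ n * c
  ∑-≤-const n f c le = ≤-trans (∑-mono (allFin n) le) (≤-reflexive (∑-const-Fin n c))

  ∑-suc : ∀ n (f : Fin (suc n) → ℕ) → ∑ (allFin (suc n)) f ≡ f Fin.zero + ∑ (allFin n) (f ∘ Fin.suc)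
  ∑-suc n f = cong (f Fin.zero +_) (cong sum
    (trans (map-tabulate Fin.suc f) (sym (map-tabulate (λ i → i) (f ∘ Fin.suc)))))

  ∑-single : ∀ {n} {Q : Fin n → Set} (d : ∀ x → Dec (Q x)) (f : Fin n → ℕ) {k} →
             Q k → (∀ x → Q x → x ≡ k) → ∑[ x ← allFin n ] (ind (d x) * f x) ≡ f k
  ∑-single {suc n} d f {Fin.zero} Qk uniq =
    trans (∑-suc n _) (trans (cong₂ _+_
      (trans (cong (_* f Fin.zero) (ind-yes (d Fin.zero) Qk)) (+-identityʳ _))
      (trans (∑-cong (allFin n) λ x → cong (_* f (Fin.suc x)) (ind-no (d (Fin.suc x)) λ q → Fin.0≢1+n (sym (uniq _ q))))
             (∑-zero (allFin n))))
      (+-identityʳ (f Fin.zero)))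
  ∑-single {suc n} d f {Fin.suc k} Qk uniq =
    trans (∑-suc n _) (cong₂ _+_
      (cong (_* f Fin.zero) (ind-no (d Fin.zero) λ q → Fin.0≢1+n (uniq _ q)))
      (∑-single (d ∘ Fin.suc) (f ∘ Fin.suc) Qk (λ x q → Fin.suc-injective (uniq _ q))))

  ≤-max : ∀ {xs : List A} {x} (f : A → ℕ) → x ∈ xs → f x ≤ max 0 (map f xs)
  ≤-max {xs = xs} f x∈ = All.lookup (All.map⁻ (Extrema.xs≤max 0 (map f xs))) x∈

  *-max-≤ : ∀ {c} k (xs : List A) (f : A → ℕ) → (∀ x → k * f x ≤ c) → k * max 0 (map f xs) ≤ c
  *-max-≤ {c = c} k xs f le = Extrema.argmax-all id {P = λ v → k * v ≤ c}
    (≤-trans (≤-reflexive (*-zeroʳ k)) z≤n) (All.map⁺ (All.universal le xs))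

  -- Finite sums of integers

  ∑ℤ : List A → (A → ℤ) → ℤ
  ∑ℤ []       f = 0ℤ
  ∑ℤ (x ∷ xs) f = f x ℤ.+ ∑ℤ xs f

  syntax ∑ℤ xs (λ x → e) = ∑ℤ[ x ← xs ] e

  sq : ℤ → ℤ
  sq x = x ℤ.* x

  sq≥0 : ∀ x → 0ℤ ℤ.≤ sq x
  sq≥0 (ℤ.+ n)     = subst (0ℤ ℤ.≤_) (ℤ.pos-* n n) (ℤ.+≤+ z≤n)
  sq≥0 (ℤ.-[1+ n ]) = ℤ.+≤+ z≤n

  pos-∑ : ∀ (xs : List A) f → ℤ.+ (∑ xs f) ≡ ∑ℤ[ x ← xs ] (ℤ.+ f x)
  pos-∑ []       f = refl
  pos-∑ (x ∷ xs) f = trans (ℤ.pos-+ (f x) _) (cong (λ y → ℤ.+ f x ℤ.+ y) (pos-∑ xs f))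

  ∑ℤ-cong : ∀ (xs : List A) {f g} → (∀ x → f x ≡ g x) → ∑ℤ xs f ≡ ∑ℤ xs g
  ∑ℤ-cong []       eq = refl
  ∑ℤ-cong (x ∷ xs) eq = cong₂ ℤ._+_ (eq x) (∑ℤ-cong xs eq)

  ∑ℤ-mono : ∀ (xs : List A) {f g} → (∀ x → f x ℤ.≤ g x) → ∑ℤ xs f ℤ.≤ ∑ℤ xs g
  ∑ℤ-mono []       le = ℤ.≤-refl
  ∑ℤ-mono (x ∷ xs) le = ℤ.+-mono-≤ (le x) (∑ℤ-mono xs le)

  ∑ℤ-+ : ∀ (xs : List A) f g → ∑ℤ[ x ← xs ] (f x ℤ.+ g x) ≡ ∑ℤ xs f ℤ.+ ∑ℤ xs g
  ∑ℤ-+ []       f g = refl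
  ∑ℤ-+ (x ∷ xs) f g rewrite ∑ℤ-+ xs f g = interchange (f x) (g x) _ _
    where
    interchange : ∀ a b c d → (a ℤ.+ b) ℤ.+ (c ℤ.+ d) ≡ (a ℤ.+ c) ℤ.+ (b ℤ.+ d)
    interchange = ℤ-Solver.solve-∀

  ∑ℤ-*ˡ : ∀ (xs : List A) c f → ∑ℤ[ x ← xs ] (c ℤ.* f x) ≡ c ℤ.* ∑ℤ xs f
  ∑ℤ-*ˡ []       c f = sym (ℤ.*-zeroʳ c)
  ∑ℤ-*ˡ (x ∷ xs) c f rewrite ∑ℤ-*ˡ xs c f = sym (ℤ.*-distribˡ-+ c (f x) _)

  ∑ℤ-*ʳ : ∀ (xs : List A) c f → ∑ℤ[ x ← xs ] (f x ℤ.* c) ≡ ∑ℤ xs f ℤ.* c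
  ∑ℤ-*ʳ []       c f = sym (ℤ.*-zeroˡ c)
  ∑ℤ-*ʳ (x ∷ xs) c f rewrite ∑ℤ-*ʳ xs c f = sym (ℤ.*-distribʳ-+ c (f x) _)

  ∑ℤ-zero : ∀ (xs : List A) → ∑ℤ[ _ ← xs ] 0ℤ ≡ 0ℤ
  ∑ℤ-zero []       = refl
  ∑ℤ-zero (x ∷ xs) = trans (ℤ.+-identityˡ _) (∑ℤ-zero xs)

  ∑ℤ-swap : ∀ (xs : List A) (ys : List B) (f : A → B → ℤ) →
            ∑ℤ[ x ← xs ] ∑ℤ[ y ← ys ] f x y ≡ ∑ℤ[ y ← ys ] ∑ℤ[ x ← xs ] f x y
  ∑ℤ-swap []       ys f = sym (∑ℤ-zero ys)
  ∑ℤ-swap (x ∷ xs) ys f =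
    trans (cong (λ z → ∑ℤ ys (f x) ℤ.+ z) (∑ℤ-swap xs ys f)) (sym (∑ℤ-+ ys (f x) _))

  ∑ℤ-suc : ∀ n (f : Fin (suc n) → ℤ) → ∑ℤ (allFin (suc n)) f ≡ f Fin.zero ℤ.+ ∑ℤ (allFin n) (f ∘ Fin.suc)
  ∑ℤ-suc n f = cong (λ z → f Fin.zero ℤ.+ z) (trans (cong (λ xs → ∑ℤ xs f) (sym (map-tabulate id Fin.suc))) (∑ℤ-map (allFin n)))
    where
    ∑ℤ-map : ∀ xs → ∑ℤ (map Fin.suc xs) f ≡ ∑ℤ xs (f ∘ Fin.suc)
    ∑ℤ-map []       = refl
    ∑ℤ-map (x ∷ xs) = cong (λ z → f (Fin.suc x) ℤ.+ z) (∑ℤ-map xs)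

  ∑ℤ≥0 : ∀ (xs : List A) (f : A → ℤ) → (∀ x → 0ℤ ℤ.≤ f x) → 0ℤ ℤ.≤ ∑ℤ xs f
  ∑ℤ≥0 xs f f≥0 = ℤ.≤-trans (ℤ.≤-reflexive (sym (∑ℤ-zero xs))) (∑ℤ-mono xs f≥0)

  ∑ℤ-∈ : ∀ n (f : Fin n → ℤ) → (∀ j → 0ℤ ℤ.≤ f j) → ∀ i → f i ℤ.≤ ∑ℤ (allFin n) f
  ∑ℤ-∈ (suc n) f f≥0 Fin.zero = ℤ.≤-trans (ℤ.≤-reflexive (sym (ℤ.+-identityʳ (f Fin.zero))))
    (ℤ.≤-trans (ℤ.+-monoʳ-≤ (f Fin.zero) (∑ℤ≥0 (allFin n) (f ∘ Fin.suc) (f≥0 ∘ Fin.suc)))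
               (ℤ.≤-reflexive (sym (∑ℤ-suc n f))))
  ∑ℤ-∈ (suc n) f f≥0 (Fin.suc i) = ℤ.≤-trans (∑ℤ-∈ n (f ∘ Fin.suc) (f≥0 ∘ Fin.suc) i)
    (ℤ.≤-trans (ℤ.≤-reflexive (sym (ℤ.+-identityˡ _)))
    (ℤ.≤-trans (ℤ.+-monoˡ-≤ _ (f≥0 Fin.zero)) (ℤ.≤-reflexive (sym (∑ℤ-suc n f)))))

  -- Derandomised balancing

  -- The averaging argument without division. If no value is at most `β`, every value is at least
  -- `β + 1` by integrality, and since the total weight is positive the weighted sum exceeds its
  -- bound.
  ∃≤-average : ∀ (xs : List A) (w : A → ℕ) (f : A → ℤ) β → 0 < ∑ xs w →
               ∑ℤ[ x ← xs ] (ℤ.+ w x ℤ.* f x) ℤ.≤ ℤ.+ ∑ xs w ℤ.* β → ∃[ x ] f x ℤ.≤ β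
  ∃≤-average {A} xs w f β W>0 le with search xs
    where
    search : ∀ ys → (∃[ x ] f x ℤ.≤ β) ⊎
             ∑ℤ[ x ← ys ] (ℤ.+ w x ℤ.* ℤ.suc β) ℤ.≤ ∑ℤ[ x ← ys ] (ℤ.+ w x ℤ.* f x)
    search []       = inj₂ ℤ.≤-refl
    search (y ∷ ys) with f y ℤ.≤? β | search ys
    ... | yes fy≤β | _       = inj₁ (y , fy≤β)
    ... | no  _    | inj₁ ∃x = inj₁ ∃x
    ... | no  fy≰β | inj₂ le′ = inj₂ (ℤ.+-mono-≤ (ℤ.*-monoˡ-≤-nonNeg (ℤ.+ w y) (ℤ.i<j⇒suc[i]≤j (ℤ.≰⇒> fy≰β))) le′)
  ... | inj₁ ∃x  = ∃x
  ... | inj₂ le′ = contradiction (ℤ.≤-trans (subst (ℤ._≤ _) Σ≡ le′) le) (ℤ.<⇒≱ W+>)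
    where
    W = ∑ xs w
    Σ≡ : ∑ℤ[ x ← xs ] (ℤ.+ w x ℤ.* ℤ.suc β) ≡ ℤ.+ W ℤ.* ℤ.suc β
    Σ≡ = trans (∑ℤ-*ʳ xs (ℤ.suc β) _) (cong (ℤ._* ℤ.suc β) (sym (pos-∑ xs w)))
    W+> : ℤ.+ W ℤ.* β ℤ.< ℤ.+ W ℤ.* ℤ.suc β
    W+> = ℤ.*-monoˡ-<-pos (ℤ.+ W) {{ℤ.positive (ℤ.+<+ W>0)}} (ℤ.suc[i]≤j⇒i<j ℤ.≤-refl)

  -- The method of conditional expectations: the cross term vanishes on average.
  balance-step : ∀ (xs : List A) (R : List B) (w : A → ℕ) (v : A → B → ℤ) β (X : B → ℤ) → 0 < ∑ xs w →
                 (∀ r → ∑ℤ[ a ← xs ] (ℤ.+ w a ℤ.* v a r) ≡ 0ℤ) →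
                 ∑ℤ[ a ← xs ] (ℤ.+ w a ℤ.* ∑ℤ[ r ← R ] sq (v a r)) ℤ.≤ ℤ.+ ∑ xs w ℤ.* β →
                 ∃[ a ] ∑ℤ[ r ← R ] sq (X r ℤ.+ v a r) ℤ.≤ ∑ℤ[ r ← R ] sq (X r) ℤ.+ β
  balance-step {A} {B} xs R w v β X W>0 mean var =
    ∃≤-average xs w _ _ W>0 (ℤ.≤-trans (ℤ.≤-reflexive eq)
      (ℤ.≤-trans (ℤ.+-monoʳ-≤ (W ℤ.* SX) var) (ℤ.≤-reflexive (sym (ℤ.*-distribˡ-+ W SX β)))))
    where
    open ≡-Reasoning
    W  = ℤ.+ ∑ xs w
    SX = ∑ℤ[ r ← R ] sq (X r)
    2ℤ = ℤ.+ 2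
    sq-+ : ∀ x v → sq (x ℤ.+ v) ≡ sq x ℤ.+ (2ℤ ℤ.* (x ℤ.* v) ℤ.+ sq v)
    sq-+ = sq-+′
      where
      sq-+′ : ∀ x v → (x ℤ.+ v) ℤ.* (x ℤ.+ v) ≡ x ℤ.* x ℤ.+ (2ℤ ℤ.* (x ℤ.* v) ℤ.+ v ℤ.* v)
      sq-+′ = ℤ-Solver.solve-∀
    inner : ∀ a → ∑ℤ[ r ← R ] sq (X r ℤ.+ v a r) ≡ SX ℤ.+ (2ℤ ℤ.* ∑ℤ[ r ← R ] (X r ℤ.* v a r) ℤ.+ ∑ℤ[ r ← R ] sq (v a r))
    inner a = begin
      ∑ℤ[ r ← R ] sq (X r ℤ.+ v a r)
        ≡⟨ ∑ℤ-cong R (λ r → sq-+ (X r) (v a r)) ⟩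
      ∑ℤ[ r ← R ] (sq (X r) ℤ.+ (2ℤ ℤ.* (X r ℤ.* v a r) ℤ.+ sq (v a r)))
        ≡⟨ ∑ℤ-+ R (sq ∘ X) _ ⟩
      SX ℤ.+ ∑ℤ[ r ← R ] (2ℤ ℤ.* (X r ℤ.* v a r) ℤ.+ sq (v a r))
        ≡⟨ cong (λ z → SX ℤ.+ z) (trans (∑ℤ-+ R _ _) (cong (λ z → z ℤ.+ _) (∑ℤ-*ˡ R 2ℤ _))) ⟩
      SX ℤ.+ (2ℤ ℤ.* ∑ℤ[ r ← R ] (X r ℤ.* v a r) ℤ.+ ∑ℤ[ r ← R ] sq (v a r)) ∎
    cross : ∑ℤ[ a ← xs ] (ℤ.+ w a ℤ.* ∑ℤ[ r ← R ] (X r ℤ.* v a r)) ≡ 0ℤ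
    cross = begin
      ∑ℤ[ a ← xs ] (ℤ.+ w a ℤ.* ∑ℤ[ r ← R ] (X r ℤ.* v a r))
        ≡⟨ ∑ℤ-cong xs (λ a → sym (∑ℤ-*ˡ R (ℤ.+ w a) _)) ⟩
      ∑ℤ[ a ← xs ] ∑ℤ[ r ← R ] (ℤ.+ w a ℤ.* (X r ℤ.* v a r))
        ≡⟨ ∑ℤ-swap xs R _ ⟩
      ∑ℤ[ r ← R ] ∑ℤ[ a ← xs ] (ℤ.+ w a ℤ.* (X r ℤ.* v a r))
        ≡⟨ ∑ℤ-cong R (λ r → trans (∑ℤ-cong xs (λ a → left-comm (ℤ.+ w a) (X r) (v a r)))
                          (trans (∑ℤ-*ˡ xs (X r) _) (trans (cong (X r ℤ.*_) (mean r)) (ℤ.*-zeroʳ (X r))))) ⟩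
      ∑ℤ[ r ← R ] 0ℤ
        ≡⟨ ∑ℤ-zero R ⟩
      0ℤ ∎
      where
      left-comm : ∀ a b c → a ℤ.* (b ℤ.* c) ≡ b ℤ.* (a ℤ.* c)
      left-comm = ℤ-Solver.solve-∀
    eq : ∑ℤ[ a ← xs ] (ℤ.+ w a ℤ.* ∑ℤ[ r ← R ] sq (X r ℤ.+ v a r)) ≡ W ℤ.* SX ℤ.+ ∑ℤ[ a ← xs ] (ℤ.+ w a ℤ.* ∑ℤ[ r ← R ] sq (v a r))
    eq = begin
      ∑ℤ[ a ← xs ] (ℤ.+ w a ℤ.* ∑ℤ[ r ← R ] sq (X r ℤ.+ v a r))
        ≡⟨ ∑ℤ-cong xs (λ a → trans (cong (ℤ.+ w a ℤ.*_) (inner a)) (split (ℤ.+ w a) SX _ _)) ⟩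
      ∑ℤ[ a ← xs ] (ℤ.+ w a ℤ.* SX ℤ.+ (2ℤ ℤ.* (ℤ.+ w a ℤ.* ∑ℤ[ r ← R ] (X r ℤ.* v a r)) ℤ.+ ℤ.+ w a ℤ.* ∑ℤ[ r ← R ] sq (v a r)))
        ≡⟨ trans (∑ℤ-+ xs _ _) (cong₂ ℤ._+_ (∑ℤ-*ʳ xs SX _) (trans (∑ℤ-+ xs _ _) (cong (λ z → z ℤ.+ _) (∑ℤ-*ˡ xs 2ℤ _)))) ⟩
      ∑ℤ xs (λ a → ℤ.+ w a) ℤ.* SX ℤ.+ (2ℤ ℤ.* ∑ℤ[ a ← xs ] (ℤ.+ w a ℤ.* ∑ℤ[ r ← R ] (X r ℤ.* v a r)) ℤ.+ V)
        ≡⟨ cong₂ (λ y z → y ℤ.* SX ℤ.+ (2ℤ ℤ.* z ℤ.+ V)) (sym (pos-∑ xs w)) cross ⟩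
      W ℤ.* SX ℤ.+ (2ℤ ℤ.* 0ℤ ℤ.+ V)
        ≡⟨ cong (λ z → W ℤ.* SX ℤ.+ z) (ℤ.+-identityˡ V) ⟩
      W ℤ.* SX ℤ.+ V ∎
      where
      V = ∑ℤ[ a ← xs ] (ℤ.+ w a ℤ.* ∑ℤ[ r ← R ] sq (v a r))
      split : ∀ w s x y → w ℤ.* (s ℤ.+ (2ℤ ℤ.* x ℤ.+ y)) ≡ w ℤ.* s ℤ.+ (2ℤ ℤ.* (w ℤ.* x) ℤ.+ w ℤ.* y)
      split = ℤ-Solver.solve-∀

  -- The potential is the sum of squares of the vector `X` accumulated so far. A step must be
  -- possible from every `X`, because the earlier choices are arbitrary; it raises the potential by
  -- at most `β s`.
  balance : ∀ {A : Set} k (R : List B) (v : Fin k → A → B → ℤ) (β : Fin k → ℤ) →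
            (∀ s (X : B → ℤ) → ∃[ a ] ∑ℤ[ r ← R ] sq (X r ℤ.+ v s a r) ℤ.≤ ∑ℤ[ r ← R ] sq (X r) ℤ.+ β s) →
            ∀ (X : B → ℤ) → Σ[ c ∈ (Fin k → A) ] ∑ℤ[ r ← R ] sq (X r ℤ.+ ∑ℤ[ s ← allFin k ] v s (c s) r)
                                   ℤ.≤ ∑ℤ[ r ← R ] sq (X r) ℤ.+ ∑ℤ (allFin k) β
  balance zero    R v β step X = (λ ()) , ℤ.≤-reflexive
    (trans (∑ℤ-cong R λ r → cong sq (ℤ.+-identityʳ (X r))) (sym (ℤ.+-identityʳ _)))
  balance {A = A} (suc k) R v β step X
    with a , le ← step Fin.zero X
    with c , le′ ← balance k R (v ∘ Fin.suc) (β ∘ Fin.suc) (step ∘ Fin.suc) (λ r → X r ℤ.+ v Fin.zero a r)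
    = c′ , ℤ.≤-trans (ℤ.≤-reflexive left) (ℤ.≤-trans le′ (ℤ.≤-trans (ℤ.+-monoˡ-≤ _ le) (ℤ.≤-reflexive right)))
    where
    c′ : Fin (suc k) → A
    c′ Fin.zero    = a
    c′ (Fin.suc s) = c s
    left : ∑ℤ[ r ← R ] sq (X r ℤ.+ ∑ℤ[ s ← allFin (suc k) ] v s (c′ s) r)
           ≡ ∑ℤ[ r ← R ] sq (X r ℤ.+ v Fin.zero a r ℤ.+ ∑ℤ[ s ← allFin k ] v (Fin.suc s) (c s) r)
    left = ∑ℤ-cong R λ r → cong sq (trans (cong (λ z → X r ℤ.+ z) (∑ℤ-suc k (λ s → v s (c′ s) r))) (sym (ℤ.+-assoc (X r) _ _)))
    right : ∑ℤ[ r ← R ] sq (X r) ℤ.+ β Fin.zero ℤ.+ ∑ℤ (allFin k) (β ∘ Fin.suc)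
            ≡ ∑ℤ[ r ← R ] sq (X r) ℤ.+ ∑ℤ (allFin (suc k)) β
    right = trans (ℤ.+-assoc (∑ℤ[ r ← R ] sq (X r)) (β Fin.zero) _) (cong (λ z → ∑ℤ[ r ← R ] sq (X r) ℤ.+ z) (sym (∑ℤ-suc k β)))

  -- Prefix sums

  pre : ∀ {n} → ℕ → (Fin n → ℕ) → ℕ
  pre {n} k f = ∑[ j ← allFin n ] (ind (toℕ j <? k) * f j)

  pre-zero : ∀ {n} (f : Fin n → ℕ) → pre 0 f ≡ 0
  pre-zero {n} f = trans (∑-cong (allFin n) λ j → cong (_* f j) (ind-no (toℕ j <? 0) λ ())) (∑-zero (allFin n))

  pre-suc : ∀ {n} (i : Fin n) (f : Fin n → ℕ) → pre (suc (toℕ i)) f ≡ pre (toℕ i) f + f i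
  pre-suc {n} i f = begin
    pre (suc (toℕ i)) f
      ≡⟨ ∑-cong (allFin n) (λ j → trans (cong (_* f j) (split j)) (*-distribʳ-+ (f j) (ind (toℕ j <? toℕ i)) _)) ⟩
    ∑[ j ← allFin n ] (ind (toℕ j <? toℕ i) * f j + ind (j Fin.≟ i) * f j)
      ≡⟨ ∑-+ (allFin n) _ _ ⟩
    pre (toℕ i) f + ∑[ j ← allFin n ] (ind (j Fin.≟ i) * f j)
      ≡⟨ cong (pre (toℕ i) f +_) (∑-single (Fin._≟ i) f refl (λ _ → id)) ⟩
    pre (toℕ i) f + f i ∎
    where
    open ≡-Reasoning
    split : ∀ j → ind (toℕ j <? suc (toℕ i)) ≡ ind (toℕ j <? toℕ i) + ind (j Fin.≟ i)
    split j with j Fin.≟ i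
    ... | yes refl = trans (ind-yes (toℕ j <? suc (toℕ j)) ≤-refl) (cong (_+ 1) (sym (ind-no (toℕ j <? toℕ j) (<-irrefl refl))))
    ... | no  j≢i  = trans (ind-⇔ (toℕ j <? suc (toℕ i)) (toℕ j <? toℕ i)
                                  (λ lt → ≤∧≢⇒< (s≤s⁻¹ lt) (j≢i ∘ Fin.toℕ-injective)) m<n⇒m<1+n)
                           (sym (+-identityʳ _))

  pre-all : ∀ {n} (f : Fin n → ℕ) → pre n f ≡ ∑ (allFin n) f
  pre-all {n} f = ∑-cong (allFin n) λ j → trans (cong (_* f j) (ind-yes (toℕ j <? n) (Fin.toℕ<n j))) (+-identityʳ (f j))

  pre≤ : ∀ {n} k (f : Fin n → ℕ) → pre k f ≤ ∑ (allFin n) f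
  pre≤ {n} k f = ∑-mono (allFin n) λ j → ind*≤ (toℕ j <? k) (f j)

  prefix-induction : ∀ {n} (Q : ℕ → Set) → Q 0 → (∀ (i : Fin n) → Q (toℕ i) → Q (suc (toℕ i))) → Q n
  prefix-induction {zero}  Q q₀ step = q₀
  prefix-induction {suc n} Q q₀ step = prefix-induction (Q ∘ suc) (step Fin.zero q₀) (step ∘ Fin.suc)

  -- Cells

  module Cells {n : ℕ} (p : Fin n → ℕ) {L : ℕ} (obj : Fin n → Fin L) where

    P : ℕ
    P = ∑ (allFin n) p

    memb : Fin L → Fin n → ℕ
    memb o j = ind (obj j Fin.≟ o) * p j

    z : Fin L → ℕ
    z o = ∑ (allFin n) (memb o)

    -- The clients of a cell are consecutive, and all of them start within a
    -- window of length P / L, so that a cell without its last client is light.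
    Consecutive : Set
    Consecutive = ∀ j → toℕ (obj j) * P ≤ pre (toℕ j) p * L × pre (toℕ j) p * L < suc (toℕ (obj j)) * P

    ∑-cells : ∀ (g : Fin n → ℕ) → ∑[ o ← allFin L ] ∑[ j ← allFin n ] (memb o j * g j) ≡ ∑[ j ← allFin n ] (p j * g j)
    ∑-cells g = trans (∑-swap (allFin L) (allFin n) _) (∑-cong (allFin n) λ j →
      trans (∑-cong (allFin L) λ o → *-assoc (ind (obj j Fin.≟ o)) (p j) (g j))
            (∑-single (obj j Fin.≟_) (λ _ → p j * g j) refl (λ _ → sym)))

    ∑z≡P : ∑ (allFin L) z ≡ P
    ∑z≡P = trans (∑-cong (allFin L) λ o → ∑-cong (allFin n) λ j → sym (*-identityʳ (memb o j)))
          (trans (∑-cells (λ _ → 1)) (∑-cong (allFin n) λ j → *-identityʳ (p j)))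

    module _ (g : Fin n → ℕ) (g≤1 : ∀ j → g j ≡ 0 ⊎ g j ≡ 1) (o : Fin L) where

      in-part out-part : ℕ
      in-part  = ∑[ j ← allFin n ] (memb o j * g j)
      out-part = ∑[ j ← allFin n ] (memb o j * (1 ∸ g j))

      private
        split : ∀ j → memb o j ≡ memb o j * g j + memb o j * (1 ∸ g j)
        split j with g j | g≤1 j
        ... | _ | inj₁ refl = sym (cong₂ _+_ (*-zeroʳ (memb o j)) (*-identityʳ _))
        ... | _ | inj₂ refl = sym (trans (cong₂ _+_ (*-identityʳ (memb o j)) (*-zeroʳ (memb o j))) (+-identityʳ _))

      parts : z o ≡ in-part + out-part
      parts = trans (∑-cong (allFin n) split) (∑-+ (allFin n) _ _)

      -- The last client of the cell belongs to one of the two parts. The other part consists of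
      -- earlier members, which weigh at most `P / L`, while the first part weighs at most `z o`. In
      -- the induction over prefixes every member in turn takes the role of the last one.
      variance : Consecutive → L * (in-part * out-part) ≤ z o * P
      variance consecutive = subst₂ _≤_
          (cong (L *_) (cong₂ _*_ (pre-all (λ j → memb o j * g j)) (pre-all (λ j → memb o j * (1 ∸ g j))))) (cong (_* P) (pre-all (memb o)))
          (proj₂ (prefix-induction Q base step))
        where
        open ≤-Reasoning
        zₖ aₖ bₖ : ℕ → ℕ
        zₖ k = pre k (memb o)
        aₖ k = pre k (λ j → memb o j * g j)
        bₖ k = pre k (λ j → memb o j * (1 ∸ g j))
        ab≡z : ∀ k → zₖ k ≡ aₖ k + bₖ k
        ab≡z k = trans (∑-cong (allFin n) λ j → trans (cong (ind (toℕ j <? k) *_) (split j)) (*-distribˡ-+ (ind (toℕ j <? k)) _ _))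
                       (∑-+ (allFin n) _ _)
        -- Either the cell is still empty, or its members so far fit between the point
        -- `toℕ o * P / L`, where the window of the cell begins, and the current prefix sum.
        Start : ℕ → Set
        Start k = zₖ k ≡ 0 ⊎ L * zₖ k + toℕ o * P ≤ L * pre k p
        start-step : ∀ i → Start (toℕ i) → Start (suc (toℕ i))
        start-step i st with obj i Fin.≟ o | pre-suc i (memb o) | pre-suc i p
        ... | no _ | eqz | eqp with st
        ...   | inj₁ z≡0 = inj₁ (trans eqz (trans (+-identityʳ _) z≡0))
        ...   | inj₂ le  = inj₂ (begin
          L * zₖ (suc (toℕ i)) + toℕ o * P ≡⟨ cong (λ y → L * y + toℕ o * P) (trans eqz (+-identityʳ _)) ⟩
          L * zₖ (toℕ i) + toℕ o * P       ≤⟨ le ⟩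
          L * pre (toℕ i) p                ≤⟨ *-monoʳ-≤ L (m≤m+n _ (p i)) ⟩
          L * (pre (toℕ i) p + p i)        ≡⟨ cong (L *_) (sym eqp) ⟩
          L * pre (suc (toℕ i)) p          ∎)
        start-step i st | yes refl | eqz | eqp = inj₂ (begin
          L * zₖ (suc (toℕ i)) + toℕ o * P       ≡⟨ cong (λ y → L * y + toℕ o * P) (trans eqz (cong (zₖ (toℕ i) +_) (+-identityʳ _))) ⟩
          L * (zₖ (toℕ i) + p i) + toℕ o * P     ≡⟨ rearrange L (zₖ (toℕ i)) (p i) (toℕ o * P) ⟩
          (L * zₖ (toℕ i) + toℕ o * P) + L * p i ≤⟨ +-monoˡ-≤ (L * p i) (bound st) ⟩
          L * pre (toℕ i) p + L * p i            ≡⟨ sym (*-distribˡ-+ L _ (p i)) ⟩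
          L * (pre (toℕ i) p + p i)              ≡⟨ cong (L *_) (sym eqp) ⟩
          L * pre (suc (toℕ i)) p                ∎)
          where
          rearrange : ∀ l a b c → l * (a + b) + c ≡ (l * a + c) + l * b
          rearrange = solve-∀
          bound : Start (toℕ i) → L * zₖ (toℕ i) + toℕ o * P ≤ L * pre (toℕ i) p
          bound (inj₂ le) = le
          bound (inj₁ z≡0) = begin
            L * zₖ (toℕ i) + toℕ o * P ≡⟨ cong (λ y → L * y + toℕ o * P) z≡0 ⟩
            L * 0 + toℕ o * P          ≡⟨ cong (_+ toℕ o * P) (*-zeroʳ L) ⟩
            toℕ o * P                  ≤⟨ proj₁ (consecutive i) ⟩
            pre (toℕ i) p * L          ≡⟨ *-comm _ L ⟩
            L * pre (toℕ i) p          ∎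
        -- A member `i` starts before the end `(toℕ o + 1) * P / L` of the window, so the members
        -- before it weigh at most `P / L`.
        light : ∀ i → obj i ≡ o → Start (toℕ i) → L * zₖ (toℕ i) ≤ P
        light i refl (inj₁ z≡0) = ≤-trans (≤-reflexive (trans (cong (L *_) z≡0) (*-zeroʳ L))) z≤n
        light i refl (inj₂ le)  = +-cancelʳ-≤ (toℕ o * P) _ _ (begin
          L * zₖ (toℕ i) + toℕ o * P ≤⟨ le ⟩
          L * pre (toℕ i) p          ≡⟨ *-comm L _ ⟩
          pre (toℕ i) p * L          ≤⟨ <⇒≤ (proj₂ (consecutive i)) ⟩
          P + toℕ o * P              ∎)
        Q : ℕ → Set
        Q k = Start k × L * (aₖ k * bₖ k) ≤ zₖ k * P
        base : Q 0
        base = inj₁ (pre-zero (memb o))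
             , ≤-trans (≤-reflexive (trans (cong (λ y → L * (y * bₖ 0)) (pre-zero (λ j → memb o j * g j))) (*-zeroʳ L))) z≤n
        step : ∀ i → Q (toℕ i) → Q (suc (toℕ i))
        step i (st , le) = start-step i st , goal
          where
          k = toℕ i
          heavy : obj i ≡ o → ∀ x y → x ≤ zₖ (suc k) → y ≤ zₖ k → L * (x * y) ≤ zₖ (suc k) * P
          heavy o≡ x y x≤ y≤ = begin
            L * (x * y)                 ≡⟨ swap L x y ⟩
            x * (L * y)                 ≤⟨ *-mono-≤ x≤ (≤-trans (*-monoʳ-≤ L y≤) (light i o≡ st)) ⟩
            zₖ (suc k) * P              ∎
            where
            swap : ∀ l x y → l * (x * y) ≡ x * (l * y)
            swap = solve-∀
          a≤z : ∀ k → aₖ k ≤ zₖ k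
          a≤z k = ≤-trans (m≤m+n _ (bₖ k)) (≤-reflexive (sym (ab≡z k)))
          b≤z : ∀ k → bₖ k ≤ zₖ k
          b≤z k = ≤-trans (m≤n+m _ (aₖ k)) (≤-reflexive (sym (ab≡z k)))
          goal : L * (aₖ (suc k) * bₖ (suc k)) ≤ zₖ (suc k) * P
          goal with obj i Fin.≟ o | pre-suc i (memb o) | pre-suc i (λ j → memb o j * g j) | pre-suc i (λ j → memb o j * (1 ∸ g j))
          ... | no _ | eqz | eqa | eqb rewrite trans eqz (+-identityʳ _) | trans eqa (+-identityʳ _) | trans eqb (+-identityʳ _) = le
          ... | yes o≡ | eqz | eqa | eqb with g i | g≤1 i
          ...   | _ | inj₁ refl = begin
            L * (aₖ (suc k) * bₖ (suc k)) ≡⟨ cong (L *_) (*-comm (aₖ (suc k)) _) ⟩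
            L * (bₖ (suc k) * aₖ (suc k)) ≤⟨ heavy o≡ _ _ (b≤z (suc k)) (≤-trans (≤-reflexive (trans eqa (trans (cong (aₖ k +_) (*-zeroʳ (p i + 0))) (+-identityʳ _)))) (a≤z k)) ⟩
            zₖ (suc k) * P                ∎
          ...   | _ | inj₂ refl =
            heavy o≡ _ _ (a≤z (suc k)) (≤-trans (≤-reflexive (trans eqb (trans (cong (bₖ k +_) (*-zeroʳ (p i + 0))) (+-identityʳ _)))) (b≤z k))

  -- Drawing a representative of each cell

  ∑ℤ-cartesian : ∀ {A B : Set} (xs : List A) (ys : List B) (f : A × B → ℤ) →
                 ∑ℤ (cartesianProduct xs ys) f ≡ ∑ℤ[ x ← xs ] ∑ℤ[ y ← ys ] f (x , y)
  ∑ℤ-cartesian []       ys f = refl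
  ∑ℤ-cartesian (x ∷ xs) ys f = trans (append ys) (cong (λ s → ∑ℤ ys (f ∘ (x ,_)) ℤ.+ s) (∑ℤ-cartesian xs ys f))
    where
    append : ∀ ys′ {zs} → ∑ℤ (map (x ,_) ys′ ++ zs) f ≡ ∑ℤ ys′ (f ∘ (x ,_)) ℤ.+ ∑ℤ zs f
    append []        = sym (ℤ.+-identityˡ _)
    append (y ∷ ys′) = trans (cong (λ s → f (x , y) ℤ.+ s) (append ys′)) (sym (ℤ.+-assoc (f (x , y)) _ _))

  length-cartesianProduct : ∀ {A B : Set} (xs : List A) (ys : List B) → length (cartesianProduct xs ys) ≡ length xs * length ys
  length-cartesianProduct []       ys = refl
  length-cartesianProduct (x ∷ xs) ys =
    trans (length-++ (map (x ,_) ys)) (cong₂ _+_ (length-map (x ,_) ys) (length-cartesianProduct xs ys))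

  module Representatives {n : ℕ} (p : Fin n → ℕ) {L : ℕ} (obj : Fin n → Fin L) {m H : ℕ} (lev : Fin m → Fin n → Fin (suc H)) where

    open Cells p obj

    below : Fin m → Fin (suc H) → Fin n → ℕ
    below i h j = ind (lev i j Fin.≤? h)

    below-01 : ∀ i h j → below i h j ≡ 0 ⊎ below i h j ≡ 1
    below-01 i h j with lev i j Fin.≤? h
    ... | yes _ = inj₂ refl
    ... | no  _ = inj₁ refl

    a b : Fin L → Fin m × Fin (suc H) → ℕ
    a o (i , h) = in-part  (below i h) (below-01 i h) o
    b o (i , h) = out-part (below i h) (below-01 i h) o

    grid : List (Fin m × Fin (suc H))
    grid = cartesianProduct (allFin m) (allFin (suc H))

    -- The error made on day `i` at level `h` when `j` stands for the whole cell: the cell then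
    -- contributes all or nothing of `z o` to the mass up to level `h`, instead of its true share
    -- `a o (i , h)`. Under the weights `memb o` the mean is zero.
    deviation : Fin L → Fin n → Fin m × Fin (suc H) → ℤ
    deviation o j (i , h) = ℤ.+ z o ℤ.* ℤ.+ below i h j ℤ.- ℤ.+ a o (i , h)

    cellVariance : Fin L → ℕ
    cellVariance o = ∑[ r ← grid ] (a o r * b o r)

    private
      Σbelow : ∀ o i h → ∑ℤ[ j ← allFin n ] (ℤ.+ memb o j ℤ.* ℤ.+ below i h j) ≡ ℤ.+ a o (i , h)
      Σbelow o i h = trans (∑ℤ-cong (allFin n) λ j → sym (ℤ.pos-* (memb o j) _)) (sym (pos-∑ (allFin n) _))

      linear : ∀ o i h c d → ∑ℤ[ j ← allFin n ] (c ℤ.* (ℤ.+ memb o j ℤ.* ℤ.+ below i h j) ℤ.+ d ℤ.* ℤ.+ memb o j)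
               ≡ c ℤ.* ℤ.+ a o (i , h) ℤ.+ d ℤ.* ℤ.+ z o
      linear o i h c d = trans (∑ℤ-+ (allFin n) _ _) (cong₂ ℤ._+_
        (trans (∑ℤ-*ˡ (allFin n) c _) (cong (c ℤ.*_) (Σbelow o i h)))
        (trans (∑ℤ-*ˡ (allFin n) d _) (cong (d ℤ.*_) (sym (pos-∑ (allFin n) (memb o))))))

      mean : ∀ o r → ∑ℤ[ j ← allFin n ] (ℤ.+ memb o j ℤ.* deviation o j r) ≡ 0ℤ
      mean o (i , h) = trans
        (∑ℤ-cong (allFin n) λ j → expansion (ℤ.+ memb o j) (ℤ.+ z o) (ℤ.+ below i h j) (ℤ.+ a o (i , h)))
        (trans (linear o i h (ℤ.+ z o) (ℤ.- ℤ.+ a o (i , h))) (cancel (ℤ.+ z o) (ℤ.+ a o (i , h))))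
        where
        expansion : ∀ w z x a → w ℤ.* (z ℤ.* x ℤ.- a) ≡ z ℤ.* (w ℤ.* x) ℤ.+ (ℤ.- a) ℤ.* w
        expansion = ℤ-Solver.solve-∀
        cancel : ∀ z a → z ℤ.* a ℤ.+ (ℤ.- a) ℤ.* z ≡ 0ℤ
        cancel = ℤ-Solver.solve-∀

      -- The deviation is `b` with weight `a` and `- a` with weight `b`, so its weighted square is
      -- `a b² + b a² = z a b`, as `z = a + b`. In the calculation, idempotence of the indicator
      -- makes the square linear in `below`.
      var : ∀ o r → ∑ℤ[ j ← allFin n ] (ℤ.+ memb o j ℤ.* sq (deviation o j r)) ≡ ℤ.+ z o ℤ.* ℤ.+ (a o r * b o r)
      var o (i , h) = trans
        (∑ℤ-cong (allFin n) λ j → trans (expansion (ℤ.+ memb o j) (ℤ.+ z o) (ℤ.+ below i h j) (ℤ.+ a o (i , h)))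
          (cong (λ y → zz ℤ.* (ℤ.+ memb o j ℤ.* y) ℤ.+ c ℤ.* (ℤ.+ memb o j ℤ.* ℤ.+ below i h j) ℤ.+ aa ℤ.* ℤ.+ memb o j)
            (trans (sym (ℤ.pos-* (below i h j) _)) (cong ℤ.+_ (ind-idem (lev i j Fin.≤? h))))))
        (trans (∑ℤ-cong (allFin n) λ j → cong (λ y → y ℤ.+ aa ℤ.* ℤ.+ memb o j)
                  (sym (ℤ.*-distribʳ-+ (ℤ.+ memb o j ℤ.* ℤ.+ below i h j) zz c)))
        (trans (linear o i h (zz ℤ.+ c) aa) (trans (cong (λ y → (y ℤ.* y ℤ.+ (ℤ.- (ℤ.+ 2 ℤ.* y ℤ.* ℤ.+ a o (i , h)))) ℤ.* ℤ.+ a o (i , h) ℤ.+ aa ℤ.* y) z≡)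
          (trans (collect (ℤ.+ a o (i , h)) (ℤ.+ b o (i , h))) (cong₂ ℤ._*_ (sym z≡) (sym (ℤ.pos-* (a o (i , h)) _)))))))
        where
        zz = ℤ.+ z o ℤ.* ℤ.+ z o
        aa = ℤ.+ a o (i , h) ℤ.* ℤ.+ a o (i , h)
        c  = ℤ.- (ℤ.+ 2 ℤ.* ℤ.+ z o ℤ.* ℤ.+ a o (i , h))
        z≡ : ℤ.+ z o ≡ ℤ.+ a o (i , h) ℤ.+ ℤ.+ b o (i , h)
        z≡ = cong ℤ.+_ (parts (below i h) (below-01 i h) o)
        expansion : ∀ w z x a → w ℤ.* ((z ℤ.* x ℤ.- a) ℤ.* (z ℤ.* x ℤ.- a)) ≡
                 z ℤ.* z ℤ.* (w ℤ.* (x ℤ.* x)) ℤ.+ (ℤ.- (ℤ.+ 2 ℤ.* z ℤ.* a)) ℤ.* (w ℤ.* x) ℤ.+ a ℤ.* a ℤ.* w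
        expansion = ℤ-Solver.solve-∀
        collect : ∀ a b → ((a ℤ.+ b) ℤ.* (a ℤ.+ b) ℤ.+ (ℤ.- (ℤ.+ 2 ℤ.* (a ℤ.+ b) ℤ.* a))) ℤ.* a ℤ.+ a ℤ.* a ℤ.* (a ℤ.+ b)
                  ≡ (a ℤ.+ b) ℤ.* (a ℤ.* b)
        collect = ℤ-Solver.solve-∀

      empty : ∀ o → z o ≡ 0 → ∀ j r → deviation o j r ≡ 0ℤ
      empty o z≡0 j (i , h) = cong₂ (λ y y′ → ℤ.+ y ℤ.* ℤ.+ below i h j ℤ.- ℤ.+ y′) z≡0
        (m+n≡0⇒m≡0 (a o (i , h)) (trans (sym (parts (below i h) (below-01 i h) o)) z≡0))

    sampling-step : Fin n → ∀ o (X : Fin m × Fin (suc H) → ℤ) →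
                    ∃[ j ] ∑ℤ[ r ← grid ] sq (X r ℤ.+ deviation o j r) ℤ.≤ ∑ℤ[ r ← grid ] sq (X r) ℤ.+ ℤ.+ cellVariance o
    sampling-step j₀ o X with z o ≟ 0
    -- A cell of mass 0 offers no weights to draw with; its deviations all vanish, so any client
    -- will do.
    ... | yes z≡0 = j₀ , ℤ.≤-trans
      (ℤ.≤-reflexive (∑ℤ-cong grid λ r → cong sq (trans (cong (λ y → X r ℤ.+ y) (empty o z≡0 j₀ r)) (ℤ.+-identityʳ (X r)))))
      (ℤ.≤-trans (ℤ.≤-reflexive (sym (ℤ.+-identityʳ _))) (ℤ.+-monoʳ-≤ (∑ℤ[ r ← grid ] sq (X r)) (ℤ.+≤+ z≤n)))
    ... | no z≢0 = balance-step (allFin n) grid (memb o) (deviation o) (ℤ.+ cellVariance o) X (n≢0⇒n>0 z≢0) (mean o)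
      (ℤ.≤-reflexive (begin
        ∑ℤ[ j ← allFin n ] (ℤ.+ memb o j ℤ.* ∑ℤ[ r ← grid ] sq (deviation o j r))
          ≡⟨ ∑ℤ-cong (allFin n) (λ j → sym (∑ℤ-*ˡ grid (ℤ.+ memb o j) _)) ⟩
        ∑ℤ[ j ← allFin n ] ∑ℤ[ r ← grid ] (ℤ.+ memb o j ℤ.* sq (deviation o j r))
          ≡⟨ ∑ℤ-swap (allFin n) grid _ ⟩
        ∑ℤ[ r ← grid ] ∑ℤ[ j ← allFin n ] (ℤ.+ memb o j ℤ.* sq (deviation o j r))
          ≡⟨ ∑ℤ-cong grid (var o) ⟩
        ∑ℤ[ r ← grid ] (ℤ.+ z o ℤ.* ℤ.+ (a o r * b o r))
          ≡⟨ ∑ℤ-*ˡ grid (ℤ.+ z o) _ ⟩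
        ℤ.+ z o ℤ.* ∑ℤ[ r ← grid ] (ℤ.+ (a o r * b o r))
          ≡⟨ cong (ℤ.+ z o ℤ.*_) (sym (pos-∑ grid _)) ⟩
        ℤ.+ z o ℤ.* ℤ.+ cellVariance o ∎))
      where open ≡-Reasoning

    total : (Fin L → Fin n) → Fin m × Fin (suc H) → ℤ
    total c r = ∑ℤ[ o ← allFin L ] deviation o (c o) r

    -- `balance` adds up the variances of the cells as if the draws were independent. Each cell
    -- contributes at most `z o * P / L` for each of the `m * suc H` pairs of a day and a level, and
    -- the masses `z o` sum to `P`.
    representatives : Fin n → Consecutive → Σ[ c ∈ (Fin L → Fin n) ]
                      ℤ.+ L ℤ.* (∑ℤ[ i ← allFin m ] ∑ℤ[ h ← allFin (suc H) ] sq (total c (i , h))) ℤ.≤ ℤ.+ (m * suc H * (P * P))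
    representatives j₀ consecutive
      with c , le ← balance L grid deviation (λ o → ℤ.+ cellVariance o) (sampling-step j₀) (λ _ → 0ℤ)
      = c , ℤ.≤-trans (ℤ.*-monoˡ-≤-nonNeg (ℤ.+ L) (ℤ.≤-trans (ℤ.≤-reflexive left) (ℤ.≤-trans le (ℤ.≤-reflexive right))))
            (ℤ.≤-trans (ℤ.≤-reflexive (sym (ℤ.pos-* L (∑ (allFin L) cellVariance)))) (ℤ.+≤+ bound))
      where
      left : ∑ℤ[ i ← allFin m ] ∑ℤ[ h ← allFin (suc H) ] sq (total c (i , h)) ≡ ∑ℤ[ r ← grid ] sq (0ℤ ℤ.+ total c r)
      left = trans (sym (∑ℤ-cartesian (allFin m) (allFin (suc H)) (sq ∘ total c))) (∑ℤ-cong grid λ r → cong sq (sym (ℤ.+-identityˡ (total c r))))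
      right : ∑ℤ[ r ← grid ] sq 0ℤ ℤ.+ ∑ℤ[ o ← allFin L ] (ℤ.+ cellVariance o) ≡ ℤ.+ ∑ (allFin L) cellVariance
      right = trans (cong₂ ℤ._+_ (∑ℤ-zero grid) (sym (pos-∑ (allFin L) cellVariance))) (ℤ.+-identityˡ _)
      length-grid : length grid ≡ m * suc H
      length-grid = trans (length-cartesianProduct (allFin m) (allFin (suc H))) (cong₂ _*_ (length-allFin m) (length-allFin (suc H)))
      bound : L * ∑ (allFin L) cellVariance ≤ m * suc H * (P * P)
      bound = begin
        L * ∑ (allFin L) cellVariance
          ≡⟨ sym (∑-*ˡ (allFin L) L cellVariance) ⟩
        ∑[ o ← allFin L ] (L * cellVariance o)
          ≡⟨ ∑-cong (allFin L) (λ o → sym (∑-*ˡ grid L _)) ⟩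
        ∑[ o ← allFin L ] ∑[ r ← grid ] (L * (a o r * b o r))
          ≤⟨ ∑-mono (allFin L) (λ o → ∑-mono grid (λ (i , h) → variance (below i h) (below-01 i h) o consecutive)) ⟩
        ∑[ o ← allFin L ] ∑[ r ← grid ] (z o * P)
          ≡⟨ ∑-cong (allFin L) (λ o → trans (∑-const grid _) (cong (_* (z o * P)) length-grid)) ⟩
        ∑[ o ← allFin L ] (m * suc H * (z o * P))
          ≡⟨ trans (∑-*ˡ (allFin L) (m * suc H) _) (cong (m * suc H *_) (trans (∑-*ʳ (allFin L) P z) (cong (_* P) ∑z≡P))) ⟩
        m * suc H * (P * P) ∎
        where open ≤-Reasoning

  -- Rankings of the cells, and sampling of days

  2xy≤x²+y² : ∀ x y → ℤ.+ 2 ℤ.* (x ℤ.* y) ℤ.≤ sq x ℤ.+ sq y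
  2xy≤x²+y² x y = ℤ.0≤i-j⇒j≤i (ℤ.≤-trans (sq≥0 (x ℤ.- y)) (ℤ.≤-reflexive (eq x y)))
    where
    eq : ∀ x y → (x ℤ.- y) ℤ.* (x ℤ.- y) ≡ x ℤ.* x ℤ.+ y ℤ.* y ℤ.- ℤ.+ 2 ℤ.* (x ℤ.* y)
    eq = ℤ-Solver.solve-∀

  sq-cancel-≤ : ∀ x c → sq x ℤ.≤ sq (ℤ.+ c) → x ℤ.≤ ℤ.+ c
  sq-cancel-≤ ℤ.-[1+ n ] c le = ℤ.-≤+
  sq-cancel-≤ (ℤ.+ n) c le with n ≤? c
  ... | yes n≤c = ℤ.+≤+ n≤c
  ... | no  n≰c = contradiction (ℤ.drop‿+≤+ (subst₂ ℤ._≤_ (sym (ℤ.pos-* n n)) (sym (ℤ.pos-* c c)) le))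
                                (<⇒≱ (*-mono-< (≰⇒> n≰c) (≰⇒> n≰c)))

  sq-diff-≤ : ∀ {x y c} → x ≤ c → y ≤ c → sq (ℤ.+ x ℤ.- ℤ.+ y) ℤ.≤ ℤ.+ (c * c)
  sq-diff-≤ {x} {y} {c} x≤c y≤c with m≤n⇒∃[o]m+o≡n x≤c | m≤n⇒∃[o]m+o≡n y≤c
  ... | u , x+u≡c | v , y+v≡c = ℤ.0≤i-j⇒j≤i (ℤ.≤-trans (ℤ.+≤+ z≤n) (ℤ.≤-reflexive (trans (ℤ.pos-* (u + y) (v + x))
    (trans (eq (ℤ.+ x) (ℤ.+ y) (ℤ.+ u) (ℤ.+ v) (cong ℤ.+_ (trans x+u≡c (sym y+v≡c))))
      (cong (λ z → z ℤ.- sq (ℤ.+ x ℤ.- ℤ.+ y)) (trans (sym (ℤ.pos-* (x + u) _)) (cong₂ (λ a b → ℤ.+ (a * b)) x+u≡c x+u≡c)))))))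
    where
    -- (c - x + y) (c - y + x) = c² - (x - y)²
    eq : ∀ x y u v → x ℤ.+ u ≡ y ℤ.+ v → (u ℤ.+ y) ℤ.* (v ℤ.+ x) ≡ (x ℤ.+ u) ℤ.* (x ℤ.+ u) ℤ.- (x ℤ.- y) ℤ.* (x ℤ.- y)
    eq x y u v eq′ = trans (cong (λ w → (u ℤ.+ y) ℤ.* (w ℤ.+ x)) v≡) (eq″ x y u)
      where
      v≡ : v ≡ x ℤ.+ u ℤ.- y
      v≡ = trans (cancel y v) (cong (ℤ._- y) (sym eq′))
        where
        cancel : ∀ y v → v ≡ y ℤ.+ v ℤ.- y
        cancel = ℤ-Solver.solve-∀
      eq″ : ∀ x y u → (u ℤ.+ y) ℤ.* (x ℤ.+ u ℤ.- y ℤ.+ x) ≡ (x ℤ.+ u) ℤ.* (x ℤ.+ u) ℤ.- (x ℤ.- y) ℤ.* (x ℤ.- y)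
      eq″ = ℤ-Solver.solve-∀

  -- Ties count in full, so objects of equal rank may be ordered arbitrarily.
  massUpTo : ∀ {L R} → (Fin L → ℕ) → (Fin L → Fin R) → Fin L → ℕ
  massUpTo {L} w ρ o = ∑[ o′ ← allFin L ] (ind (ρ o′ Fin.≤? ρ o) * w o′)

  massUpTo≤ : ∀ {L R} (w : Fin L → ℕ) (ρ : Fin L → Fin R) o → massUpTo w ρ o ≤ ∑ (allFin L) w
  massUpTo≤ {L} w ρ o = ∑-mono (allFin L) λ o′ → ind*≤ (ρ o′ Fin.≤? ρ o) (w o′)

  module _ {n : ℕ} (p : Fin n → ℕ) {m H : ℕ} (obj : Fin n → Fin (suc H * (H * H))) (lev : Fin m → Fin n → Fin (suc H)) where

    open Cells p obj
    open Representatives p obj lev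

    -- A cell takes over the levels of one and the same client `c o` on all days, so the bound `K`
    -- on that client's total carries over. The true mass up to the level of `c o` exceeds its
    -- completion time by at most `P / H` per day (`mass` and `level`); counting cells by their
    -- representatives instead of single clients adds the deviations, which sum to at most
    -- `m * P / H`.
    cluster : ∀ {K} (C : Fin m → Fin n → ℕ) → Fin n → 0 < P → Consecutive →
              (∀ i h → H * ∑[ j ← allFin n ] (p j * below i h j) ≤ suc (toℕ h) * P) →
              (∀ i j → toℕ (lev i j) * P ≤ H * C i j) →
              (∀ j → ∑[ i ← allFin m ] C i j ≤ K) →
              Σ[ ρ ∈ (Fin m → Fin (suc H * (H * H)) → Fin (suc H)) ]
                (∀ o → H * ∑[ i ← allFin m ] massUpTo z (ρ i) o ≤ H * K + 2 * (m * P))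
    cluster {K} C j₀ P>0 consecutive mass level ≤K = ρ , bound
      where
      c = proj₁ (representatives j₀ consecutive)
      S₂≤ = proj₂ (representatives j₀ consecutive)
      L = suc H * (H * H)
      ρ : Fin m → Fin L → Fin (suc H)
      ρ i o = lev i (c o)
      H′ = ℤ.+ H
      P′ = ℤ.+ P
      instance
        P≢0 : NonZero P
        P≢0 = >-nonZero P>0
      upTo : Fin m → Fin (suc H) → ℕ
      upTo i h = ∑[ j ← allFin n ] (p j * below i h j)
      S₂ = ∑ℤ[ i ← allFin m ] ∑ℤ[ h ← allFin (suc H) ] sq (total c (i , h))
      HHS₂≤ : H′ ℤ.* H′ ℤ.* S₂ ℤ.≤ ℤ.+ (m * (P * P))
      HHS₂≤ = ℤ.*-cancelˡ-≤-pos _ _ (ℤ.+ suc H) (ℤ.≤-trans (ℤ.≤-reflexive left) (ℤ.≤-trans S₂≤ (ℤ.≤-reflexive right)))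
        where
        left : ℤ.+ suc H ℤ.* (H′ ℤ.* H′ ℤ.* S₂) ≡ ℤ.+ L ℤ.* S₂
        left = trans (sym (ℤ.*-assoc (ℤ.+ suc H) (H′ ℤ.* H′) S₂))
          (cong (ℤ._* S₂) (trans (cong (ℤ.+ suc H ℤ.*_) (sym (ℤ.pos-* H H))) (sym (ℤ.pos-* (suc H) (H * H)))))
        right : ℤ.+ (m * suc H * (P * P)) ≡ ℤ.+ suc H ℤ.* ℤ.+ (m * (P * P))
        right = trans (cong ℤ.+_ (comm m (suc H) (P * P))) (ℤ.pos-* (suc H) (m * (P * P)))
          where
          comm : ∀ m h q → m * h * q ≡ h * (m * q)
          comm = solve-∀
      total≡ : ∀ i o → ℤ.+ massUpTo z (ρ i) o ≡ total c (i , ρ i o) ℤ.+ ℤ.+ upTo i (ρ i o)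
      total≡ i o = begin
        ℤ.+ massUpTo z (ρ i) o
          ≡⟨ pos-∑ (allFin L) _ ⟩
        ∑ℤ[ o′ ← allFin L ] (ℤ.+ (below i h (c o′) * z o′))
          ≡⟨ ∑ℤ-cong (allFin L) (λ o′ → trans (ℤ.pos-* (below i h (c o′)) (z o′)) (shift (ℤ.+ below i h (c o′)) (ℤ.+ z o′) (ℤ.+ a o′ (i , h)))) ⟩
        ∑ℤ[ o′ ← allFin L ] (deviation o′ (c o′) (i , h) ℤ.+ ℤ.+ a o′ (i , h))
          ≡⟨ ∑ℤ-+ (allFin L) _ _ ⟩
        total c (i , h) ℤ.+ ∑ℤ[ o′ ← allFin L ] (ℤ.+ a o′ (i , h))
          ≡⟨ cong (λ y → total c (i , h) ℤ.+ y) (trans (sym (pos-∑ (allFin L) _)) (cong ℤ.+_ (∑-cells (below i h)))) ⟩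
        total c (i , h) ℤ.+ ℤ.+ upTo i h ∎
        where
        open ≡-Reasoning
        h = ρ i o
        shift : ∀ x z a → x ℤ.* z ≡ z ℤ.* x ℤ.- a ℤ.+ a
        shift = ℤ-Solver.solve-∀
      bound : ∀ o → H * ∑[ i ← allFin m ] massUpTo z (ρ i) o ≤ H * K + 2 * (m * P)
      bound o = ℤ.drop‿+≤+ (begin
        ℤ.+ (H * ∑[ i ← allFin m ] massUpTo z (ρ i) o)
          ≡⟨ trans (ℤ.pos-* H (∑[ i ← allFin m ] massUpTo z (ρ i) o)) (cong (H′ ℤ.*_) (trans (pos-∑ (allFin m) _) (trans (∑ℤ-cong (allFin m) λ i → total≡ i o) (∑ℤ-+ (allFin m) _ _)))) ⟩
        H′ ℤ.* (D ℤ.+ ∑ℤ[ i ← allFin m ] (ℤ.+ upTo i (ρ i o)))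
          ≡⟨ trans (ℤ.*-distribˡ-+ H′ D _) (cong (λ y → H′ ℤ.* D ℤ.+ y) (trans (cong (H′ ℤ.*_) (sym (pos-∑ (allFin m) (λ i → upTo i (ρ i o))))) (sym (ℤ.pos-* H (∑[ i ← allFin m ] upTo i (ρ i o)))))) ⟩
        H′ ℤ.* D ℤ.+ ℤ.+ (H * ∑[ i ← allFin m ] upTo i (ρ i o))
          ≤⟨ ℤ.+-mono-≤ HD≤ (ℤ.+≤+ upTo≤) ⟩
        ℤ.+ (m * P) ℤ.+ ℤ.+ (m * P + H * K)
          ≡⟨ cong ℤ.+_ (collect (m * P) (H * K)) ⟩
        ℤ.+ (H * K + 2 * (m * P)) ∎)
        where
        open ℤ.≤-Reasoning
        collect : ∀ x y → x + (x + y) ≡ y + 2 * x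
        collect = solve-∀
        d : Fin m → ℤ
        d i = total c (i , ρ i o)
        D = ∑ℤ (allFin m) d
        -- Which level matters on day `i` depends on the representative chosen for `o`, so the
        -- squares on all levels had to be controlled; this accounts for the factor `suc H` in `L`.
        ∑d²≤ : ∑ℤ[ i ← allFin m ] sq (d i) ℤ.≤ S₂
        ∑d²≤ = ∑ℤ-mono (allFin m) λ i → ∑ℤ-∈ (suc H) (λ h → sq (total c (i , h))) (λ h → sq≥0 (total c (i , h))) (ρ i o)
        -- The arithmetic-geometric mean inequality with `P` as the second number; summed over the
        -- days it does the work of Cauchy-Schwarz.
        pointwise : ∀ i → ℤ.+ 2 ℤ.* P′ ℤ.* (H′ ℤ.* d i) ℤ.≤ H′ ℤ.* H′ ℤ.* sq (d i) ℤ.+ ℤ.+ (P * P)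
        pointwise i = begin
          ℤ.+ 2 ℤ.* P′ ℤ.* (H′ ℤ.* d i)         ≡⟨ eq₁ P′ (H′ ℤ.* d i) ⟩
          ℤ.+ 2 ℤ.* (H′ ℤ.* d i ℤ.* P′)         ≤⟨ 2xy≤x²+y² (H′ ℤ.* d i) P′ ⟩
          sq (H′ ℤ.* d i) ℤ.+ sq P′             ≡⟨ cong₂ ℤ._+_ (eq₂ H′ (d i)) (sym (ℤ.pos-* P P)) ⟩
          H′ ℤ.* H′ ℤ.* sq (d i) ℤ.+ ℤ.+ (P * P) ∎
          where
          eq₁ : ∀ p x → ℤ.+ 2 ℤ.* p ℤ.* x ≡ ℤ.+ 2 ℤ.* (x ℤ.* p)
          eq₁ = ℤ-Solver.solve-∀
          eq₂ : ∀ h d → (h ℤ.* d) ℤ.* (h ℤ.* d) ≡ h ℤ.* h ℤ.* (d ℤ.* d)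
          eq₂ = ℤ-Solver.solve-∀
        HD≤ : H′ ℤ.* D ℤ.≤ ℤ.+ (m * P)
        HD≤ = ℤ.*-cancelˡ-≤-pos _ _ (ℤ.+ (2 * P)) {{ℤ.positive (ℤ.+<+ (*-mono-< {0} {2} {0} z<s P>0))}} (begin
          ℤ.+ (2 * P) ℤ.* (H′ ℤ.* D)
            ≡⟨ cong₂ ℤ._*_ (ℤ.pos-* 2 P) (sym (∑ℤ-*ˡ (allFin m) H′ d)) ⟩
          ℤ.+ 2 ℤ.* P′ ℤ.* ∑ℤ[ i ← allFin m ] (H′ ℤ.* d i)
            ≡⟨ sym (∑ℤ-*ˡ (allFin m) (ℤ.+ 2 ℤ.* P′) _) ⟩
          ∑ℤ[ i ← allFin m ] (ℤ.+ 2 ℤ.* P′ ℤ.* (H′ ℤ.* d i))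
            ≤⟨ ∑ℤ-mono (allFin m) pointwise ⟩
          ∑ℤ[ i ← allFin m ] (H′ ℤ.* H′ ℤ.* sq (d i) ℤ.+ ℤ.+ (P * P))
            ≡⟨ trans (∑ℤ-+ (allFin m) _ _) (cong₂ ℤ._+_ (∑ℤ-*ˡ (allFin m) (H′ ℤ.* H′) _) (trans (sym (pos-∑ (allFin m) _)) (cong ℤ.+_ (∑-const-Fin m (P * P))))) ⟩
          H′ ℤ.* H′ ℤ.* ∑ℤ[ i ← allFin m ] sq (d i) ℤ.+ ℤ.+ (m * (P * P))
            ≤⟨ ℤ.+-monoˡ-≤ (ℤ.+ (m * (P * P))) (ℤ.≤-trans (ℤ.≤-reflexive (cong (ℤ._* ∑ℤ[ i ← allFin m ] sq (d i)) (sym (ℤ.pos-* H H))))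
                (ℤ.≤-trans (ℤ.*-monoˡ-≤-nonNeg (ℤ.+ (H * H)) ∑d²≤) (ℤ.≤-trans (ℤ.≤-reflexive (cong (ℤ._* S₂) (ℤ.pos-* H H))) HHS₂≤))) ⟩
          ℤ.+ (m * (P * P)) ℤ.+ ℤ.+ (m * (P * P))
            ≡⟨ cong ℤ.+_ (eq₃ m P) ⟩
          ℤ.+ (2 * P * (m * P))
            ≡⟨ ℤ.pos-* (2 * P) (m * P) ⟩
          ℤ.+ (2 * P) ℤ.* ℤ.+ (m * P) ∎)
          where
          eq₃ : ∀ m p → m * (p * p) + m * (p * p) ≡ 2 * p * (m * p)
          eq₃ = solve-∀
        upTo≤ : H * ∑[ i ← allFin m ] upTo i (ρ i o) ≤ m * P + H * K
        upTo≤ = R.begin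
          H * ∑[ i ← allFin m ] upTo i (ρ i o)
            R.≡⟨ sym (∑-*ˡ (allFin m) H _) ⟩
          ∑[ i ← allFin m ] (H * upTo i (ρ i o))
            R.≤⟨ ∑-mono (allFin m) (λ i → ≤-trans (mass i (ρ i o)) (+-monoʳ-≤ P (level i (c o)))) ⟩
          ∑[ i ← allFin m ] (P + H * C i (c o))
            R.≡⟨ trans (∑-+ (allFin m) (λ _ → P) _) (cong₂ _+_ (∑-const-Fin m P) (∑-*ˡ (allFin m) H _)) ⟩
          m * P + H * ∑[ i ← allFin m ] C i (c o)
            R.≤⟨ +-monoʳ-≤ (m * P) (*-monoʳ-≤ H (≤K (c o))) ⟩
          m * P + H * K R.∎
          where module R = ≤-Reasoning

  -- The vectors `m * Z i o - S o` have mean zero over the days and squared norm at most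
  -- `L * (m * P)²`. Balancing `M` of them leaves each coordinate `D` of the sum with
  -- `D² ≤ M * L * (m * P)²`, and `M = L * (H * H)` turns this into `H * D ≤ M * m * P`.
  sampleDays : ∀ {m L} H P → 0 < m → (Z : Fin m → Fin L → ℕ) → (∀ i o → Z i o ≤ P) →
               let M = L * (H * H) in
               Σ[ day ∈ (Fin M → Fin m) ]
                 (∀ o → H * (m * ∑[ l ← allFin M ] Z (day l) o) ≤ H * (M * ∑[ i ← allFin m ] Z i o) + M * (m * P))
  sampleDays {m} {L} H P m>0 Z Z≤P = day , bound
    where
    M = L * (H * H)
    mP = m * P
    S : Fin L → ℕ
    S o = ∑[ i ← allFin m ] Z i o
    v : Fin m → Fin L → ℤ
    v i o = ℤ.+ (m * Z i o) ℤ.- ℤ.+ S o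
    β = L * (mP * mP)
    mean : ∀ o → ∑ℤ[ i ← allFin m ] (ℤ.+ 1 ℤ.* v i o) ≡ 0ℤ
    mean o = begin
      ∑ℤ[ i ← allFin m ] (ℤ.+ 1 ℤ.* v i o)
        ≡⟨ ∑ℤ-cong (allFin m) (λ i → ℤ.*-identityˡ (v i o)) ⟩
      ∑ℤ[ i ← allFin m ] (ℤ.+ (m * Z i o) ℤ.+ ℤ.- ℤ.+ S o)
        ≡⟨ ∑ℤ-+ (allFin m) _ _ ⟩
      ∑ℤ[ i ← allFin m ] (ℤ.+ (m * Z i o)) ℤ.+ ∑ℤ[ i ← allFin m ] (ℤ.- ℤ.+ S o)
        ≡⟨ cong₂ ℤ._+_ (trans (sym (pos-∑ (allFin m) _)) (cong ℤ.+_ (∑-*ˡ (allFin m) m _))) neg ⟩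
      ℤ.+ (m * S o) ℤ.+ ℤ.- ℤ.+ (m * S o)
        ≡⟨ ℤ.+-inverseʳ (ℤ.+ (m * S o)) ⟩
      0ℤ ∎
      where
      open ≡-Reasoning
      neg : ∑ℤ[ i ← allFin m ] (ℤ.- ℤ.+ S o) ≡ ℤ.- ℤ.+ (m * S o)
      neg = begin
        ∑ℤ[ i ← allFin m ] (ℤ.- ℤ.+ S o)              ≡⟨ ∑ℤ-cong (allFin m) (λ _ → sym (ℤ.-1*i≡-i (ℤ.+ S o))) ⟩
        ∑ℤ[ i ← allFin m ] (ℤ.-1ℤ ℤ.* ℤ.+ S o)        ≡⟨ ∑ℤ-*ˡ (allFin m) ℤ.-1ℤ _ ⟩
        ℤ.-1ℤ ℤ.* ∑ℤ[ i ← allFin m ] (ℤ.+ S o)        ≡⟨ cong (ℤ.-1ℤ ℤ.*_) (trans (sym (pos-∑ (allFin m) _)) (cong ℤ.+_ (∑-const-Fin m (S o)))) ⟩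
        ℤ.-1ℤ ℤ.* ℤ.+ (m * S o)                       ≡⟨ ℤ.-1*i≡-i (ℤ.+ (m * S o)) ⟩
        ℤ.- ℤ.+ (m * S o)                             ∎
    ∑1≡m : ∑[ _ ← allFin m ] 1 ≡ m
    ∑1≡m = trans (∑-const-Fin m 1) (*-identityʳ m)
    ∑v²≤ : ∀ i → ∑ℤ[ o ← allFin L ] sq (v i o) ℤ.≤ ℤ.+ β
    ∑v²≤ i = ℤ.≤-trans
      (∑ℤ-mono (allFin L) λ o → sq-diff-≤ (*-monoʳ-≤ m (Z≤P i o)) (∑-≤-const m (λ i → Z i o) P (λ i → Z≤P i o)))
      (ℤ.≤-reflexive (trans (sym (pos-∑ (allFin L) _)) (cong ℤ.+_ (∑-const-Fin L (mP * mP)))))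
    step : ∀ (s : Fin M) X → ∃[ i ] ∑ℤ[ o ← allFin L ] sq (X o ℤ.+ v i o) ℤ.≤ ∑ℤ[ o ← allFin L ] sq (X o) ℤ.+ ℤ.+ β
    step s X = balance-step (allFin m) (allFin L) (λ _ → 1) v (ℤ.+ β) X (subst (0 <_) (sym ∑1≡m) m>0) mean
      (ℤ.≤-trans (∑ℤ-mono (allFin m) λ i → ℤ.*-monoˡ-≤-nonNeg (ℤ.+ 1) (∑v²≤ i))
        (ℤ.≤-reflexive (trans (∑ℤ-*ʳ (allFin m) (ℤ.+ β) _) (cong (ℤ._* ℤ.+ β) (sym (pos-∑ (allFin m) _))))))
    balanced = balance M (allFin L) (λ _ → v) (λ _ → ℤ.+ β) step (λ _ → 0ℤ)
    day = proj₁ balanced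
    bound : ∀ o → H * (m * ∑[ l ← allFin M ] Z (day l) o) ≤ H * (M * S o) + M * mP
    bound o = ℤ.drop‿+≤+ (begin
      ℤ.+ (H * (m * U))                                     ≡⟨ trans (ℤ.pos-* H _) (cong (ℤ.+ H ℤ.*_) (sym (cancel (ℤ.+ (m * U)) (ℤ.+ (M * S o))))) ⟩
      ℤ.+ H ℤ.* (ℤ.+ (M * S o) ℤ.+ D)                       ≡⟨ trans (ℤ.*-distribˡ-+ (ℤ.+ H) _ D) (cong (λ y → y ℤ.+ ℤ.+ H ℤ.* D) (sym (ℤ.pos-* H (M * S o)))) ⟩
      ℤ.+ (H * (M * S o)) ℤ.+ ℤ.+ H ℤ.* D                   ≤⟨ ℤ.+-monoʳ-≤ (ℤ.+ (H * (M * S o))) HD≤ ⟩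
      ℤ.+ (H * (M * S o)) ℤ.+ ℤ.+ (M * mP)                  ≡⟨ sym (ℤ.pos-+ (H * (M * S o)) (M * mP)) ⟩
      ℤ.+ (H * (M * S o) + M * mP) ∎)
      where
      open ℤ.≤-Reasoning
      U = ∑[ l ← allFin M ] Z (day l) o
      D = ℤ.+ (m * U) ℤ.- ℤ.+ (M * S o)
      cancel : ∀ x y → y ℤ.+ (x ℤ.- y) ≡ x
      cancel = ℤ-Solver.solve-∀
      D≡ : 0ℤ ℤ.+ ∑ℤ[ l ← allFin M ] v (day l) o ≡ D
      D≡ = trans (ℤ.+-identityˡ (∑ℤ[ l ← allFin M ] v (day l) o)) (trans (∑ℤ-+ (allFin M) _ _) (cong₂ ℤ._+_
        (trans (sym (pos-∑ (allFin M) _)) (cong ℤ.+_ (∑-*ˡ (allFin M) m _)))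
        (trans (∑ℤ-cong (allFin M) (λ _ → sym (ℤ.-1*i≡-i (ℤ.+ S o)))) (trans (∑ℤ-*ˡ (allFin M) ℤ.-1ℤ _)
          (trans (cong (ℤ.-1ℤ ℤ.*_) (trans (sym (pos-∑ (allFin M) _)) (cong ℤ.+_ (∑-const-Fin M (S o))))) (ℤ.-1*i≡-i (ℤ.+ (M * S o))))))))
      D²≤ : sq D ℤ.≤ ℤ.+ (M * β)
      D²≤ = begin
        sq D ≡⟨ cong sq (sym D≡) ⟩
        sq (0ℤ ℤ.+ ∑ℤ[ l ← allFin M ] v (day l) o)
          ≤⟨ ∑ℤ-∈ L (λ o → sq (0ℤ ℤ.+ ∑ℤ[ l ← allFin M ] v (day l) o)) (λ o → sq≥0 (0ℤ ℤ.+ ∑ℤ[ l ← allFin M ] v (day l) o)) o ⟩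
        ∑ℤ[ o ← allFin L ] sq (0ℤ ℤ.+ ∑ℤ[ l ← allFin M ] v (day l) o)
          ≤⟨ proj₂ balanced ⟩
        ∑ℤ[ o ← allFin L ] sq 0ℤ ℤ.+ ∑ℤ[ _ ← allFin M ] (ℤ.+ β)
          ≡⟨ trans (cong₂ ℤ._+_ (∑ℤ-zero (allFin L)) (trans (sym (pos-∑ (allFin M) _)) (cong ℤ.+_ (∑-const-Fin M β)))) (ℤ.+-identityˡ (ℤ.+ (M * β))) ⟩
        ℤ.+ (M * β) ∎
      HD≤ : ℤ.+ H ℤ.* D ℤ.≤ ℤ.+ (M * mP)
      HD≤ = sq-cancel-≤ (ℤ.+ H ℤ.* D) (M * mP) (begin
        sq (ℤ.+ H ℤ.* D)             ≡⟨ eq₁ (ℤ.+ H) D ⟩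
        ℤ.+ H ℤ.* ℤ.+ H ℤ.* sq D     ≡⟨ cong (ℤ._* sq D) (sym (ℤ.pos-* H H)) ⟩
        ℤ.+ (H * H) ℤ.* sq D         ≤⟨ ℤ.*-monoˡ-≤-nonNeg (ℤ.+ (H * H)) D²≤ ⟩
        ℤ.+ (H * H) ℤ.* ℤ.+ (M * β)  ≡⟨ sym (ℤ.pos-* (H * H) (M * β)) ⟩
        ℤ.+ (H * H * (M * β))        ≡⟨ cong ℤ.+_ (eq₂ (H * H) L mP) ⟩
        ℤ.+ (M * mP * (M * mP))      ≡⟨ ℤ.pos-* (M * mP) (M * mP) ⟩
        sq (ℤ.+ (M * mP)) ∎)
        where
        eq₁ : ∀ h d → (h ℤ.* d) ℤ.* (h ℤ.* d) ≡ h ℤ.* h ℤ.* (d ℤ.* d)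
        eq₁ = ℤ-Solver.solve-∀
        eq₂ : ∀ g l q → g * (l * g * (l * (q * q))) ≡ l * g * q * (l * g * q)
        eq₂ = solve-∀

  -- Completion times

  maximal : ∀ {A : Set} {Q : A → Set} (Q? : ∀ x → Dec (Q x)) (f : A → ℕ) (xs : List A) →
            (∀ {x} → x ∈ xs → ¬ Q x) ⊎ (∃[ y ] Q y × (∀ {x} → x ∈ xs → Q x → f x ≤ f y))
  maximal Q? f []       = inj₁ λ ()
  maximal Q? f (x ∷ xs) with Q? x | maximal Q? f xs
  ... | no ¬q | inj₁ none = inj₁ λ { (here refl) → ¬q ; (there x∈) → none x∈ }
  ... | yes q | inj₁ none = inj₂ (x , q , λ { (here refl) _ → ≤-refl ; (there x∈) q′ → contradiction q′ (none x∈) })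
  ... | no ¬q | inj₂ (y , qy , y-max) = inj₂ (y , qy , λ { (here refl) q → contradiction q ¬q ; (there x∈) → y-max x∈ })
  ... | yes q | inj₂ (y , qy , y-max) with f x ≤? f y
  ...   | yes x≤y = inj₂ (y , qy , λ { (here refl) _ → x≤y ; (there x∈) → y-max x∈ })
  ...   | no  x≰y = inj₂ (x , q , λ { (here refl) _ → ≤-refl ; (there x∈) q′ → ≤-trans (y-max x∈ q′) (<⇒≤ (≰⇒> x≰y)) })

  module Completion {n : ℕ} (p : Fin n → ℕ) where

    P : ℕ
    P = ∑ (allFin n) p

    completion : Permutation′ n → Fin n → ℕ
    completion σ j = ∑[ ℓ ← allFin n ] (ind ((σ ⟨$⟩ʳ ℓ) Fin.≤? (σ ⟨$⟩ʳ j)) * p ℓ)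

    completion≤P : ∀ σ j → completion σ j ≤ P
    completion≤P σ j = ∑-mono (allFin n) λ ℓ → ind*≤ ((σ ⟨$⟩ʳ ℓ) Fin.≤? (σ ⟨$⟩ʳ j)) (p ℓ)

    -- When the last client satisfying `Q` completes, all clients satisfying `Q` have been
    -- processed.
    mass-below : ∀ σ {Q : Fin n → Set} (Q? : ∀ j → Dec (Q j)) →
                 ∑[ j ← allFin n ] (p j * ind (Q? j)) ≡ 0 ⊎
                 (∃[ j ] Q j × ∑[ ℓ ← allFin n ] (p ℓ * ind (Q? ℓ)) ≤ completion σ j)
    mass-below σ Q? with maximal Q? (λ j → toℕ (σ ⟨$⟩ʳ j)) (allFin n)
    ... | inj₁ none = inj₁ (trans (∑-cong (allFin n) λ j →
            trans (cong (p j *_) (ind-no (Q? j) (none (∈-allFin j)))) (*-zeroʳ (p j))) (∑-zero (allFin n)))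
    ... | inj₂ (y , qy , y-max) = inj₂ (y , qy , ∑-mono (allFin n) λ ℓ →
            ≤-trans (≤-reflexive (*-comm (p ℓ) _))
                    (*-monoˡ-≤ (p ℓ) (ind-mono (Q? ℓ) ((σ ⟨$⟩ʳ ℓ) Fin.≤? (σ ⟨$⟩ʳ y)) (y-max (∈-allFin ℓ)))))

    -- Of any two clients one does not come after the other, so each product `p j * p ℓ` is
    -- contained in `p j * completion σ j` or in `p ℓ * completion σ ℓ`.
    P²≤2∑pC : ∀ σ → P * P ≤ 2 * ∑[ j ← allFin n ] (p j * completion σ j)
    P²≤2∑pC σ = begin
      P * P
        ≡⟨ trans (sym (∑-*ʳ (allFin n) P p)) (∑-cong (allFin n) λ j → sym (∑-*ˡ (allFin n) (p j) p)) ⟩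
      ∑[ j ← allFin n ] ∑[ ℓ ← allFin n ] (p j * p ℓ)
        ≤⟨ ∑-mono (allFin n) (λ j → ∑-mono (allFin n) λ ℓ → total j ℓ) ⟩
      ∑[ j ← allFin n ] ∑[ ℓ ← allFin n ] (p j * (le ℓ j * p ℓ) + p ℓ * (le j ℓ * p j))
        ≡⟨ trans (∑-cong (allFin n) λ j → ∑-+ (allFin n) _ _) (∑-+ (allFin n) _ _) ⟩
      ∑[ j ← allFin n ] ∑[ ℓ ← allFin n ] (p j * (le ℓ j * p ℓ)) + ∑[ j ← allFin n ] ∑[ ℓ ← allFin n ] (p ℓ * (le j ℓ * p j))
        ≡⟨ cong₂ _+_ once (trans (∑-swap (allFin n) (allFin n) _) once) ⟩
      T + T
        ≡⟨ cong (T +_) (sym (+-identityʳ T)) ⟩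
      2 * T ∎
      where
      open ≤-Reasoning
      T = ∑[ j ← allFin n ] (p j * completion σ j)
      le : Fin n → Fin n → ℕ
      le ℓ j = ind ((σ ⟨$⟩ʳ ℓ) Fin.≤? (σ ⟨$⟩ʳ j))
      once : ∑[ j ← allFin n ] ∑[ ℓ ← allFin n ] (p j * (le ℓ j * p ℓ)) ≡ T
      once = ∑-cong (allFin n) λ j → ∑-*ˡ (allFin n) (p j) _
      total : ∀ j ℓ → p j * p ℓ ≤ p j * (le ℓ j * p ℓ) + p ℓ * (le j ℓ * p j)
      total j ℓ with (σ ⟨$⟩ʳ ℓ) Fin.≤? (σ ⟨$⟩ʳ j) | (σ ⟨$⟩ʳ j) Fin.≤? (σ ⟨$⟩ʳ ℓ)
      ... | yes _   | _       = ≤-trans (≤-reflexive (cong (p j *_) (sym (+-identityʳ (p ℓ))))) (m≤m+n _ _)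
      ... | no _    | yes _   = ≤-trans (≤-reflexive (trans (*-comm (p j) (p ℓ)) (cong (p ℓ *_) (sym (+-identityʳ (p j)))))) (m≤n+m _ (p j * 0))
      ... | no ¬ℓ≤j | no ¬j≤ℓ = contradiction (≰⇒≥ ¬ℓ≤j) ¬j≤ℓ

  jobCompletion≡ : ∀ {n m} (I : Instance n m) π i j → jobCompletion I π i j ≡ Completion.completion (p I) (π i) j
  jobCompletion≡ {n} I π i j = ∑-filter (λ ℓ → (π i ⟨$⟩ʳ ℓ) Fin.≤? (π i ⟨$⟩ʳ j)) (allFin n) (p I)

  module Bounds {n m : ℕ} (I : Instance n m) (π : Schedule n m) where

    open Completion (p I)

    C : Fin m → Fin n → ℕ
    C i = completion (π i)

    clientCompletion≡ : ∀ j → clientCompletion I π j ≡ ∑[ i ← allFin m ] C i j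
    clientCompletion≡ j = ∑-cong (allFin m) λ i → jobCompletion≡ I π i j

    ∑C≤objective : ∀ j → ∑[ i ← allFin m ] C i j ≤ objective I π
    ∑C≤objective j = ≤-trans (≤-reflexive (sym (clientCompletion≡ j))) (≤-max (clientCompletion I π) (∈-allFin j))

    -- The maximum is at least the mean weighted by processing times, and by `P²≤2∑pC` every day
    -- contributes at least `P / 2` to that mean, whatever its order.
    mP≤2objective : 0 < P → m * P ≤ 2 * objective I π
    mP≤2objective P>0 = *-cancelʳ-≤ (m * P) (2 * K) P {{>-nonZero P>0}} (begin
      m * P * P
        ≡⟨ trans (*-assoc m P P) (sym (∑-const-Fin m (P * P))) ⟩
      ∑[ _ ← allFin m ] (P * P)
        ≤⟨ ∑-mono (allFin m) (λ i → P²≤2∑pC (π i)) ⟩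
      ∑[ i ← allFin m ] (2 * ∑[ j ← allFin n ] (p I j * C i j))
        ≡⟨ trans (∑-*ˡ (allFin m) 2 _) (cong (2 *_) (trans (∑-swap (allFin m) (allFin n) _) (∑-cong (allFin n) λ j → ∑-*ˡ (allFin m) (p I j) _))) ⟩
      2 * ∑[ j ← allFin n ] (p I j * ∑[ i ← allFin m ] C i j)
        ≤⟨ *-monoʳ-≤ 2 (∑-mono (allFin n) λ j → *-monoʳ-≤ (p I j) (∑C≤objective j)) ⟩
      2 * ∑[ j ← allFin n ] (p I j * K)
        ≡⟨ trans (cong (2 *_) (trans (∑-*ʳ (allFin n) K (p I)) (*-comm P K))) (sym (*-assoc 2 K P)) ⟩
      2 * K * P ∎)
      where
      open ≤-Reasoning
      K = objective I π

  module Levels {n m : ℕ} (I : Instance n m) (π : Schedule n m) (H : ℕ) .{{_ : NonZero (Completion.P (p I))}} where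

    open Completion (p I)
    open Bounds I π

    -- There are `suc H` levels and not `H`, because the last client of a day completes at `P` and
    -- gets level `H`.
    lev : Fin m → Fin n → Fin (suc H)
    lev i j = Fin.fromℕ< (m<n*o⇒m/o<n {H * C i j} {suc H} {P}
      (≤-<-trans (*-monoʳ-≤ H (completion≤P (π i) j)) (m<n+m (H * P) (>-nonZero⁻¹ P))))

    toℕ-lev : ∀ i j → toℕ (lev i j) ≡ H * C i j / P
    toℕ-lev i j = Fin.toℕ-fromℕ< _

    lev-lower : ∀ i j → toℕ (lev i j) * P ≤ H * C i j
    lev-lower i j = ≤-trans (≤-reflexive (cong (_* P) (toℕ-lev i j))) (m/n*n≤m (H * C i j) P)

    lev-mass : ∀ i (h : Fin (suc H)) → H * ∑[ j ← allFin n ] (p I j * ind (lev i j Fin.≤? h)) ≤ suc (toℕ h) * P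
    lev-mass i h = bound (mass-below (π i) (λ j → lev i j Fin.≤? h))
      where
      open ≤-Reasoning
      bound : ∀ {S} → S ≡ 0 ⊎ (∃[ j ] lev i j Fin.≤ h × S ≤ C i j) → H * S ≤ suc (toℕ h) * P
      bound (inj₁ refl) = ≤-trans (≤-reflexive (*-zeroʳ H)) z≤n
      bound (inj₂ (j , lev≤h , le)) = ≤-trans (*-monoʳ-≤ H le) (<⇒≤ (begin-strict
        H * C i j                             ≡⟨ m≡m%n+[m/n]*n (H * C i j) P ⟩
        H * C i j % P + H * C i j / P * P     <⟨ +-monoˡ-< _ (m%n<n (H * C i j) P) ⟩
        suc (H * C i j / P) * P               ≤⟨ *-monoˡ-≤ P (s≤s (≤-trans (≤-reflexive (sym (toℕ-lev i j))) lev≤h)) ⟩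
        suc (toℕ h) * P                       ∎))

  -- Client j belongs to the cell of length P / L in which its job starts when
  -- the jobs are processed in index order.
  module Window {n : ℕ} (p : Fin n → ℕ) (p>0 : ∀ j → 0 < p j) (L : ℕ) .{{_ : NonZero L}}
                .{{_ : NonZero (Completion.P p)}} where

    open Completion p

    pre<P : ∀ j → pre (toℕ j) p < P
    pre<P j = <-≤-trans (m<m+n (pre (toℕ j) p) (p>0 j)) (≤-trans (≤-reflexive (sym (pre-suc j p))) (pre≤ (suc (toℕ j)) p))

    obj : Fin n → Fin L
    obj j = Fin.fromℕ< (m<n*o⇒m/o<n {pre (toℕ j) p * L} {L} {P} (<-≤-trans (*-monoˡ-< L (pre<P j)) (≤-reflexive (*-comm P L))))

    toℕ-obj : ∀ j → toℕ (obj j) ≡ pre (toℕ j) p * L / P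
    toℕ-obj j = Fin.toℕ-fromℕ< _

    consecutive : Cells.Consecutive p obj
    consecutive j rewrite toℕ-obj j = m/n*n≤m (pre (toℕ j) p * L) P
      , ≤-trans (≤-reflexive (cong suc (m≡m%n+[m/n]*n (pre (toℕ j) p * L) P))) (+-monoˡ-< _ (m%n<n (pre (toℕ j) p * L) P))

  -- Ranking

  -- If `y` were missed, punching it out would embed `Fin (suc n)` into `Fin n`.
  injective⇒surjective : ∀ {n} (f : Fin n → Fin n) → (∀ {x y} → f x ≡ f y → x ≡ y) → ∀ y → ∃[ x ] f x ≡ y
  injective⇒surjective {suc n} f inj y with Fin.any? (λ x → f x Fin.≟ y)
  ... | yes ∃x = ∃x
  ... | no ∄x  = contradiction (Fin.injective⇒≤ {f = λ x → Fin.punchOut (y≢f x)} (λ eq → inj (Fin.punchOut-injective (y≢f _) (y≢f _) eq))) 1+n≰n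
    where
    y≢f : ∀ x → y ≢ f x
    y≢f x eq = ∄x (x , sym eq)

  module Ranking {n : ℕ} (κ : Fin n → ℕ) where

    -- The lexicographic order by class `κ` and then by index, coded as one number so that ties are
    -- broken. It doubles as a clock: the program visits the pairs of a class `h` and a client `i`
    -- at the times `h * n + toℕ i`, and `key j` is the time at which it places `j`.
    key : Fin n → ℕ
    key j = κ j * n + toℕ j

    rank : ℕ → ℕ
    rank t = ∑[ x ← allFin n ] ind (key x <? t)

    key-injective : ∀ {h} x y → h * n + toℕ x ≡ key y → x ≡ y × h ≡ κ y
    key-injective {h} x y eq = Fin.toℕ-injective x≡y , *-cancelʳ-≡ h (κ y) n (+-cancelʳ-≡ (toℕ x) (h * n) (κ y * n) (trans eq (cong (κ y * n +_) (sym x≡y))))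
      where
      instance
        n≢0 : NonZero n
        n≢0 = Fin.nonZeroIndex x
      residue : ∀ h (j : Fin n) → (h * n + toℕ j) % n ≡ toℕ j
      residue h j = trans (cong (_% n) (+-comm (h * n) (toℕ j))) (trans ([m+kn]%n≡m%n (toℕ j) h n) (m<n⇒m%n≡m (Fin.toℕ<n j)))
      x≡y : toℕ x ≡ toℕ y
      x≡y = trans (sym (residue h x)) (trans (cong (_% n) eq) (residue (κ y) y))

    rank-zero : rank 0 ≡ 0
    rank-zero = trans (∑-cong (allFin n) λ x → ind-no (key x <? 0) λ ()) (∑-zero (allFin n))

    rank-mono : ∀ {t u} → t ≤ u → rank t ≤ rank u
    rank-mono {t} {u} t≤u = ∑-mono (allFin n) λ x → ind-mono (key x <? t) (key x <? u) (λ lt → <-≤-trans lt t≤u)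

    rank≤n : ∀ t → rank t ≤ n
    rank≤n t = ≤-trans (∑-≤-const n _ 1 λ x → ind≤1 (key x <? t)) (≤-reflexive (*-identityʳ n))

    -- Only client `i` can have the key `h * n + toℕ i`, and it does exactly if its class is `h`.
    -- This mirrors one iteration of the program, whose accumulator is `rank` of the current time.
    rank-suc : ∀ h i → rank (suc (h * n + toℕ i)) ≡ rank (h * n + toℕ i) + ind (κ i ≟ h)
    rank-suc h i = begin
      rank (suc t)
        ≡⟨ ∑-cong (allFin n) split ⟩
      ∑[ x ← allFin n ] (ind (key x <? t) + ind (i Fin.≟ x) * ind (κ x ≟ h))
        ≡⟨ ∑-+ (allFin n) _ _ ⟩
      rank t + ∑[ x ← allFin n ] (ind (i Fin.≟ x) * ind (κ x ≟ h))
        ≡⟨ cong (rank t +_) (∑-single (i Fin.≟_) (λ x → ind (κ x ≟ h)) refl (λ _ → sym)) ⟩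
      rank t + ind (κ i ≟ h) ∎
      where
      open ≡-Reasoning
      t = h * n + toℕ i
      split : ∀ x → ind (key x <? suc t) ≡ ind (key x <? t) + ind (i Fin.≟ x) * ind (κ x ≟ h)
      split x with key x ≟ t
      ... | yes eq with refl , refl ← key-injective {h} i x (sym eq) =
        trans (ind-yes (key x <? suc t) (s≤s (≤-reflexive eq))) (sym (cong₂ _+_
          (ind-no (key x <? t) (<-irrefl eq))
          (cong₂ _*_ (ind-yes (i Fin.≟ i) refl) (ind-yes (κ x ≟ h) refl))))
      ... | no neq = trans
        (ind-⇔ (key x <? suc t) (key x <? t) (λ lt → ≤∧≢⇒< (s≤s⁻¹ lt) neq) m<n⇒m<1+n)
        (trans (sym (+-identityʳ _)) (cong (ind (key x <? t) +_) (sym (off x neq))))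
        where
        off : ∀ x → key x ≢ t → ind (i Fin.≟ x) * ind (κ x ≟ h) ≡ 0
        off x neq with i Fin.≟ x | κ x ≟ h
        ... | no _     | _        = refl
        ... | yes _    | no _     = refl
        ... | yes refl | yes refl = contradiction refl neq

    rank-key : ∀ j → rank (suc (key j)) ≡ suc (rank (key j))
    rank-key j = trans (rank-suc (κ j) j) (trans (cong (rank (key j) +_) (ind-yes (κ j ≟ κ j) refl)) (+-comm _ 1))

    position : Fin n → Fin n
    position j = Fin.fromℕ< {rank (key j)} (≤-trans (≤-reflexive (sym (rank-key j))) (rank≤n _))

    toℕ-position : ∀ j → toℕ (position j) ≡ rank (key j)
    toℕ-position j = Fin.toℕ-fromℕ< _

    key<⇒position< : ∀ {i j} → key i < key j → toℕ (position i) < toℕ (position j)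
    key<⇒position< {i} {j} lt rewrite toℕ-position i | toℕ-position j = ≤-trans (≤-reflexive (sym (rank-key i))) (rank-mono lt)

    position-injective : ∀ {i j} → position i ≡ position j → i ≡ j
    position-injective {i} {j} eq with <-cmp (key i) (key j)
    ... | tri< lt _ _ = contradiction (cong toℕ eq) (<⇒≢ (key<⇒position< lt))
    ... | tri> _ _ gt = contradiction (cong toℕ (sym eq)) (<⇒≢ (key<⇒position< gt))
    ... | tri≈ _ k≡ _ = proj₁ (key-injective {κ i} i j k≡)

    private
      position⁻¹ : ∀ y → ∃[ x ] position x ≡ y
      position⁻¹ = injective⇒surjective position position-injective

    order : Permutation′ n
    order = Perm.permutation position (proj₁ ∘ position⁻¹) (proj₂ ∘ position⁻¹) (λ x → position-injective (proj₂ (position⁻¹ (position x))))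

    position≤⇒κ≤ : ∀ {i j} → toℕ (order ⟨$⟩ʳ i) ≤ toℕ (order ⟨$⟩ʳ j) → κ i ≤ κ j
    position≤⇒κ≤ {i} {j} le with κ i ≤? κ j
    ... | yes κ≤ = κ≤
    ... | no  κ≰ = contradiction le (<⇒≱ (key<⇒position< (begin-strict
      κ j * n + toℕ j  <⟨ +-monoʳ-< (κ j * n) (Fin.toℕ<n j) ⟩
      κ j * n + n      ≡⟨ +-comm (κ j * n) n ⟩
      suc (κ j) * n    ≤⟨ *-monoˡ-≤ n (≰⇒> κ≰) ⟩
      κ i * n          ≤⟨ m≤m+n _ (toℕ i) ⟩
      κ i * n + toℕ i  ∎)))
      where open ≤-Reasoning

  -- The best schedule of the objects

  module Table (D L R : ℕ) .{{_ : NonZero R}} where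

    Plan : Set
    Plan = Fin D → Fin L → Fin R

    planCost : (Fin L → ℕ) → Plan → Fin L → ℕ
    planCost w ρ o = ∑[ i ← allFin D ] massUpTo w (ρ i) o

    worst : (Fin L → ℕ) → Plan → ℕ
    worst w ρ = max 0 (map (planCost w ρ) (allFin L))

    private
      decodePlan : Fin ((R ^ L) ^ D) → Plan
      decodePlan c i = Fin.finToFun (Fin.finToFun c i)

      encodePlan : Plan → Fin ((R ^ L) ^ D)
      encodePlan ρ = Fin.funToFin (λ i → Fin.funToFin (ρ i))

      decode-encodePlan : ∀ ρ i o → decodePlan (encodePlan ρ) i o ≡ ρ i o
      decode-encodePlan ρ i o rewrite Fin.finToFun-funToFin (λ i → Fin.funToFin (ρ i)) i = Fin.finToFun-funToFin (ρ i) o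

      cost-cong : ∀ w {ρ ρ′ : Plan} → (∀ i o → ρ i o ≡ ρ′ i o) → ∀ o → planCost w ρ o ≡ planCost w ρ′ o
      cost-cong w {ρ} {ρ′} eq o = ∑-cong (allFin D) λ i → ∑-cong (allFin L) λ o′ →
        cong (_* w o′) (ind-⇔ (ρ i o′ Fin.≤? ρ i o) (ρ′ i o′ Fin.≤? ρ′ i o)
          (subst₂ Fin._≤_ (eq i o′) (eq i o)) (subst₂ Fin._≤_ (sym (eq i o′)) (sym (eq i o))))

    -- Exhaustive search over all plans. It belongs to the construction of the program, not to its
    -- execution, so its size does not enter the running time.
    best : (Fin L → ℕ) → Plan
    best w = decodePlan (Extrema.argmin (worst w ∘ decodePlan) (encodePlan (λ _ _ → Fin.fromℕ< (>-nonZero⁻¹ R))) (allFin _))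

    best-≤ : ∀ {c} k w ρ → (∀ o → k * planCost w ρ o ≤ c) → ∀ o → k * planCost w (best w) o ≤ c
    best-≤ {c} k w ρ le o = begin
      k * planCost w (best w) o                       ≤⟨ *-monoʳ-≤ k (≤-max (planCost w (best w)) (∈-allFin o)) ⟩
      k * worst w (best w)                         ≤⟨ *-monoʳ-≤ k (All.lookup (Extrema.f[argmin]≤f[xs] {f = worst w ∘ decodePlan} (encodePlan (λ _ _ → Fin.fromℕ< (>-nonZero⁻¹ R))) (allFin _)) (∈-allFin (encodePlan ρ))) ⟩
      k * worst w (decodePlan (encodePlan ρ))      ≤⟨ *-max-≤ k (allFin L) _ (λ o → ≤-trans (≤-reflexive (cong (k *_) (cost-cong w (decode-encodePlan ρ) o))) (le o)) ⟩
      c                                            ∎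
      where open ≤-Reasoning

  -- The rounded instance and its best plan

  -- L cells, of sizes rounded to multiples of P / V; schedules for M₀ or more
  -- days are periodic with period M.
  module Params (H : ℕ) where

    L V M M₀ : ℕ
    L  = suc H * (H * H)
    V  = L * H
    M  = L * (H * H)
    M₀ = H * M

  module Rounding {n m : ℕ} (I : Instance n m) .{{_ : NonZero n}} .{{_ : NonZero m}} (H : ℕ) .{{_ : NonZero H}} where

    open Completion (p I) public

    open Params H public

    P>0 : 0 < P
    P>0 = <-≤-trans (p>0 I j₀) (∑-∈ (p I) (∈-allFin j₀))
      where
      j₀ : Fin n
      j₀ = Fin.fromℕ< (>-nonZero⁻¹ n)

    instance
      P≢0 : NonZero P
      P≢0 = >-nonZero P>0
      HH≢0 : NonZero (H * H)
      HH≢0 = m*n≢0 H H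
      L≢0 : NonZero L
      L≢0 = m*n≢0 (suc H) (H * H)
      V≢0 : NonZero V
      V≢0 = m*n≢0 L H
      M≢0 : NonZero M
      M≢0 = m*n≢0 L (H * H)

    open Window (p I) (p>0 I) L public
    open Cells (p I) obj public hiding (P)

    size : Fin L → ℕ
    size o = z o * V / P

    module _ (π : Schedule n m) where

      private
        K = objective I π

      clustered : Σ[ ρ ∈ (Fin m → Fin L → Fin (suc H)) ]
                  (∀ o → H * ∑[ i ← allFin m ] massUpTo z (ρ i) o ≤ H * K + 2 * (m * P))
      clustered = cluster (p I) obj (Levels.lev I π H) (Bounds.C I π) (Fin.fromℕ< (>-nonZero⁻¹ n)) P>0 consecutive
                    (Levels.lev-mass I π H) (Levels.lev-lower I π H) (Bounds.∑C≤objective I π)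

      -- Multiplying by `m` and `D` gives one statement for both kinds of plan. For `D = m` the days
      -- are used as they are; for `D = M` sampling adds the third error of `m * P / H`.
      plan-exists : ∀ {D} → D ≡ m ⊎ D ≡ M → Σ[ ρ ∈ (Fin D → Fin L → Fin (suc H)) ]
                    (∀ o → H * (m * ∑[ l ← allFin D ] massUpTo z (ρ l) o) ≤ D * (H * K + 3 * (m * P)))
      plan-exists (inj₁ refl) = proj₁ clustered , λ o → begin
        H * (m * S o)                               ≡⟨ comm H m (S o) ⟩
        m * (H * S o)                               ≤⟨ *-monoʳ-≤ m (proj₂ clustered o) ⟩
        m * (H * K + 2 * (m * P))                   ≤⟨ *-monoʳ-≤ m (+-monoʳ-≤ (H * K) (*-monoˡ-≤ (m * P) {2} {3} (s≤s (s≤s z≤n)))) ⟩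
        m * (H * K + 3 * (m * P))                   ∎
        where
        open ≤-Reasoning
        S : Fin L → ℕ
        S o = ∑[ i ← allFin m ] massUpTo z (proj₁ clustered i) o
        comm : ∀ h m s → h * (m * s) ≡ m * (h * s)
        comm = solve-∀
      plan-exists (inj₂ refl) = proj₁ clustered ∘ proj₁ sampled , λ o → begin
        H * (m * ∑[ l ← allFin M ] massUpTo z (proj₁ clustered (proj₁ sampled l)) o) ≤⟨ proj₂ sampled o ⟩
        H * (M * S o) + M * (m * P)                 ≡⟨ factor H M (S o) (m * P) ⟩
        M * (H * S o + m * P)                       ≤⟨ *-monoʳ-≤ M (+-monoˡ-≤ (m * P) (proj₂ clustered o)) ⟩
        M * (H * K + 2 * (m * P) + m * P)           ≡⟨ cong (M *_) (collect (H * K) (m * P)) ⟩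
        M * (H * K + 3 * (m * P))                   ∎
        where
        open ≤-Reasoning
        S : Fin L → ℕ
        S o = ∑[ i ← allFin m ] massUpTo z (proj₁ clustered i) o
        sampled = sampleDays H P (>-nonZero⁻¹ m) (λ i → massUpTo z (proj₁ clustered i))
                    (λ i o → ≤-trans (massUpTo≤ z (proj₁ clustered i) o) (≤-reflexive ∑z≡P))
        factor : ∀ h M s q → h * (M * s) + M * q ≡ M * (h * s + q)
        factor = solve-∀
        collect : ∀ k q → k + 2 * q + q ≡ k + 3 * q
        collect = solve-∀

    -- The sizes are a variable `σ` because a leaf of the decision tree is built for hard-wired
    -- numbers, of which it is only known that they agree pointwise with `size`.
    module _ {σ : Fin L → ℕ} (σ≡ : ∀ o → σ o ≡ size o) where

      P*size≤ : ∀ o → P * σ o ≤ V * z o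
      P*size≤ o = ≤-trans (≤-reflexive (trans (cong (P *_) (σ≡ o)) (*-comm P _))) (≤-trans (m/n*n≤m (z o * V) P) (≤-reflexive (*-comm (z o) V)))

      ≤P*size : ∀ o → V * z o ≤ P * σ o + P
      ≤P*size o = begin
        V * z o                              ≡⟨ trans (*-comm V (z o)) (m≡m%n+[m/n]*n (z o * V) P) ⟩
        z o * V % P + z o * V / P * P        ≤⟨ +-monoˡ-≤ _ (<⇒≤ (m%n<n (z o * V) P)) ⟩
        P + z o * V / P * P                  ≡⟨ trans (+-comm P _) (cong (_+ P) (*-comm _ P)) ⟩
        P * (z o * V / P) + P                ≡⟨ cong (λ x → P * x + P) (sym (σ≡ o)) ⟩
        P * σ o + P                          ∎
        where open ≤-Reasoning

      module _ {D : ℕ} (D≡ : D ≡ m ⊎ D ≡ M) (π : Schedule n m) where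

        open Table D L (suc H)

        private
          K = objective I π
          ρ* = best σ

        -- The plan is optimal for the rounded sizes, so the true sizes are left and re-entered.
        -- Rounding down does not raise the cost of the plan from `plan-exists` (`lower`); going
        -- back to true sizes costs the best plan at most `L * P / V = P / H` per day (`upper`), the
        -- fourth error.
        best-plan : ∀ o → H * (m * ∑[ l ← allFin D ] massUpTo z (ρ* l) o) ≤ D * (H * K + 4 * (m * P))
        best-plan o = *-cancelˡ-≤ V (begin
          V * (H * (m * ∑[ l ← allFin D ] massUpTo z (ρ* l) o))
            ≡⟨ comm V H m _ ⟩
          H * m * (V * ∑[ l ← allFin D ] massUpTo z (ρ* l) o)
            ≡⟨ cong (H * m *_) (sym (∑-*ˡ (allFin D) V _)) ⟩
          H * m * ∑[ l ← allFin D ] (V * massUpTo z (ρ* l) o)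
            ≤⟨ *-monoʳ-≤ (H * m) (∑-mono (allFin D) (λ l → upper (ρ* l))) ⟩
          H * m * ∑[ l ← allFin D ] (P * massUpTo σ (ρ* l) o + L * P)
            ≡⟨ cong (H * m *_) (trans (∑-+ (allFin D) _ _) (cong₂ _+_ (∑-*ˡ (allFin D) P _) (∑-const-Fin D (L * P)))) ⟩
          H * m * (P * planCost σ ρ* o + D * (L * P))
            ≡⟨ split H m P (planCost σ ρ* o) D L ⟩
          H * m * P * planCost σ ρ* o + V * (D * (m * P))
            ≤⟨ +-monoˡ-≤ _ (best-≤ (H * m * P) σ (proj₁ plan) plan≤ o) ⟩
          V * (D * (H * K + 3 * (m * P))) + V * (D * (m * P))
            ≡⟨ collect V D (H * K) (m * P) ⟩
          V * (D * (H * K + 4 * (m * P))) ∎)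
          where
          open ≤-Reasoning
          plan = plan-exists π D≡
          comm : ∀ v h m s → v * (h * (m * s)) ≡ h * m * (v * s)
          comm = solve-∀
          split : ∀ h m p c d l → h * m * (p * c + d * (l * p)) ≡ h * m * p * c + l * h * (d * (m * p))
          split = solve-∀
          collect : ∀ v d k q → v * (d * (k + 3 * q)) + v * (d * q) ≡ v * (d * (k + 4 * q))
          collect = solve-∀
          upper : ∀ ρ → V * massUpTo z ρ o ≤ P * massUpTo σ ρ o + L * P
          upper ρ = begin
            V * massUpTo z ρ o
              ≡⟨ sym (∑-*ˡ (allFin L) V _) ⟩
            ∑[ o′ ← allFin L ] (V * (ind (ρ o′ Fin.≤? ρ o) * z o′))
              ≤⟨ ∑-mono (allFin L) (λ o′ → term (ρ o′ Fin.≤? ρ o) o′) ⟩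
            ∑[ o′ ← allFin L ] (P * (ind (ρ o′ Fin.≤? ρ o) * σ o′) + P)
              ≡⟨ trans (∑-+ (allFin L) _ _) (cong₂ _+_ (∑-*ˡ (allFin L) P _) (∑-const-Fin L P)) ⟩
            P * massUpTo σ ρ o + L * P ∎
            where
            term : ∀ {Q : Set} (d : Dec Q) o′ → V * (ind d * z o′) ≤ P * (ind d * σ o′) + P
            term (yes _) o′ = ≤-trans (≤-reflexive (cong (V *_) (+-identityʳ (z o′))))
              (≤-trans (≤P*size o′) (≤-reflexive (cong (λ x → P * x + P) (sym (+-identityʳ (σ o′))))))
            term (no _)  o′ = ≤-trans (≤-reflexive (*-zeroʳ V)) z≤n
          lower : ∀ ρ o → P * massUpTo σ ρ o ≤ V * massUpTo z ρ o
          lower ρ o = begin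
            P * massUpTo σ ρ o
              ≡⟨ sym (∑-*ˡ (allFin L) P _) ⟩
            ∑[ o′ ← allFin L ] (P * (ind (ρ o′ Fin.≤? ρ o) * σ o′))
              ≤⟨ ∑-mono (allFin L) (λ o′ → ≤-trans (≤-reflexive (left-comm P (ind (ρ o′ Fin.≤? ρ o)) (σ o′)))
                   (≤-trans (*-monoʳ-≤ (ind (ρ o′ Fin.≤? ρ o)) (P*size≤ o′)) (≤-reflexive (left-comm (ind (ρ o′ Fin.≤? ρ o)) V (z o′))))) ⟩
            ∑[ o′ ← allFin L ] (V * (ind (ρ o′ Fin.≤? ρ o) * z o′))
              ≡⟨ ∑-*ˡ (allFin L) V _ ⟩
            V * massUpTo z ρ o ∎
            where
            left-comm : ∀ a b c → a * (b * c) ≡ b * (a * c)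
            left-comm = solve-∀
          plan≤ : ∀ o → H * m * P * planCost σ (proj₁ plan) o ≤ V * (D * (H * K + 3 * (m * P)))
          plan≤ o = begin
            H * m * P * planCost σ ρ o
              ≡⟨ trans (*-assoc (H * m) P _) (cong (H * m *_) (sym (∑-*ˡ (allFin D) P _))) ⟩
            H * m * ∑[ l ← allFin D ] (P * massUpTo σ (ρ l) o)
              ≤⟨ *-monoʳ-≤ (H * m) (∑-mono (allFin D) λ l → lower (ρ l) o) ⟩
            H * m * ∑[ l ← allFin D ] (V * massUpTo z (ρ l) o)
              ≡⟨ trans (cong (H * m *_) (∑-*ˡ (allFin D) V _)) (sym (comm V H m _)) ⟩
            V * (H * (m * ∑[ l ← allFin D ] massUpTo z (ρ l) o))
              ≤⟨ *-monoʳ-≤ V (proj₂ plan o) ⟩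
            V * (D * (H * K + 3 * (m * P))) ∎
            where ρ = proj₁ plan

    -- Opaque, since permutations have η and would be compared field by field.
    opaque
      cellOrder : (Fin L → ℕ) → Permutation′ n
      cellOrder ρ = Ranking.order (ρ ∘ obj)

      toℕ-cellOrder : ∀ ρ j → toℕ (cellOrder ρ ⟨$⟩ʳ j) ≡ Ranking.rank (ρ ∘ obj) (Ranking.key (ρ ∘ obj) j)
      toℕ-cellOrder ρ = Ranking.toℕ-position (ρ ∘ obj)

      -- Whatever precedes `j` lies in a cell of rank at most that of the cell of `j`, and
      -- `massUpTo` counts all such cells in full; hence the order among clients of equal rank is
      -- irrelevant.
      completion≤massUpTo : ∀ {R} (ρ : Fin L → Fin R) j → completion (cellOrder (toℕ ∘ ρ)) j ≤ massUpTo z ρ (obj j)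
      completion≤massUpTo ρ j = begin
        completion order j
          ≤⟨ ∑-mono (allFin n) (λ ℓ → *-monoˡ-≤ (p I ℓ) (ind-mono ((order ⟨$⟩ʳ ℓ) Fin.≤? (order ⟨$⟩ʳ j)) (g? ℓ) position≤⇒κ≤)) ⟩
        ∑[ ℓ ← allFin n ] (g ℓ * p I ℓ)
          ≡⟨ ∑-cong (allFin n) (λ ℓ → *-comm (g ℓ) (p I ℓ)) ⟩
        ∑[ ℓ ← allFin n ] (p I ℓ * g ℓ)
          ≡⟨ sym (∑-cells g) ⟩
        ∑[ o ← allFin L ] ∑[ ℓ ← allFin n ] (memb o ℓ * g ℓ)
          ≡⟨ ∑-cong (allFin L) (λ o → trans (∑-cong (allFin n) (λ ℓ → same o ℓ (obj ℓ Fin.≟ o))) (∑-*ˡ (allFin n) (ind (ρ o Fin.≤? ρ (obj j))) _)) ⟩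
        massUpTo z ρ (obj j) ∎
        where
        open ≤-Reasoning
        open Ranking (toℕ ∘ ρ ∘ obj)
        g? : ∀ ℓ → Dec (ρ (obj ℓ) Fin.≤ ρ (obj j))
        g? ℓ = ρ (obj ℓ) Fin.≤? ρ (obj j)
        g : Fin n → ℕ
        g ℓ = ind (g? ℓ)
        same : ∀ o ℓ (d : Dec (obj ℓ ≡ o)) → ind d * p I ℓ * g ℓ ≡ ind (ρ o Fin.≤? ρ (obj j)) * (ind d * p I ℓ)
        same o ℓ (yes refl) = *-comm (1 * p I ℓ) (g ℓ)
        same o ℓ (no _)     = sym (*-zeroʳ (ind (ρ o Fin.≤? ρ (obj j))))

    module Output (σ : Fin L → ℕ) (σ≡ : ∀ o → σ o ≡ size o) (D : ℕ) .{{_ : NonZero D}} (D≡ : D ≡ m ⊎ (D ≡ M × M₀ ≤ m)) where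

      open Table D L (suc H)

      D≡m⊎M : D ≡ m ⊎ D ≡ M
      D≡m⊎M = map₂ proj₁ D≡

      dayOrder : Fin D → Permutation′ n
      dayOrder i = cellOrder (toℕ ∘ best σ i)

      anyOrder : Permutation′ n
      anyOrder = cellOrder (λ _ → 0)

      -- One layout for both cases: if `D = m`, every planned order lasts one day and the final
      -- block lasts 0 days; if `D = M`, the final block takes up the days that do not fill a
      -- period.
      blocks : List (Block n)
      blocks = map (λ i → m / D , dayOrder i) (allFin D) ++ (m % D , anyOrder) ∷ []

      ∑-expand : ∀ bs (f : Permutation′ n → ℕ) → ∑ (expand bs) f ≡ ∑[ b ← bs ] (proj₁ b * f (proj₂ b))
      ∑-expand []             f = refl
      ∑-expand ((k , σ) ∷ bs) f = trans (∑-++ (replicate k σ) (expand bs) f) (cong₂ _+_ (∑-replicate k σ f) (∑-expand bs f))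

      ∑-map : ∀ {A B : Set} (h : A → B) xs (f : B → ℕ) → ∑ (map h xs) f ≡ ∑ xs (f ∘ h)
      ∑-map h []       f = refl
      ∑-map h (x ∷ xs) f = cong (f (h x) +_) (∑-map h xs f)

      ∑-blocks : ∀ (f : Permutation′ n → ℕ) → ∑ (expand blocks) f ≡ m / D * ∑[ i ← allFin D ] f (dayOrder i) + m % D * f anyOrder
      ∑-blocks f = trans (∑-expand blocks f) (trans (∑-++ (map (λ i → m / D , dayOrder i) (allFin D)) ((m % D , anyOrder) ∷ []) weigh)
        (cong₂ _+_ (trans (∑-map (λ i → m / D , dayOrder i) (allFin D) weigh) (∑-*ˡ (allFin D) (m / D) (f ∘ dayOrder))) (+-identityʳ _)))
        where
        weigh : Block n → ℕ
        weigh b = proj₁ b * f (proj₂ b)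

      length-expand : length (expand blocks) ≡ m
      length-expand = begin
        length (expand blocks)                      ≡⟨ trans (sym (*-identityʳ _)) (sym (∑-const (expand blocks) 1)) ⟩
        ∑[ _ ← expand blocks ] 1                    ≡⟨ ∑-blocks (λ _ → 1) ⟩
        m / D * ∑[ i ← allFin D ] 1 + m % D * 1     ≡⟨ cong₂ (λ x y → m / D * x + y) (trans (∑-const-Fin D 1) (*-identityʳ D)) (*-identityʳ _) ⟩
        m / D * D + m % D                           ≡⟨ trans (+-comm _ (m % D)) (sym (m≡m%n+[m/n]*n m D)) ⟩
        m                                           ∎
        where open ≡-Reasoning

      H*rest≤m : H * (m % D) ≤ m
      H*rest≤m = bound D D≡
        where
        bound : ∀ D .{{_ : NonZero D}} → D ≡ m ⊎ (D ≡ M × M₀ ≤ m) → H * (m % D) ≤ m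
        bound D (inj₁ refl)          = ≤-trans (≤-reflexive (trans (cong (H *_) (n%n≡0 m)) (*-zeroʳ H))) z≤n
        bound D (inj₂ (refl , M₀≤m)) = ≤-trans (*-monoʳ-≤ H (<⇒≤ (m%n<n m M))) M₀≤m

      -- The planned days contribute at most `K + 4 * m * P / H`, because `m / D * D ≤ m`. The
      -- leftover days number at most `m / H` and cost at most `P` each, the fifth error; finally
      -- `5 * (m * P) ≤ 10 * K`.
      output≤ : ∀ π j → H * ∑[ σ ← expand blocks ] completion σ j ≤ (H + 10) * objective I π
      output≤ π j = begin
        H * ∑[ σ ← expand blocks ] completion σ j
          ≡⟨ trans (cong (H *_) (∑-blocks (λ σ → completion σ j))) (distrib H (m / D) _ (m % D) _) ⟩
        m / D * (H * ∑[ i ← allFin D ] completion (dayOrder i) j) + H * (m % D) * completion anyOrder j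
          ≤⟨ +-mono-≤ main (*-mono-≤ H*rest≤m (completion≤P anyOrder j)) ⟩
        (H * K + 4 * (m * P)) + m * P
          ≡⟨ collect (H * K) (m * P) ⟩
        H * K + 5 * (m * P)
          ≤⟨ +-monoʳ-≤ (H * K) (*-monoʳ-≤ 5 (Bounds.mP≤2objective I π P>0)) ⟩
        H * K + 5 * (2 * K)
          ≡⟨ collect′ H K ⟩
        (H + 10) * K ∎
        where
        open ≤-Reasoning
        K = objective I π
        distrib : ∀ h q s r c → h * (q * s + r * c) ≡ q * (h * s) + h * r * c
        distrib = solve-∀
        collect : ∀ k q → k + 4 * q + q ≡ k + 5 * q
        collect = solve-∀
        collect′ : ∀ h k → h * k + 5 * (2 * k) ≡ (h + 10) * k
        collect′ = solve-∀
        main : m / D * (H * ∑[ i ← allFin D ] completion (dayOrder i) j) ≤ H * K + 4 * (m * P)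
        main = *-cancelˡ-≤ m (begin
          m * (m / D * (H * ∑[ i ← allFin D ] completion (dayOrder i) j))
            ≡⟨ comm m (m / D) H _ ⟩
          m / D * (H * (m * ∑[ i ← allFin D ] completion (dayOrder i) j))
            ≤⟨ *-monoʳ-≤ (m / D) (*-monoʳ-≤ H (*-monoʳ-≤ m (∑-mono (allFin D) λ i → completion≤massUpTo (best σ i) j))) ⟩
          m / D * (H * (m * ∑[ i ← allFin D ] massUpTo z (best σ i) (obj j)))
            ≤⟨ *-monoʳ-≤ (m / D) (best-plan σ≡ D≡m⊎M π (obj j)) ⟩
          m / D * (D * (H * K + 4 * (m * P)))
            ≡⟨ sym (*-assoc (m / D) D _) ⟩
          m / D * D * (H * K + 4 * (m * P))
            ≤⟨ *-monoˡ-≤ _ (m/n*n≤m m D) ⟩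
          m * (H * K + 4 * (m * P)) ∎)
          where
          comm : ∀ m q h s → m * (q * (h * s)) ≡ q * (h * (m * s))
          comm = solve-∀

      schedule : Σ[ π ∈ Schedule n m ] expand blocks ≡ tabulate π
      schedule = fromList (expand blocks) length-expand
        where
        fromList : ∀ {m} {A : Set} (xs : List A) → length xs ≡ m → Σ[ π ∈ (Fin m → A) ] xs ≡ tabulate π
        fromList xs refl = lookup xs , sym (tabulate-lookup xs)

      objective≤ : ∀ π → H * objective I (proj₁ schedule) ≤ (H + 10) * objective I π
      objective≤ π = *-max-≤ H (allFin n) _ λ j → ≤-trans (≤-reflexive (cong (H *_) (eq j))) (output≤ π j)
        where
        ρ = proj₁ schedule
        eq : ∀ j → clientCompletion I ρ j ≡ ∑[ σ ← expand blocks ] completion σ j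
        eq j = trans (Bounds.clientCompletion≡ I ρ j) (trans (sym (∑-map ρ (allFin m) (λ σ → completion σ j)))
          (cong (λ xs → ∑[ σ ← xs ] completion σ j) (trans (map-tabulate id ρ) (sym (proj₂ schedule)))))

  -- Total correctness with running times

  -- A total-correctness assertion for one start state. The time is only bounded by `b`, so that
  -- branches of different lengths can share a bound.
  Run : ℕ → Cmd → State → ℕ → (State → Set) → Set
  Run W c s b Q = ∃[ t ] ∃[ s′ ] W ⊢ c , s ⇓[ t ] s′ × t ≤ b × Q s′

  module _ {W : ℕ} where

    run-weaken : ∀ {c s b b′} {Q Q′ : State → Set} → b ≤ b′ → (∀ s → Q s → Q′ s) → Run W c s b Q → Run W c s b′ Q′
    run-weaken b≤b′ Q⊆Q′ (t , s′ , d , t≤b , q) = t , s′ , d , ≤-trans t≤b b≤b′ , Q⊆Q′ s′ q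

    run-skip : ∀ {s} {Q : State → Set} → Q s → Run W skip s 1 Q
    run-skip q = 1 , _ , ⇓skip , ≤-refl , q

    run-set : ∀ {s x e} {Q : State → Set} → Fits W s e → Q ⟨ regs s [ x ↦ eval s e ] , mem s ⟩ → Run W (set x e) s (1 + cost e) Q
    run-set fits q = _ , _ , ⇓set fits , ≤-refl , q

    run-store : ∀ {s a e} {Q : State → Set} → Fits W s a → Fits W s e →
                Q ⟨ regs s , mem s [ eval s a ↦ eval s e ] ⟩ → Run W (store a e) s (1 + cost a + cost e) Q
    run-store fa fe q = _ , _ , ⇓store fa fe , ≤-refl , q

    run-seq : ∀ {c₁ c₂ s b₁ b₂} {Q R : State → Set} → Run W c₁ s b₁ Q → (∀ s → Q s → Run W c₂ s b₂ R) → Run W (c₁ ⨾ c₂) s (b₁ + b₂) R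
    run-seq (t₁ , s₁ , d₁ , t₁≤ , q) k with k s₁ q
    ... | t₂ , s₂ , d₂ , t₂≤ , r = t₁ + t₂ , s₂ , ⇓seq d₁ d₂ , +-mono-≤ t₁≤ t₂≤ , r

    run-ifnz : ∀ {s e c₁ c₂ b} {Q : State → Set} → Fits W s e → (eval s e ≢ 0 → Run W c₁ s b Q) → (eval s e ≡ 0 → Run W c₂ s b Q) →
               Run W (ifnz e c₁ c₂) s (1 + cost e + b) Q
    run-ifnz {s} {e} fits k₁ k₂ with eval s e ≟ 0
    ... | yes eq with k₂ eq
    ...   | t , s′ , d , t≤ , q = _ , s′ , ⇓else fits eq d , +-monoʳ-≤ (1 + cost e) t≤ , q
    run-ifnz {s} {e} fits k₁ k₂ | no neq with k₁ neq
    ...   | t , s′ , d , t≤ , q = _ , s′ , ⇓then fits neq d , +-monoʳ-≤ (1 + cost e) t≤ , q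

    run-loop : ∀ {s e c b₁ b₂} {Q R : State → Set} → Fits W s e → eval s e ≢ 0 → Run W c s b₁ Q →
               (∀ s → Q s → Run W (while e c) s b₂ R) → Run W (while e c) s (1 + cost e + b₁ + b₂) R
    run-loop {e = e} fits neq (t₁ , s₁ , d₁ , t₁≤ , q) k with k s₁ q
    ... | t₂ , s₂ , d₂ , t₂≤ , r = _ , s₂ , ⇓loop fits neq d₁ d₂ , +-mono-≤ (+-monoʳ-≤ (1 + cost e) t₁≤) t₂≤ , r

    run-exit : ∀ {s e c} {Q : State → Set} → Fits W s e → eval s e ≡ 0 → Q s → Run W (while e c) s (1 + cost e) Q
    run-exit fits eq q = _ , _ , ⇓exit fits eq , ≤-refl , q

    fits⇒eval≤ : ∀ s e → Fits W s e → eval s e ≤ W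
    fits⇒eval≤ s (lit k)    f = f
    fits⇒eval≤ s (reg x)    f = f
    fits⇒eval≤ s (load e)   f = proj₂ f
    fits⇒eval≤ s (op _ a b) f = proj₂ (proj₂ f)

    fits-sub : ∀ s a b → Fits W s a → Fits W s b → Fits W s (op sub a b)
    fits-sub s a b fa fb = fa , fb , ≤-trans (m∸n≤m (eval s a) (eval s b)) (fits⇒eval≤ s a fa)

    fits-div : ∀ s a b → Fits W s a → Fits W s b → Fits W s (op div a b)
    fits-div s a b fa fb = fa , fb , ≤-trans (div≤ (eval s a) (eval s b)) (fits⇒eval≤ s a fa)
      where
      div≤ : ∀ a b → ⟦ div ⟧ a b ≤ a
      div≤ a zero    = z≤n
      div≤ a (suc b) = m/n≤m a (suc b)

  ⟦div⟧ : ∀ a b .{{_ : NonZero b}} → ⟦ div ⟧ a b ≡ a / b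
  ⟦div⟧ a (suc b) = refl

  -- Subtraction is truncated, so one of the summands is positive unless e evaluates to k.
  diff : Expr → ℕ → Expr
  diff e k = op add (op sub e (lit k)) (op sub (lit k) e)

  diff≡0 : ∀ {s e k} → eval s e ≡ k → eval s (diff e k) ≡ 0
  diff≡0 {k = k} eq rewrite eq | n∸n≡0 k = refl

  diff≡0⇒ : ∀ s e k → eval s (diff e k) ≡ 0 → eval s e ≡ k
  diff≡0⇒ s e k eq = ≤-antisym (m∸n≡0⇒m≤n (m+n≡0⇒m≡0 _ eq)) (m∸n≡0⇒m≤n (m+n≡0⇒n≡0 (eval s e ∸ k) eq))

  fits-diff : ∀ {W} s e k → Fits W s e → k ≤ W → Fits W s (diff e k)
  fits-diff {W} s e k fe k≤W = fits-sub s e (lit k) fe k≤W , fits-sub s (lit k) e k≤W fe , dist (≤-total (eval s e) k)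
    where
    dist : eval s e ≤ k ⊎ k ≤ eval s e → (eval s e ∸ k) + (k ∸ eval s e) ≤ W
    dist (inj₁ le) rewrite m≤n⇒m∸n≡0 le = ≤-trans (m∸n≤m k (eval s e)) k≤W
    dist (inj₂ ge) rewrite m≤n⇒m∸n≡0 ge | +-identityʳ (eval s e ∸ k) = ≤-trans (m∸n≤m (eval s e) k) (fits⇒eval≤ s e fe)

  lookup-here : ∀ (f : ℕ → ℕ) x v → (f [ x ↦ v ]) x ≡ v
  lookup-here f x v with x ≡ᵇ x | ≡⇒≡ᵇ x x refl
  ... | true | _ = refl

  lookup-there : ∀ (f : ℕ → ℕ) {x y} v → x ≢ y → (f [ x ↦ v ]) y ≡ f y
  lookup-there f {x} {y} v x≢y with x ≡ᵇ y in eq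
  ... | true  = contradiction (≡ᵇ⇒≡ x y (subst Bool.T (sym eq) _)) x≢y
  ... | false = refl

  -- Turns a machine value into a number known when the program is built: a chain of comparisons
  -- with `v`, `v + 1`, ... at whose ends the command for that number is placed. The last candidate
  -- needs no test.
  select : ℕ → ℕ → (ℕ → Cmd) → Cmd
  select v zero    f = f v
  select v (suc k) f = ifnz (diff (reg 5) v) (select (suc v) k f) (f v)

  run-select : ∀ {W b s} {Q : State → Set} k v f → v ≤ regs s 5 → regs s 5 ≤ v + k → v + k ≤ W →
               Run W (f (regs s 5)) s b Q → Run W (select v k f) s (k * 8 + b) Q
  run-select {W} {s = s} {Q} zero v f v≤ ≤v _ r =
    subst (λ x → Run W (f x) s _ Q) (≤-antisym (≤-trans ≤v (≤-reflexive (+-identityʳ v))) v≤) r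
  run-select {W} {b} {s} {Q} (suc k) v f v≤ ≤v v≤W r = run-weaken (≤-reflexive (sym (+-assoc 8 (k * 8) b))) (λ _ → id)
    (run-ifnz (fits-diff s (reg 5) v (≤-trans ≤v v≤W) (≤-trans (m≤m+n v (suc k)) v≤W))
      (λ neq → run-select k (suc v) f (≤∧≢⇒< v≤ (λ eq → neq (diff≡0 {s} {reg 5} (sym eq)))) (≤-trans ≤v (≤-reflexive (+-suc v k)))
                 (≤-trans (≤-reflexive (sym (+-suc v k))) v≤W) r)
      (λ eq → run-weaken (m≤n+m b (k * 8)) (λ _ → id) (subst (λ x → Run W (f x) s b Q) (diff≡0⇒ s (reg 5) v eq) r)))

  -- The local function of `input` that stores the processing times ignores the
  -- instance, so its copies for I and for rest I are convertible.
  input-mem : ∀ {n m} (I : Instance n m) j → mem (input I) (toℕ j) ≡ p I j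
  input-mem I Fin.zero    = refl
  input-mem I (Fin.suc j) = input-mem (rest I) j
    where
    rest : ∀ {n m} → Instance (suc n) m → Instance n m
    rest I = record { p = p I ∘ Fin.suc ; p>0 = λ j → p>0 I (Fin.suc j) }

  -- The program

  data Count : Set where
    quotient remainder : Count

  countReg : Count → ℕ
  countReg quotient  = 7
  countReg remainder = 8

  -- Registers: 0 holds n and the address of the output, 1 holds m and finally
  -- the number of blocks, 2 the total processing time P, 3 the client in a
  -- loop over all clients, 4 the total processing time of the earlier clients,
  -- 5 an accumulator, 6 the address of the next block, 7 and 8 the lengths of
  -- the blocks.
  module Program (H : ℕ) where

    open Params H

    forLoop : Cmd → Cmd
    forLoop body = set 3 (lit 0) ⨾ set 4 (lit 0) ⨾
      while (op sub (reg 0) (reg 3))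
        (body ⨾ set 4 (op add (reg 4) (load (reg 3))) ⨾ set 3 (op add (reg 3) (lit 1)))

    cell : Expr
    cell = op div (op mul (reg 4) (lit L)) (reg 2)

    -- Truncated subtraction from 1 makes this the indicator that the client in register 3 lies in
    -- the cell `o`.
    isCell : Fin L → Expr
    isCell o = op sub (lit 1) (diff cell (toℕ o))

    -- Table lookup as one expression: a sum over the cells in which a single indicator is 1.
    -- Neither the table nor the cells of the clients occupy memory.
    tabulated : (Fin L → ℕ) → List (Fin L) → Expr
    tabulated ρ []       = lit 0
    tabulated ρ (o ∷ os) = op add (op mul (lit (ρ o)) (isCell o)) (tabulated ρ os)

    measure : Fin L → Cmd
    measure o = set 5 (lit 0) ⨾
      forLoop (ifnz (diff cell (toℕ o)) skip (set 5 (op add (reg 5) (load (reg 3))))) ⨾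
      set 5 (op div (op mul (reg 5) (lit V)) (reg 2))

    -- The decision tree. `ι` lists the cells still to be measured; the continuation receives the
    -- sizes found on the path as numbers, and can therefore compute a best plan from them.
    branch : ∀ k → (Fin k → Fin L) → ((Fin k → ℕ) → Cmd) → Cmd
    branch zero    ι f = f λ ()
    branch (suc k) ι f = measure (ι Fin.zero) ⨾ select 0 V λ v → branch k (ι ∘ Fin.suc) λ σ →
      f (v Vector.∷ σ)

    -- One pass of a counting sort without auxiliary array: register 5 is the next free position,
    -- and only clients of class `h` are placed.
    emitLevel : (Fin L → ℕ) → ℕ → Cmd
    emitLevel ρ h = forLoop (ifnz (diff (tabulated ρ (allFin L)) h) skip
      (store (op add (op add (reg 6) (lit 1)) (reg 3)) (reg 5) ⨾ set 5 (op add (reg 5) (lit 1))))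

    emitLevels : (Fin L → ℕ) → ℕ → ℕ → Cmd
    emitLevels ρ h zero    = skip
    emitLevels ρ h (suc r) = emitLevel ρ h ⨾ emitLevels ρ (suc h) r

    emitBlock : Count → (Fin L → ℕ) → Cmd
    emitBlock k ρ = store (reg 6) (reg (countReg k)) ⨾ set 5 (lit 0) ⨾ emitLevels ρ 0 (suc H) ⨾
      set 6 (op add (op add (reg 6) (reg 0)) (lit 1))

    emitBlocks : List (Count × (Fin L → ℕ)) → Cmd
    emitBlocks []             = skip
    emitBlocks ((k , ρ) ∷ bs) = emitBlock k ρ ⨾ emitBlocks bs

    plan : ∀ D → (Fin L → ℕ) → List (Count × (Fin L → ℕ))
    plan D σ = map (λ i → quotient , toℕ ∘ Table.best D L (suc H) σ i) (allFin D) ++ (remainder , λ _ → 0) ∷ []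

    -- Applied to the minimum of `m` and `M₀`. A value below `M₀` is `m` itself, and then every day
    -- is planned individually; otherwise `m` is only known to be large, and a periodic schedule is
    -- used.
    period : ℕ → ℕ
    period x with x <? M₀
    ... | yes _ = x
    ... | no  _ = M

    solve : ℕ → Cmd
    solve D = set 7 (op div (reg 1) (lit D)) ⨾ set 8 (op sub (reg 1) (op mul (reg 7) (lit D))) ⨾ set 6 (reg 0) ⨾
      branch L id λ σ → emitBlocks (plan D σ) ⨾ set 1 (lit (suc D))

    main : Cmd
    -- `forLoop skip` leaves the total processing time in register 4, and `m ∸ (m ∸ M₀)` is the
    -- minimum of `m` and `M₀`.
    main = forLoop skip ⨾ set 2 (reg 4) ⨾ set 5 (op sub (reg 1) (op sub (reg 1) (lit M₀))) ⨾
      select 0 M₀ (solve ∘ period)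

  -- Correctness and running time of the program

  record Env : Set where
    constructor env
    field
      total next quot rest : ℕ

  open Env

  count : ℕ → ℕ → Count → ℕ
  count q r quotient  = q
  count q r remainder = r

  -- The word size enters through three bounds only: on the end of the output, which consists of at
  -- most `suc M₀` blocks written after the `n` input cells, on the number of days, and on the
  -- product `P * V`, which dominates the products formed in measuring sizes and locating cells.
  module Machine {n m : ℕ} (I : Instance n m) .{{_ : NonZero n}} .{{_ : NonZero m}} (H : ℕ) .{{_ : NonZero H}} (W : ℕ)
                 (addr≤W : n + suc (Params.M₀ H) * suc n ≤ W) (m≤W : m ≤ W)
                 (PV≤W : ∑ (allFin n) (p I) * Params.V H ≤ W) where

    open Rounding I H
    open Program H

    P≤W : P ≤ W
    P≤W = ≤-trans (m≤m*n P V) PV≤W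

    V≤W : V ≤ W
    V≤W = ≤-trans (m≤n*m V P) PV≤W

    L≤W : L ≤ W
    L≤W = ≤-trans (m≤m*n L H) V≤W

    n≤W : n ≤ W
    n≤W = ≤-trans (m≤m+n n _) addr≤W

    1≤W : 1 ≤ W
    1≤W = ≤-trans (>-nonZero⁻¹ n) n≤W

    -- What the loops leave alone: all registers in use except 3, 4 and 5, and the input cells,
    -- which must survive because every pass rereads them.
    record Base (E : Env) (s : State) : Set where
      field
        r0 : regs s 0 ≡ n
        r1 : regs s 1 ≡ m
        r2 : regs s 2 ≡ total E
        r6 : regs s 6 ≡ next E
        r7 : regs s 7 ≡ quot E
        r8 : regs s 8 ≡ rest E
        cl : ∀ j → mem s (toℕ j) ≡ p I j

    open Base

    base-3 : ∀ {E s} v → Base E s → Base E ⟨ regs s [ 3 ↦ v ] , mem s ⟩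
    base-3 v b = record { r0 = r0 b ; r1 = r1 b ; r2 = r2 b ; r6 = r6 b ; r7 = r7 b ; r8 = r8 b ; cl = cl b }

    base-4 : ∀ {E s} v → Base E s → Base E ⟨ regs s [ 4 ↦ v ] , mem s ⟩
    base-4 v b = record { r0 = r0 b ; r1 = r1 b ; r2 = r2 b ; r6 = r6 b ; r7 = r7 b ; r8 = r8 b ; cl = cl b }

    base-5 : ∀ {E s} v → Base E s → Base E ⟨ regs s [ 5 ↦ v ] , mem s ⟩
    base-5 v b = record { r0 = r0 b ; r1 = r1 b ; r2 = r2 b ; r6 = r6 b ; r7 = r7 b ; r8 = r8 b ; cl = cl b }

    base-store : ∀ {E s} a v → n ≤ a → Base E s → Base E ⟨ regs s , mem s [ a ↦ v ] ⟩
    base-store {E} {s} a v n≤a b = record { r0 = r0 b ; r1 = r1 b ; r2 = r2 b ; r6 = r6 b ; r7 = r7 b ; r8 = r8 b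
      ; cl = λ j → trans (lookup-there (mem s) v (λ eq → <⇒≢ (<-≤-trans (Fin.toℕ<n j) n≤a) (sym eq))) (cl b j) }

    record At (E : Env) (k : ℕ) (s : State) : Set where
      constructor at
      field
        base : Base E s
        r3   : regs s 3 ≡ k
        r4   : regs s 4 ≡ pre k (p I)

    open At

    -- The invariant speaks of the accumulator and the memory only, since a body must preserve
    -- registers 3 and 4, as `At` demands. An iteration costs 13 steps beyond its body: 4 for the
    -- test, 5 for the prefix sum, 4 for the counter.
    run-forLoop : ∀ {E body b} (Inv : ℕ → ℕ → (ℕ → ℕ) → Set) →
      (∀ i s → At E (toℕ i) s → Inv (toℕ i) (regs s 5) (mem s) →
        Run W body s b (λ s′ → At E (toℕ i) s′ × Inv (suc (toℕ i)) (regs s′ 5) (mem s′))) →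
      ∀ s → Base E s → Inv 0 (regs s 5) (mem s) →
      Run W (forLoop body) s (8 + n * (b + 13)) (λ s′ → At E n s′ × Inv n (regs s′ 5) (mem s′))
    run-forLoop {E} {body} {b} Inv ok s bs inv = run-weaken (≤-reflexive (total≡ n b)) (λ _ → id)
      (run-seq {Q = λ s′ → Base E s′ × regs s′ 3 ≡ 0 × Inv 0 (regs s′ 5) (mem s′)} (run-set z≤n (base-3 0 bs , refl , inv)) λ s₁ (bs₁ , eq₁ , inv₁) →
       run-seq {Q = λ s′ → At E 0 s′ × Inv 0 (regs s′ 5) (mem s′)} (run-set z≤n (at (base-4 0 bs₁) eq₁ (sym (pre-zero (p I))) , inv₁)) λ s₂ (at₂ , inv₂) →
       iterate n 0 refl s₂ at₂ inv₂)
      where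
      total≡ : ∀ n b → 2 + (2 + (n * (b + 13) + 4)) ≡ 8 + n * (b + 13)
      total≡ = solve-∀
      iterate : ∀ r k → k + r ≡ n → ∀ s → At E k s → Inv k (regs s 5) (mem s) →
        Run W (while (op sub (reg 0) (reg 3)) (body ⨾ set 4 (op add (reg 4) (load (reg 3))) ⨾ set 3 (op add (reg 3) (lit 1)))) s
          (r * (b + 13) + 4) (λ s′ → At E n s′ × Inv n (regs s′ 5) (mem s′))
      iterate r k k+r≡n s a inv with r
      ... | zero = run-exit {e = op sub (reg 0) (reg 3)} (fits-sub s (reg 0) (reg 3) r0≤ r3≤)
                     (trans (cong₂ _∸_ (r0 (base a)) (trans (r3 a) k≡n)) (n∸n≡0 n))
                     (subst (λ k → At E k s × Inv k (regs s 5) (mem s)) k≡n (a , inv))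
        where
        k≡n = trans (sym (+-identityʳ k)) k+r≡n
        r0≤ : regs s 0 ≤ W
        r0≤ = ≤-trans (≤-reflexive (r0 (base a))) n≤W
        r3≤ : regs s 3 ≤ W
        r3≤ = ≤-trans (≤-reflexive (trans (r3 a) k≡n)) n≤W
      ... | suc r = run-weaken (≤-reflexive (cost≡ r b)) (λ _ → id)
          (run-loop {e = op sub (reg 0) (reg 3)} (fits-sub s (reg 0) (reg 3) (≤-trans (≤-reflexive (r0 (base a))) n≤W) (≤-trans (≤-reflexive (r3 a)) (<⇒≤ (<-≤-trans k<n n≤W))))
            (λ eq → <⇒≱ k<n (m∸n≡0⇒m≤n (trans (sym (cong₂ _∸_ (r0 (base a)) (r3 a))) eq)))
            one (λ s′ (a′ , inv′) → iterate r (suc k) (trans (sym (+-suc k r)) k+r≡n) s′ a′ inv′))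
        where
        k<n : k < n
        k<n = ≤-trans (m≤m+n (suc k) r) (≤-reflexive (trans (sym (+-suc k r)) k+r≡n))
        i : Fin n
        i = Fin.fromℕ< k<n
        i≡k : toℕ i ≡ k
        i≡k = Fin.toℕ-fromℕ< k<n
        cost≡ : ∀ r b → 1 + 3 + (b + (5 + 4)) + (r * (b + 13) + 4) ≡ b + 13 + r * (b + 13) + 4
        cost≡ = solve-∀
        one : Run W (body ⨾ set 4 (op add (reg 4) (load (reg 3))) ⨾ set 3 (op add (reg 3) (lit 1))) s (b + (5 + 4))
                (λ s′ → At E (suc k) s′ × Inv (suc k) (regs s′ 5) (mem s′))
        one = subst (λ k → Run W (body ⨾ set 4 (op add (reg 4) (load (reg 3))) ⨾ set 3 (op add (reg 3) (lit 1))) s (b + (5 + 4))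
                             (λ s′ → At E (suc k) s′ × Inv (suc k) (regs s′ 5) (mem s′))) i≡k
          (run-seq (ok i s (subst (λ k → At E k s) (sym i≡k) a) (subst (λ k → Inv k (regs s 5) (mem s)) (sym i≡k) inv)) λ s₁ (a₁ , inv₁) →
           let cell≡ : mem s₁ (regs s₁ 3) ≡ p I i
               cell≡ = trans (cong (mem s₁) (r3 a₁)) (cl (base a₁) i)
               sum≡ : regs s₁ 4 + mem s₁ (regs s₁ 3) ≡ pre (suc (toℕ i)) (p I)
               sum≡ = trans (cong₂ _+_ (r4 a₁) cell≡) (sym (pre-suc i (p I)))
               sum≤ : regs s₁ 4 + mem s₁ (regs s₁ 3) ≤ W
               sum≤ = ≤-trans (≤-reflexive sum≡) (≤-trans (pre≤ (suc (toℕ i)) (p I)) P≤W)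
               r3≤ : regs s₁ 3 ≤ W
               r3≤ = ≤-trans (≤-reflexive (r3 a₁)) (≤-trans (<⇒≤ (Fin.toℕ<n i)) n≤W)
           in run-seq {Q = λ s′ → Base E s′ × regs s′ 3 ≡ toℕ i × regs s′ 4 ≡ pre (suc (toℕ i)) (p I) × Inv (suc (toℕ i)) (regs s′ 5) (mem s′)}
                (run-set (m+n≤o⇒m≤o (regs s₁ 4) sum≤ , (r3≤ , m+n≤o⇒n≤o (regs s₁ 4) sum≤) , sum≤) (base-4 _ (base a₁) , r3 a₁ , sum≡ , inv₁)) λ s₂ (b₂ , r3₂ , r4₂ , inv₂) →
           let next≡ : regs s₂ 3 + 1 ≡ suc (toℕ i)
               next≡ = trans (cong (_+ 1) r3₂) (+-comm (toℕ i) 1)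
               next≤ : regs s₂ 3 + 1 ≤ W
               next≤ = ≤-trans (≤-reflexive next≡) (≤-trans (Fin.toℕ<n i) n≤W)
           in run-set (m+n≤o⇒m≤o (regs s₂ 3) next≤ , 1≤W , next≤) (at (base-3 _ b₂) next≡ r4₂ , inv₂))

    cell-ok : ∀ {E} → total E ≡ P → ∀ i s → At E (toℕ i) s → Fits W s cell × eval s cell ≡ toℕ (obj i)
    cell-ok {E} E≡ i s a =
      fits-div s (op mul (reg 4) (lit L)) (reg 2) (m*n≤o⇒ , L≤W , prod≤) (≤-trans (≤-reflexive r2≡) P≤W) ,
      trans (cong₂ ⟦ div ⟧ (cong (_* L) (r4 a)) r2≡) (trans (⟦div⟧ _ P) (sym (toℕ-obj i)))
      where
      r2≡ : regs s 2 ≡ P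
      r2≡ = trans (r2 (base a)) E≡
      pre≤P : regs s 4 ≤ P
      pre≤P = ≤-trans (≤-reflexive (r4 a)) (pre≤ (toℕ i) (p I))
      m*n≤o⇒ : regs s 4 ≤ W
      m*n≤o⇒ = ≤-trans pre≤P P≤W
      prod≤ : regs s 4 * L ≤ W
      prod≤ = ≤-trans (*-mono-≤ pre≤P (m≤m*n L H)) PV≤W

    cell-index≤W : ∀ (o : Fin L) → toℕ o ≤ W
    cell-index≤W o = ≤-trans (<⇒≤ (Fin.toℕ<n o)) L≤W

    isCell-ok : ∀ {E} → total E ≡ P → ∀ i o s → At E (toℕ i) s → Fits W s (isCell o) × eval s (isCell o) ≡ ind (obj i Fin.≟ o)
    isCell-ok E≡ i o s a = fits-sub s (lit 1) (diff cell (toℕ o)) 1≤W (fits-diff s cell (toℕ o) (proj₁ ok) (cell-index≤W o)) , value (obj i Fin.≟ o)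
      where
      ok = cell-ok E≡ i s a
      value : (d : Dec (obj i ≡ o)) → 1 ∸ eval s (diff cell (toℕ o)) ≡ ind d
      value (yes obj≡o) = cong (1 ∸_) (diff≡0 {s} {cell} {toℕ o} (trans (proj₂ ok) (cong toℕ obj≡o)))
      value (no obj≢o)  = m≤n⇒m∸n≡0 (n≢0⇒n>0 λ eq → obj≢o (Fin.toℕ-injective (trans (sym (proj₂ ok)) (diff≡0⇒ s cell (toℕ o) eq))))

    tabulated-ok : ∀ {E} → total E ≡ P → ∀ i ρ os s → At E (toℕ i) s → ∑ os ρ ≤ W →
                   Fits W s (tabulated ρ os) × eval s (tabulated ρ os) ≡ ∑[ o ← os ] (ρ o * ind (obj i Fin.≟ o))
    tabulated-ok E≡ i ρ []       s a le = z≤n , refl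
    tabulated-ok E≡ i ρ (o ∷ os) s a le =
      ((m+n≤o⇒m≤o (ρ o) le , proj₁ ok₁ , ≤-trans term≤ (m+n≤o⇒m≤o (ρ o) le)) , proj₁ ok₂ , ≤-trans sum≤ le) ,
      cong₂ _+_ (cong (ρ o *_) (proj₂ ok₁)) (proj₂ ok₂)
      where
      ok₁ = isCell-ok E≡ i o s a
      ok₂ = tabulated-ok E≡ i ρ os s a (m+n≤o⇒n≤o (ρ o) le)
      term≤ : ρ o * eval s (isCell o) ≤ ρ o
      term≤ = ≤-trans (≤-reflexive (cong (ρ o *_) (proj₂ ok₁))) (≤-trans (≤-reflexive (*-comm (ρ o) _)) (ind*≤ (obj i Fin.≟ o) (ρ o)))
      sum≤ : ρ o * eval s (isCell o) + eval s (tabulated ρ os) ≤ ρ o + ∑ os ρ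
      sum≤ = +-mono-≤ term≤ (≤-trans (≤-reflexive (proj₂ ok₂)) (∑-mono os λ o → ≤-trans (≤-reflexive (*-comm (ρ o) _)) (ind*≤ (obj i Fin.≟ o) (ρ o))))

    cost-tabulated : ∀ ρ os → cost (tabulated ρ os) ≡ length os * 20 + 1
    cost-tabulated ρ []       = refl
    cost-tabulated ρ (o ∷ os) = cong (20 +_) (cost-tabulated ρ os)

    run-measure : ∀ {E} → total E ≡ P → ∀ o s → Base E s → Run W (measure o) s (16 + n * 34) (λ s′ → Base E s′ × regs s′ 5 ≡ size o)
    run-measure {E} E≡ o s b = run-weaken (≤-reflexive (total≡ n)) (λ _ → id)
      (run-seq {Q = λ s′ → Base E s′ × regs s′ 5 ≡ 0} (run-set z≤n (base-5 0 b , refl)) λ s₁ (b₁ , acc₁) →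
       run-seq (run-forLoop (λ k acc _ → acc ≡ pre k (memb o)) body s₁ b₁ (trans acc₁ (sym (pre-zero (memb o))))) λ s₂ (a₂ , acc₂) →
       let acc≡ : regs s₂ 5 ≡ z o
           acc≡ = trans acc₂ (pre-all (memb o))
           acc≤ : regs s₂ 5 ≤ P
           acc≤ = ≤-trans (≤-reflexive acc≡) z≤P
           r2≡ : regs s₂ 2 ≡ P
           r2≡ = trans (r2 (base a₂)) E≡
       in run-set (fits-div s₂ (op mul (reg 5) (lit V)) (reg 2) (≤-trans acc≤ P≤W , V≤W , ≤-trans (*-monoˡ-≤ V acc≤) PV≤W) (≤-trans (≤-reflexive r2≡) P≤W))
            (base-5 _ (base a₂) , trans (cong₂ ⟦ div ⟧ (cong (_* V) acc≡) r2≡) (⟦div⟧ _ P)))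
      where
      total≡ : ∀ n → 2 + ((8 + n * (21 + 13)) + 6) ≡ 16 + n * 34
      total≡ = solve-∀
      z≤P : z o ≤ P
      z≤P = ∑-mono (allFin n) λ j → ind*≤ (obj j Fin.≟ o) (p I j)
      body : ∀ i s → At E (toℕ i) s → regs s 5 ≡ pre (toℕ i) (memb o) →
             Run W (ifnz (diff cell (toℕ o)) skip (set 5 (op add (reg 5) (load (reg 3))))) s 21
               (λ s′ → At E (toℕ i) s′ × regs s′ 5 ≡ pre (suc (toℕ i)) (memb o))
      body i s a acc = run-ifnz (fits-diff s cell (toℕ o) fits (cell-index≤W o))
        (λ neq → run-weaken {b = 1} (s≤s z≤n) (λ _ → id) (run-skip (a , trans acc (sym (trans (pre-suc i (memb o))
          (trans (cong (λ y → pre (toℕ i) (memb o) + y * p I i) (ind-no (obj i Fin.≟ o) (λ obj≡o → neq (diff≡0 {s} {cell} (trans eq (cong toℕ obj≡o)))))) (+-identityʳ _)))))))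
        (λ isz → let sum≡ : regs s 5 + mem s (regs s 3) ≡ pre (suc (toℕ i)) (memb o)
                     sum≡ = trans (cong₂ _+_ acc (trans (cong (mem s) (r3 a)) (cl (base a) i))) (sym (trans (pre-suc i (memb o))
                              (cong (pre (toℕ i) (memb o) +_) (trans (cong (_* p I i) (ind-yes (obj i Fin.≟ o) (Fin.toℕ-injective (trans (sym eq) (diff≡0⇒ s cell (toℕ o) isz))))) (+-identityʳ _)))))
                     sum≤ : regs s 5 + mem s (regs s 3) ≤ W
                     sum≤ = ≤-trans (≤-reflexive sum≡) (≤-trans (pre≤ (suc (toℕ i)) (memb o)) (≤-trans z≤P P≤W))
                 in run-set (m+n≤o⇒m≤o (regs s 5) sum≤ , (≤-trans (≤-reflexive (r3 a)) (≤-trans (<⇒≤ (Fin.toℕ<n i)) n≤W) , m+n≤o⇒n≤o (regs s 5) sum≤) , sum≤)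
                      (at (base-5 _ (base a)) (r3 a) (r4 a) , sum≡))
        where
        fits = proj₁ (cell-ok E≡ i s a)
        eq   = proj₂ (cell-ok E≡ i s a)

    size≤V : ∀ o → size o ≤ V
    size≤V o = begin
      z o * V / P  ≤⟨ /-monoˡ-≤ P (*-monoˡ-≤ V (∑-mono (allFin n) λ j → ind*≤ (obj j Fin.≟ o) (p I j))) ⟩
      P * V / P    ≡⟨ trans (cong (_/ P) (*-comm P V)) (m*n/n≡m V P) ⟩
      V            ∎
      where open ≤-Reasoning

    -- Although the tree has `suc V ^ L` leaves, a run follows a single path, so the cost is linear
    -- in its depth.
    run-branch : ∀ {E} → total E ≡ P → ∀ {b} {Q : State → Set} k (ι : Fin k → Fin L) f →
                 (∀ σ → (∀ i → σ i ≡ size (ι i)) → ∀ s → Base E s → Run W (f σ) s b Q) →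
                 ∀ s → Base E s → Run W (branch k ι f) s (k * (16 + n * 34 + V * 8) + b) Q
    run-branch E≡ zero    ι f leaf s bs = leaf _ (λ ()) s bs
    run-branch {E} E≡ {b} {Q} (suc k) ι f leaf s bs = run-weaken (≤-reflexive (assoc (16 + n * 34) (V * 8) (k * (16 + n * 34 + V * 8)) b)) (λ _ → id)
      (run-seq (run-measure E≡ (ι Fin.zero) s bs) λ s₁ (b₁ , acc₁) →
       run-select V 0 (λ v → branch k (ι ∘ Fin.suc) λ σ → f (v Vector.∷ σ)) z≤n
         (≤-trans (≤-reflexive acc₁) (size≤V (ι Fin.zero))) V≤W
         (run-branch E≡ k (ι ∘ Fin.suc) _ (λ σ σ≡ → leaf _ (λ { Fin.zero → acc₁ ; (Fin.suc i) → σ≡ i })) s₁ b₁))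
      where
      assoc : ∀ x y z b → x + (y + (z + b)) ≡ x + y + z + b
      assoc = solve-∀

    levelCost blockCost : ℕ
    -- The table expression costs 20 steps per cell and occurs twice in `diff`.
    levelCost = 8 + n * (40 * L + 32)
    blockCost = suc H * levelCost + 12

    H≤W : H ≤ W
    H≤W = ≤-trans (m≤n*m H L) V≤W

    module Emission (ρ : Fin L → ℕ) (ρ≤H : ∀ o → ρ o ≤ H) {E : Env} (E≡ : total E ≡ P)
                    (n≤next : n ≤ next E) (next≤W : next E + suc n ≤ W) (μ₀ : ℕ → ℕ) where

      κ : Fin n → ℕ
      κ j = ρ (obj j)

      open Ranking κ

      private
        a₀ = next E

      -- The state of the block at time `t` of the clock described by `key`: the clients with
      -- smaller keys have been placed. The frame includes the address `a₀` itself, which already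
      -- holds the length of the block.
      Written : ℕ → ℕ → (ℕ → ℕ) → Set
      Written t acc μ = acc ≡ rank t × (∀ j → key j < t → μ (a₀ + suc (toℕ j)) ≡ rank (key j)) × (∀ x → x ≤ a₀ → μ x ≡ μ₀ x)

      class : Expr
      class = tabulated ρ (allFin L)

      ∑ρ≤W : ∑ (allFin L) ρ ≤ W
      ∑ρ≤W = ≤-trans (∑-≤-const L ρ H ρ≤H) V≤W

      class-ok : ∀ i s → At E (toℕ i) s → Fits W s class × eval s class ≡ κ i
      class-ok i s a = proj₁ ok , trans (proj₂ ok) (trans (∑-cong (allFin L) λ o → *-comm (ρ o) _)
                                              (∑-single (obj i Fin.≟_) ρ refl (λ _ → sym)))
        where ok = tabulated-ok E≡ i ρ (allFin L) s a ∑ρ≤W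

      run-emitLevel : ∀ h → h ≤ H → ∀ s → Base E s → Written (h * n) (regs s 5) (mem s) →
                      Run W (emitLevel ρ h) s levelCost (λ s′ → Base E s′ × Written (suc h * n) (regs s′ 5) (mem s′))
      run-emitLevel h h≤H s b written = run-weaken (≤-reflexive cost≡)
        (λ { s (a , w) → base a , subst (λ t → Written t (regs s 5) (mem s)) (+-comm (h * n) n) w })
        (run-forLoop (λ k → Written (h * n + k)) body s b (subst (λ t → Written t (regs s 5) (mem s)) (sym (+-identityʳ (h * n))) written))
        where
        costClass : ℕ
        costClass = 1 + cost (diff class h) + 11
        cost≡ : 8 + n * (costClass + 13) ≡ levelCost
        cost≡ = cong (λ y → 8 + n * y) (trans (cong (λ c → 1 + (1 + (1 + c + 1) + (1 + 1 + c)) + 11 + 13) (trans (cost-tabulated ρ (allFin L)) (cong (λ l → l * 20 + 1) (length-allFin L)))) (arith L))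
          where
          arith : ∀ l → 1 + (1 + (1 + (l * 20 + 1) + 1) + (1 + 1 + (l * 20 + 1))) + 11 + 13 ≡ 40 * l + 32
          arith = solve-∀
        body : ∀ i s → At E (toℕ i) s → Written (h * n + toℕ i) (regs s 5) (mem s) →
               Run W (ifnz (diff class h) skip (store (op add (op add (reg 6) (lit 1)) (reg 3)) (reg 5) ⨾ set 5 (op add (reg 5) (lit 1))))
                 s costClass (λ s′ → At E (toℕ i) s′ × Written (h * n + suc (toℕ i)) (regs s′ 5) (mem s′))
        body i s a (acc , pos , frame) = run-weaken ≤-refl (λ { s (a , w) → a , subst (λ t → Written t (regs s 5) (mem s)) (sym (+-suc (h * n) (toℕ i))) w })
          (run-ifnz (fits-diff s class h fits (≤-trans h≤H H≤W)) other this)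
          where
          fits = proj₁ (class-ok i s a)
          eq   = proj₂ (class-ok i s a)
          t : ℕ
          t = h * n + toℕ i
          other : eval s (diff class h) ≢ 0 → Run W skip s 11 (λ s′ → At E (toℕ i) s′ × Written (suc t) (regs s′ 5) (mem s′))
          other neq = run-weaken {b = 1} (s≤s z≤n) (λ _ → id) (run-skip (a ,
            trans acc (sym (trans (rank-suc h i) (trans (cong (rank t +_) (ind-no (κ i ≟ h) κ≢h)) (+-identityʳ _)))) ,
            (λ j key<t → pos j (≤∧≢⇒< (s≤s⁻¹ key<t) (key≢t j))) , frame))
            where
            κ≢h : κ i ≢ h
            κ≢h κ≡h = neq (diff≡0 {s} {class} (trans eq κ≡h))
            key≢t : ∀ j → key j ≢ t
            key≢t j key≡t = κ≢h (trans (cong κ (proj₁ same)) (sym (proj₂ same)))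
              where same = key-injective {h} i j (sym key≡t)
          this : eval s (diff class h) ≡ 0 → Run W (store (op add (op add (reg 6) (lit 1)) (reg 3)) (reg 5) ⨾ set 5 (op add (reg 5) (lit 1))) s 11
                                               (λ s′ → At E (toℕ i) s′ × Written (suc t) (regs s′ 5) (mem s′))
          this isz = run-seq {Q = λ s′ → At E (toℕ i) s′ × regs s′ 5 ≡ rank t × Stored (mem s′)}
              (run-store ((addr₁≤₁ , 1≤W , m+n≤o⇒m≤o (regs s 6 + 1) addr≤) , m+n≤o⇒n≤o (regs s 6 + 1) addr≤ , addr≤) acc≤
                (at (base-store _ _ (≤-trans n≤next (≤-trans (m≤m+n a₀ (suc (toℕ i))) (≤-reflexive (sym addr≡)))) (base a)) (r3 a) (r4 a) , acc , stored)) λ s₁ (a₁ , acc₁ , st₁) →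
            let sum≡ : regs s₁ 5 + 1 ≡ suc (rank t)
                sum≡ = trans (cong (_+ 1) acc₁) (+-comm _ 1)
                sum≤ : regs s₁ 5 + 1 ≤ W
                sum≤ = ≤-trans (≤-reflexive (trans sum≡ (sym rank-t))) (≤-trans (rank≤n (suc t)) n≤W)
            in run-set (m+n≤o⇒m≤o (regs s₁ 5) sum≤ , 1≤W , sum≤) (at (base-5 _ (base a₁)) (r3 a₁) (r4 a₁) , trans sum≡ (sym rank-t) , st₁)
            where
            Stored : (ℕ → ℕ) → Set
            Stored μ = (∀ j → key j < suc t → μ (a₀ + suc (toℕ j)) ≡ rank (key j)) × (∀ x → x ≤ a₀ → μ x ≡ μ₀ x)
            κ≡h : κ i ≡ h
            κ≡h = trans (sym eq) (diff≡0⇒ s class h isz)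
            key≡t : key i ≡ t
            key≡t = cong (λ y → y * n + toℕ i) κ≡h
            rank-t : rank (suc t) ≡ suc (rank t)
            rank-t = trans (rank-suc h i) (trans (cong (rank t +_) (ind-yes (κ i ≟ h) κ≡h)) (+-comm _ 1))
            addr≡ : regs s 6 + 1 + regs s 3 ≡ a₀ + suc (toℕ i)
            addr≡ = trans (cong₂ (λ x y → x + 1 + y) (r6 (base a)) (r3 a)) (+-assoc a₀ 1 (toℕ i))
            addr≤ : regs s 6 + 1 + regs s 3 ≤ W
            addr≤ = ≤-trans (≤-reflexive addr≡) (≤-trans (+-monoʳ-≤ a₀ (s≤s (<⇒≤ (Fin.toℕ<n i)))) next≤W)
            addr₁≤₁ : regs s 6 ≤ W
            addr₁≤₁ = m+n≤o⇒m≤o (regs s 6) (m+n≤o⇒m≤o (regs s 6 + 1) addr≤)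
            acc≤ : regs s 5 ≤ W
            acc≤ = ≤-trans (≤-reflexive acc) (≤-trans (rank≤n t) n≤W)
            stored : Stored (mem s [ regs s 6 + 1 + regs s 3 ↦ regs s 5 ])
            stored = at-address _ addr≡
              where
              at-address : ∀ x → x ≡ a₀ + suc (toℕ i) → Stored (mem s [ x ↦ regs s 5 ])
              at-address _ refl = (λ j → written-at j (i Fin.≟ j)) ,
                λ x x≤ → trans (lookup-there (mem s) (regs s 5) (λ eq → <⇒≱ (m<m+n a₀ {suc (toℕ i)} z<s) (≤-trans (≤-reflexive eq) x≤))) (frame x x≤)
                where
                written-at : ∀ j → Dec (i ≡ j) → key j < suc t → (mem s [ a₀ + suc (toℕ i) ↦ regs s 5 ]) (a₀ + suc (toℕ j)) ≡ rank (key j)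
                written-at j (yes refl) key<t = trans (lookup-here (mem s) (a₀ + suc (toℕ i)) (regs s 5)) (trans acc (cong rank (sym key≡t)))
                written-at j (no  i≢j)  key<t = trans (lookup-there (mem s) (regs s 5) (λ eq → i≢j (Fin.toℕ-injective (suc-injective (+-cancelˡ-≡ a₀ _ _ eq)))))
                  (pos j (≤∧≢⇒< (s≤s⁻¹ key<t) λ key≡ → i≢j (proj₁ (key-injective {h} i j (sym key≡)))))

      run-emitLevels : ∀ r h → h + r ≡ suc H → ∀ s → Base E s → Written (h * n) (regs s 5) (mem s) →
                       Run W (emitLevels ρ h r) s (r * levelCost + 1) (λ s′ → Base E s′ × Written (suc H * n) (regs s′ 5) (mem s′))
      run-emitLevels zero    h h≡ s b w = run-skip (b , subst (λ h → Written (h * n) (regs s 5) (mem s)) (trans (sym (+-identityʳ h)) h≡) w)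
      run-emitLevels (suc r) h h≡ s b w = run-weaken (≤-reflexive (sym (+-assoc levelCost (r * levelCost) 1))) (λ _ → id)
        (run-seq (run-emitLevel h (s≤s⁻¹ (≤-trans (m≤m+n (suc h) r) (≤-reflexive (trans (sym (+-suc h r)) h≡)))) s b w) λ s₁ (b₁ , w₁) →
         run-emitLevels r (suc h) (trans (sym (+-suc h r)) h≡) s₁ b₁ w₁)

      key<top : ∀ j → key j < suc H * n
      key<top j = <-≤-trans (+-monoʳ-< (κ j * n) (Fin.toℕ<n j)) (≤-trans (≤-reflexive (+-comm (κ j * n) n)) (*-monoˡ-≤ n (s≤s (ρ≤H (obj j)))))

    advance : Env → Env
    advance E = env (total E) (next E + suc n) (quot E) (rest E)

    countReg-ok : ∀ {E} k s → Base E s → regs s (countReg k) ≡ count (quot E) (rest E) k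
    countReg-ok quotient  s b = r7 b
    countReg-ok remainder s b = r8 b

    run-emitBlock : ∀ {E} ρ → (∀ o → ρ o ≤ H) → total E ≡ P → n ≤ next E → next E + suc n ≤ W →
                    ∀ k → count (quot E) (rest E) k ≤ W → ∀ s → Base E s →
                    Run W (emitBlock k ρ) s blockCost (λ s′ → Base (advance E) s′ ×
                      mem s′ (next E) ≡ count (quot E) (rest E) k ×
                      (∀ j → mem s′ (next E + suc (toℕ j)) ≡ toℕ (cellOrder ρ ⟨$⟩ʳ j)) ×
                      (∀ x → x < next E → mem s′ x ≡ mem s x))
    run-emitBlock {E} ρ ρ≤H E≡ n≤next next≤W k k≤W s b = run-weaken (≤-reflexive (total≡ (suc H * levelCost))) (λ _ → id)
      (run-seq {Q = λ s₁ → Base E s₁ × mem s₁ ≡ μ₀} (run-store r6≤ v≤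
         (base-store (regs s 6) _ (≤-trans n≤next (≤-reflexive (sym (r6 b)))) b , cong₂ (λ x v → mem s [ x ↦ v ]) (r6 b) v≡)) λ s₁ (b₁ , μ₁) →
       run-seq {Q = λ s₂ → Base E s₂ × regs s₂ 5 ≡ 0 × mem s₂ ≡ μ₀} (run-set z≤n (base-5 0 b₁ , refl , μ₁)) λ s₂ (b₂ , acc₂ , μ₂) →
       run-seq (run-emitLevels (suc H) 0 refl s₂ b₂ (trans acc₂ (sym rank-zero) , (λ _ ()) , λ x _ → cong (λ μ → μ x) μ₂)) λ s₃ (b₃ , _ , pos , frame) →
       let next≡ : regs s₃ 6 + regs s₃ 0 + 1 ≡ next E + suc n
           next≡ = trans (cong₂ (λ x y → x + y + 1) (r6 b₃) (r0 b₃)) (trans (+-assoc (next E) n 1) (cong (next E +_) (+-comm n 1)))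
           next≤ : regs s₃ 6 + regs s₃ 0 + 1 ≤ W
           next≤ = ≤-trans (≤-reflexive next≡) next≤W
           next₁≤ : regs s₃ 6 + regs s₃ 0 ≤ W
           next₁≤ = m+n≤o⇒m≤o (regs s₃ 6 + regs s₃ 0) next≤
       in run-set ((m+n≤o⇒m≤o (regs s₃ 6) next₁≤ , m+n≤o⇒n≤o (regs s₃ 6) next₁≤ , next₁≤) , 1≤W , next≤)
         (record { r0 = r0 b₃ ; r1 = r1 b₃ ; r2 = r2 b₃ ; r6 = next≡ ; r7 = r7 b₃ ; r8 = r8 b₃ ; cl = cl b₃ } ,
          trans (frame (next E) ≤-refl) (lookup-here (mem s) (next E) v) ,
          (λ j → trans (pos j (key<top j)) (sym (toℕ-cellOrder ρ j))) ,
          (λ x x< → trans (frame x (<⇒≤ x<)) (lookup-there (mem s) v (λ eq → <⇒≢ x< (sym eq))))))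
      where
      v = count (quot E) (rest E) k
      μ₀ = mem s [ next E ↦ v ]
      open Emission ρ ρ≤H {E} E≡ n≤next next≤W μ₀
      open Ranking κ
      v≡ : regs s (countReg k) ≡ v
      v≡ = countReg-ok k s b
      v≤ : regs s (countReg k) ≤ W
      v≤ = ≤-trans (≤-reflexive v≡) k≤W
      r6≤ : regs s 6 ≤ W
      r6≤ = ≤-trans (≤-reflexive (r6 b)) (m+n≤o⇒m≤o (next E) next≤W)
      total≡ : ∀ c → 3 + (2 + ((c + 1) + 6)) ≡ c + 12
      total≡ = solve-∀

    toBlock : ℕ → ℕ → Count × (Fin L → ℕ) → Block n
    toBlock q r (k , ρ) = count q r k , cellOrder ρ

    -- The frame condition for addresses below `next E` lets the induction keep the blocks already
    -- written.
    run-emitBlocks : ∀ bs → All (λ b → ∀ o → proj₂ b o ≤ H) bs → ∀ E → total E ≡ P → n ≤ next E → next E + length bs * suc n ≤ W →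
                     (∀ k → count (quot E) (rest E) k ≤ W) → ∀ s → Base E s →
                     Run W (emitBlocks bs) s (length bs * blockCost + 1) (λ s′ → regs s′ 0 ≡ n ×
                       StoredAt (mem s′) (next E) (map (toBlock (quot E) (rest E)) bs) × (∀ x → x < next E → mem s′ x ≡ mem s x))
    run-emitBlocks []             _              E E≡ n≤ ≤W counts s b = run-skip (r0 b , _ , λ _ _ → refl)
    run-emitBlocks ((k , ρ) ∷ bs) (ρ≤H ∷ bounds) E E≡ n≤ ≤W counts s b = run-weaken (≤-reflexive (sym (+-assoc blockCost (length bs * blockCost) 1))) (λ _ → id)
      (run-seq (run-emitBlock {E} ρ ρ≤H E≡ n≤ (m+n≤o⇒m≤o (next E + suc n) ≤W′) k (counts k) s b) λ s₁ (b₁ , len₁ , pos₁ , frame₁) →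
       run-weaken ≤-refl (λ s₂ (r0₂ , stored₂ , frame₂) → r0₂ ,
           (trans (frame₂ (next E) (m<m+n (next E) z<s)) len₁ ,
            (λ j → trans (frame₂ (next E + suc (toℕ j)) (+-monoʳ-< (next E) (s<s (Fin.toℕ<n j)))) (pos₁ j)) , stored₂) ,
           λ x x< → trans (frame₂ x (<-trans x< (m<m+n (next E) z<s))) (frame₁ x x<))
         (run-emitBlocks bs bounds (advance E) E≡ (≤-trans n≤ (m≤m+n (next E) (suc n))) ≤W′ counts s₁ b₁))
      where
      ≤W′ : next E + suc n + length bs * suc n ≤ W
      ≤W′ = ≤-trans (≤-reflexive (+-assoc (next E) (suc n) _)) ≤W

    record Good (s : State) : Set where
      constructor good
      field
        π       : Schedule n m
        outputs : Outputs s π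
        optimal : ∀ ρ → H * objective I π ≤ (H + 10) * objective I ρ

    M₀≤W : suc M₀ ≤ W
    M₀≤W = ≤-trans (≤-trans (m≤m*n (suc M₀) (suc n)) (m≤n+m _ n)) addr≤W

    leafCost solveCost : ℕ
    leafCost = suc M₀ * blockCost + 3
    solveCost = 12 + (L * (16 + n * 34 + V * 8) + leafCost)

    module _ (D : ℕ) .{{_ : NonZero D}} (D≡ : D ≡ m ⊎ (D ≡ M × M₀ ≤ m)) (D≤M₀ : D ≤ M₀) where

      length-plan : ∀ σ → length (plan D σ) ≡ suc D
      length-plan σ = trans (length-++ (map _ (allFin D))) (trans (cong (_+ 1) (trans (length-map _ (allFin D)) (length-allFin D))) (+-comm D 1))

      toBlock-plan : ∀ (ρ : Fin D → Fin L → Fin (suc H)) →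
        map (toBlock (m / D) (m % D)) (map (λ i → quotient , toℕ ∘ ρ i) (allFin D) ++ (remainder , λ _ → 0) ∷ []) ≡
        map (λ i → m / D , cellOrder (toℕ ∘ ρ i)) (allFin D) ++ (m % D , cellOrder (λ _ → 0)) ∷ []
      toBlock-plan ρ = trans (map-++ (toBlock (m / D) (m % D)) (map day (allFin D)) ((remainder , λ _ → 0) ∷ []))
        (cong (_++ map (toBlock (m / D) (m % D)) ((remainder , λ _ → 0) ∷ [])) (sym (map-∘ {g = toBlock (m / D) (m % D)} {f = day} (allFin D))))
        where
        day : Fin D → Count × (Fin L → ℕ)
        day i = quotient , toℕ ∘ ρ i

      plan-blocks : ∀ σ (σ≡ : ∀ o → σ o ≡ size o) → map (toBlock (m / D) (m % D)) (plan D σ) ≡ Output.blocks σ σ≡ D D≡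
      plan-blocks σ σ≡ = toBlock-plan (Table.best D L (suc H) σ)

      plan≤H : ∀ σ → All (λ b → ∀ o → proj₂ b o ≤ H) (plan D σ)
      plan≤H σ = All.++⁺ (All.map⁺ (All.universal (λ i o → s≤s⁻¹ (Fin.toℕ<n (Table.best D L (suc H) σ i o))) (allFin D))) ((λ _ → z≤n) ∷ [])

      E₁ : Env
      E₁ = env P n (m / D) (m % D)

      run-leaf : ∀ σ → (∀ o → σ o ≡ size o) → ∀ s → Base E₁ s → Run W (emitBlocks (plan D σ) ⨾ set 1 (lit (suc D))) s leafCost Good
      run-leaf σ σ≡ s b = run-weaken cost≤ (λ _ → id)
        (run-seq (run-emitBlocks (plan D σ) (plan≤H σ) E₁ refl ≤-refl room counts s b) λ s₁ (r0₁ , stored₁ , _) →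
         run-set (≤-trans (s≤s D≤M₀) M₀≤W) (good (proj₁ schedule)
           (blocks , trans (sym (length-plan σ)) (trans (sym (length-map (toBlock (m / D) (m % D)) (plan D σ))) (cong length (plan-blocks σ σ≡))) ,
            subst₂ (StoredAt (mem s₁)) (sym r0₁) (plan-blocks σ σ≡) stored₁ , proj₂ schedule) objective≤))
        where
        open Output σ σ≡ D D≡
        room : n + length (plan D σ) * suc n ≤ W
        room = ≤-trans (+-monoʳ-≤ n (*-monoˡ-≤ (suc n) (≤-trans (≤-reflexive (length-plan σ)) (s≤s D≤M₀)))) addr≤W
        counts : ∀ k → count (m / D) (m % D) k ≤ W
        counts quotient  = ≤-trans (m/n≤m m D) m≤W
        counts remainder = ≤-trans (m%n≤m m D) m≤W
        cost≤ : length (plan D σ) * blockCost + 1 + 2 ≤ leafCost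
        cost≤ = ≤-trans (≤-reflexive (+-assoc _ 1 2)) (+-monoˡ-≤ 3 (*-monoˡ-≤ blockCost (≤-trans (≤-reflexive (length-plan σ)) (s≤s D≤M₀))))

      run-solve : ∀ {E} → total E ≡ P → ∀ s → Base E s → Run W (solve D) s solveCost Good
      run-solve {E} E≡ s b =
        run-seq {Q = Base (env P (next E) (m / D) (rest E))} (run-set (fits-div s (reg 1) (lit D) (r1≤ b) D≤W)
          (record { r0 = r0 b ; r1 = r1 b ; r2 = trans (r2 b) E≡ ; r6 = r6 b ; r8 = r8 b ; cl = cl b
                  ; r7 = trans (cong (λ x → ⟦ div ⟧ x D) (r1 b)) (⟦div⟧ m D) })) λ s₁ b₁ →
        run-seq {Q = Base (env P (next E) (m / D) (m % D))} (run-set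
          (fits-sub s₁ (reg 1) (op mul (reg 7) (lit D)) (r1≤ b₁)
            (≤-trans (≤-reflexive (r7 b₁)) (≤-trans (m/n≤m m D) m≤W) , D≤W , ≤-trans (≤-reflexive (cong (_* D) (r7 b₁))) (≤-trans (m/n*n≤m m D) m≤W)))
          (record { r0 = r0 b₁ ; r1 = r1 b₁ ; r2 = r2 b₁ ; r6 = r6 b₁ ; r7 = r7 b₁ ; cl = cl b₁
                  ; r8 = trans (cong₂ (λ x y → x ∸ y * D) (r1 b₁) (r7 b₁)) (sym (m%n≡m∸m/n*n m D)) })) λ s₂ b₂ →
        run-seq {Q = Base E₁} (run-set (≤-trans (≤-reflexive (r0 b₂)) n≤W)
          (record { r0 = r0 b₂ ; r1 = r1 b₂ ; r2 = r2 b₂ ; r6 = r0 b₂ ; r7 = r7 b₂ ; r8 = r8 b₂ ; cl = cl b₂ })) λ s₃ b₃ →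
        run-branch refl L id _ run-leaf s₃ b₃
        where
        D≤W : D ≤ W
        D≤W = ≤-trans D≤M₀ (<⇒≤ M₀≤W)
        r1≤ : ∀ {E s} → Base E s → regs s 1 ≤ W
        r1≤ b = ≤-trans (≤-reflexive (r1 b)) m≤W

    clamp : ∀ k → (m < k × m ∸ (m ∸ k) ≡ m) ⊎ (k ≤ m × m ∸ (m ∸ k) ≡ k)
    clamp k with k ≤? m
    ... | yes k≤m = inj₂ (k≤m , m∸[m∸n]≡n k≤m)
    ... | no  k≰m = inj₁ (≰⇒> k≰m , cong (m ∸_) (m≤n⇒m∸n≡0 (<⇒≤ (≰⇒> k≰m))))

    period-ok : ∀ {x} → (m < M₀ × x ≡ m) ⊎ (M₀ ≤ m × x ≡ M₀) → (period x ≡ m ⊎ (period x ≡ M × M₀ ≤ m)) × period x ≤ M₀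
    period-ok {x} cases with x <? M₀ | cases
    ... | yes x<M₀ | inj₁ (_ , x≡m)     = inj₁ x≡m , <⇒≤ x<M₀
    ... | yes x<M₀ | inj₂ (_ , x≡M₀)    = contradiction x≡M₀ (<⇒≢ x<M₀)
    ... | no  x≮M₀ | inj₁ (m<M₀ , refl) = contradiction m<M₀ x≮M₀
    ... | no  _    | inj₂ (M₀≤m , _)    = inj₂ (refl , M₀≤m) , m≤n*m M H

    initial : Base (env 0 0 0 0) (input I)
    initial = record { r0 = refl ; r1 = refl ; r2 = refl ; r6 = refl ; r7 = refl ; r8 = refl ; cl = input-mem I }

    clamped : (m < M₀ × m ∸ (m ∸ M₀) ≡ m) ⊎ (M₀ ≤ m × m ∸ (m ∸ M₀) ≡ M₀) → m ∸ (m ∸ M₀) ≤ M₀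
    clamped (inj₁ (m<M₀ , eq)) = ≤-trans (≤-reflexive eq) (<⇒≤ m<M₀)
    clamped (inj₂ (_ , eq))    = ≤-reflexive eq

    run-period : ∀ {D} → (D ≡ m ⊎ (D ≡ M × M₀ ≤ m)) × D ≤ M₀ → ∀ s → Base (env P 0 0 0) s → Run W (solve D) s solveCost Good
    run-period {D} (D≡ , D≤) = run-solve D {{D≢0 D≡}} D≡ D≤ refl
      where
      D≢0 : D ≡ m ⊎ (D ≡ M × M₀ ≤ m) → NonZero D
      D≢0 (inj₁ eq)       = subst NonZero (sym eq) (>-nonZero (>-nonZero⁻¹ m))
      D≢0 (inj₂ (eq , _)) = subst NonZero (sym eq) M≢0

    period-of-clamp : ∀ {x} → x ≡ m ∸ (m ∸ M₀) → (period x ≡ m ⊎ (period x ≡ M × M₀ ≤ m)) × period x ≤ M₀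
    period-of-clamp refl = period-ok (clamp M₀)

    run-solve-period : ∀ s → Base (env P 0 0 0) s → regs s 5 ≡ m ∸ (m ∸ M₀) → Run W ((solve ∘ period) (regs s 5)) s solveCost Good
    run-solve-period s b x≡ = run-period {period (regs s 5)} (period-of-clamp x≡) s b

    run-dispatch : ∀ s → Base (env P 0 0 0) s → regs s 5 ≡ m ∸ (m ∸ M₀) →
                   Run W (select 0 M₀ (solve ∘ period)) s (M₀ * 8 + solveCost) Good
    run-dispatch s b x≡ = run-select {W} {solveCost} {s} {Good} M₀ 0 (solve ∘ period) z≤n (≤-trans (≤-reflexive x≡) (clamped (clamp M₀))) (<⇒≤ M₀≤W)
      (run-solve-period s b x≡)

    run-total : Run W (forLoop skip) (input I) (8 + n * 14) (λ s → Base (env 0 0 0 0) s × regs s 4 ≡ P)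
    run-total = run-weaken ≤-refl (λ { s (a , _) → base a , trans (r4 a) (pre-all (p I)) })
      (run-forLoop (λ _ _ _ → 0 ≡ 0) (λ i s a _ → run-skip (a , refl)) (input I) initial refl)

    mainCost : ℕ
    mainCost = 8 + n * 14 + (2 + (6 + (M₀ * 8 + solveCost)))

    run-main : Run W main (input I) mainCost Good
    run-main = run-seq run-total λ s₁ (b₁ , total≡) →
      run-seq {Q = Base (env P 0 0 0)} (run-set (≤-trans (≤-reflexive total≡) P≤W)
        (record { r0 = r0 b₁ ; r1 = r1 b₁ ; r2 = total≡ ; r6 = r6 b₁ ; r7 = r7 b₁ ; r8 = r8 b₁ ; cl = cl b₁ })) λ s₂ b₂ →
      run-seq {Q = λ s → Base (env P 0 0 0) s × regs s 5 ≡ m ∸ (m ∸ M₀)} (run-set (fits s₂ b₂)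
        (base-5 _ b₂ , cong (λ x → x ∸ (x ∸ M₀)) (r1 b₂))) λ s₃ (b₃ , x≡) →
      run-dispatch s₃ b₃ x≡
      where
      fits : ∀ s → Base (env P 0 0 0) s → Fits W s (op sub (reg 1) (op sub (reg 1) (lit M₀)))
      fits s b = fits-sub s (reg 1) (op sub (reg 1) (lit M₀)) m₂≤ (fits-sub s (reg 1) (lit M₀) m₂≤ (<⇒≤ M₀≤W))
        where
        m₂≤ : regs s 1 ≤ W
        m₂≤ = ≤-trans (≤-reflexive (r1 b)) m≤W

  -- Rational bounds

  int : ℕ → ℚ
  int k = ℤ.+ k ℚ./ 1

  toℚᵘ-int : ∀ k → toℚᵘ (int k) ℚᵘ.≃ ℚᵘ.mkℚᵘ (ℤ.+ k) 0
  toℚᵘ-int k = ℚ.toℚᵘ-fromℚᵘ (ℚᵘ.mkℚᵘ (ℤ.+ k) 0)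

  ≤-int : ∀ x k → ↥ x ℤ.≤ ℤ.+ k ℤ.* ↧ x → x ℚ.≤ int k
  ≤-int x@record{} k le = ℚ.toℚᵘ-cancel-≤ (ℚᵘ.≤-respʳ-≃ (ℚᵘ.≃-sym (toℚᵘ-int k))
    (ℚᵘ.*≤* (ℤ.≤-trans (ℤ.≤-reflexive (ℤ.*-identityʳ (↥ x))) le)))

  ≤-int⁻¹ : ∀ x k → x ℚ.≤ int k → ↥ x ℤ.≤ ℤ.+ k ℤ.* ↧ x
  ≤-int⁻¹ x@record{} k le with ℚᵘ.≤-respʳ-≃ (toℚᵘ-int k) (ℚ.toℚᵘ-mono-≤ le)
  ... | ℚᵘ.*≤* le′ = ℤ.≤-trans (ℤ.≤-reflexive (sym (ℤ.*-identityʳ (↥ x)))) le′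

  1≤int : ∀ k → 1 ≤ k → 1ℚ ℚ.≤ int k
  1≤int k 1≤k = ℚ.toℚᵘ-cancel-≤ (ℚᵘ.≤-respʳ-≃ (ℚᵘ.≃-sym (toℚᵘ-int k))
    (ℚᵘ.*≤* (ℤ.≤-trans (ℤ.+≤+ 1≤k) (ℤ.≤-reflexive (sym (ℤ.*-identityʳ (ℤ.+ k)))))))

  ≤∣ceiling∣ : ∀ x → x ℚ.≤ int ℤ.∣ ℚ.ceiling x ∣
  ≤∣ceiling∣ x@record{} = ≤-int x ℤ.∣ ℚ.ceiling x ∣ (ℤ.≤-trans ↥x≤ (ℤ.*-monoʳ-≤-nonNeg (↧ x) (ceiling≤ (ℚ.ceiling x))))
    where
    f = ℚ.floor (ℚ.- x)
    floor≤ : ∀ y → ℚ.floor y ℤ.* ↧ y ℤ.≤ ↥ y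
    floor≤ y@record{} = ℤ.[n/d]*d≤n (↥ y) (↧ y)
    ceiling≤ : ∀ i → i ℤ.≤ ℤ.+ ℤ.∣ i ∣
    ceiling≤ (ℤ.+ n)     = ℤ.≤-refl
    ceiling≤ ℤ.-[1+ n ] = ℤ.-≤+
    ↥x≤ : ↥ x ℤ.≤ ℚ.ceiling x ℤ.* ↧ x
    ↥x≤ = ℤ.≤-trans (ℤ.≤-reflexive (trans (sym (ℤ.neg-involutive (↥ x))) (cong ℤ.-_ (sym (ℚ.↥-neg x)))))
      (ℤ.≤-trans (ℤ.neg-mono-≤ (floor≤ (ℚ.- x))) (ℤ.≤-reflexive (trans (cong (λ d → ℤ.- (f ℤ.* d)) (ℚ.↧-neg x)) (ℤ.neg-distribˡ-* f (↧ x)))))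

  -- ⌈1/ε⌉ for positive ε.
  inverse : ℚ → ℕ
  inverse (mkℚ ℤ.+[1+ a ] b _) = suc (b / suc a)
  inverse _                    = 1

  power-pos : ∀ y .{{_ : Positive y}} k → Positive (ℚ.+-*-rawSemiring ⟨ y ⟩^ k)
  power-pos y zero    = _
  power-pos y (suc k) = ℚ.pos*pos⇒pos y (ℚ.+-*-rawSemiring ⟨ y ⟩^ k) {{power-pos y k}}

  1≤power : ∀ y .{{_ : Positive y}} → 1ℚ ℚ.≤ y → ∀ k → 1ℚ ℚ.≤ ℚ.+-*-rawSemiring ⟨ y ⟩^ k
  1≤power y 1≤y zero    = ℚ.≤-refl
  1≤power y 1≤y (suc k) = ℚ.≤-trans 1≤y (ℚ.≤-trans (ℚ.≤-reflexive (sym (ℚ.*-identityʳ y)))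
    (ℚ.*-monoˡ-≤-nonNeg y {{ℚ.pos⇒nonNeg y}} (1≤power y 1≤y k)))

  -- If `ε ≥ 1`, then `inverse ε` is 1 and `ratio` only has to be positive. Otherwise `1/ε ≥ 1`, so
  -- `1/ε` is at most its ninth power, and the factor `loglog n ≥ 1` and rounding up only increase
  -- the bound.
  inverse≤ratio : ∀ ε .{{_ : Positive ε}} n → inverse ε ≤ ratio ε n
  inverse≤ratio ε@(mkℚ ℤ.+[1+ a ] b c) n = bound (b <? suc a)
    where
    y y⁹ x : ℚ
    y  = ℚ.1/ ε
    y⁹ = ℚ.+-*-rawSemiring ⟨ y ⟩^ 9
    x  = int (loglog n) ℚ.* y⁹
    1≤loglog : 1ℚ ℚ.≤ int (loglog n)
    1≤loglog = 1≤int (loglog n) (m≤m⊔n 1 ⌈log₂ ⌈log₂ n ⌉ ⌉)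
    y⁹≤x : y⁹ ℚ.≤ x
    y⁹≤x = ℚ.≤-trans (ℚ.≤-reflexive (sym (ℚ.*-identityˡ y⁹))) (ℚ.*-monoʳ-≤-nonNeg y⁹ {{ℚ.pos⇒nonNeg y⁹ {{power-pos y 9}}}} 1≤loglog)
    x≤ : x ℚ.≤ int (ratio ε n)
    x≤ = ≤∣ceiling∣ x
    bound : Dec (b < suc a) → suc (b / suc a) ≤ ratio ε n
    bound (yes b<a) = subst (λ q → suc q ≤ ratio ε n) (sym (m<n⇒m/n≡0 b<a)) (n≢0⇒n>0 λ r≡0 →
      ℚ.<-irrefl refl (ℚ.<-≤-trans (ℚ.positive⁻¹ y⁹ {{power-pos y 9}}) (ℚ.≤-trans y⁹≤x (subst (λ r → x ℚ.≤ int r) r≡0 x≤))))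
    bound (no b≮a) = m<n*o⇒m/o<n {b} {ratio ε n} {suc a} (ℤ.drop‿+≤+ (ℤ.≤-trans (≤-int⁻¹ y (ratio ε n) y≤r) (ℤ.≤-reflexive (sym (ℤ.pos-* (ratio ε n) (suc a))))))
      where
      1≤y : 1ℚ ℚ.≤ y
      1≤y = ℚ.*≤* (ℤ.≤-trans (ℤ.≤-reflexive (ℤ.*-identityˡ (ℤ.+ suc a))) (ℤ.≤-trans (ℤ.+≤+ (m≤n⇒m≤1+n (≮⇒≥ b≮a))) (ℤ.≤-reflexive (sym (ℤ.*-identityʳ (ℤ.+ suc b))))))
      y≤r : y ℚ.≤ int (ratio ε n)
      y≤r = ℚ.≤-trans (ℚ.≤-reflexive (sym (ℚ.*-identityʳ y)))
            (ℚ.≤-trans (ℚ.*-monoˡ-≤-nonNeg y (1≤power y 1≤y 8)) (ℚ.≤-trans y⁹≤x x≤))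

  -- Cancelling 10 leaves `e * x ≤ (e + 1) * k` with `e = inverse ε`. If `x = k + δ`, then
  -- `e * δ ≤ k`, and `1/ε ≤ e` gives `δ ≤ ε * k`.
  ≤-[1+ε]* : ∀ ε .{{_ : Positive ε}} x k → let H = 10 * inverse ε in H * x ≤ (H + 10) * k →
             int x ℚ.≤ (1ℚ ℚ.+ ε) ℚ.* int k
  ≤-[1+ε]* ε@(mkℚ ℤ.+[1+ a ] b c) x k le = ℚ.toℚᵘ-cancel-≤
    (ℚᵘ.≤-respˡ-≃ (ℚᵘ.≃-sym (toℚᵘ-int x)) (ℚᵘ.≤-respʳ-≃ (ℚᵘ.≃-sym right) (ℚᵘ.*≤* (begin
      ℤ.+ x ℤ.* ℤ.+ suc ((b + 0) * 1)        ≡⟨ trans (sym (ℤ.pos-* x _)) (cong (λ d → ℤ.+ (x * suc d)) (trans (*-identityʳ (b + 0)) (+-identityʳ b))) ⟩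
      ℤ.+ (x * suc b)                        ≤⟨ ℤ.+≤+ main ⟩
      ℤ.+ ((suc b + suc a) * k)              ≡⟨ cong (λ y → ℤ.+ (y * k)) (cong₂ _+_ (cong suc (sym (+-identityʳ b))) (cong suc (sym (*-identityʳ a)))) ⟩
      ℤ.+ ((suc (b + 0) + suc (a * 1)) * k)  ≡⟨ trans (ℤ.pos-* (suc (b + 0) + suc (a * 1)) k) (sym (ℤ.*-identityʳ _)) ⟩
      ℤ.+ (suc (b + 0) + suc (a * 1)) ℤ.* ℤ.+ k ℤ.* ℤ.+ 1 ∎))))
    where
    open ℤ.≤-Reasoning
    right : toℚᵘ ((1ℚ ℚ.+ ε) ℚ.* int k) ℚᵘ.≃ (toℚᵘ 1ℚ ℚᵘ.+ toℚᵘ ε) ℚᵘ.* ℚᵘ.mkℚᵘ (ℤ.+ k) 0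
    right = ℚᵘ.≃-trans (ℚ.toℚᵘ-homo-* (1ℚ ℚ.+ ε) (int k)) (ℚᵘ.*-cong (ℚ.toℚᵘ-homo-+ 1ℚ ε) (toℚᵘ-int k))
    e = inverse ε
    ex≤ : e * x ≤ (e + 1) * k
    ex≤ = *-cancelˡ-≤ 10 (≤-trans (≤-reflexive (sym (*-assoc 10 e x))) (≤-trans le (≤-reflexive (eq e k))))
      where
      eq : ∀ e k → (10 * e + 10) * k ≡ 10 * ((e + 1) * k)
      eq = solve-∀
    b≤ : suc b ≤ e * suc a
    b≤ = ≤-trans (≤-reflexive (cong suc (m≡m%n+[m/n]*n b (suc a)))) (+-monoˡ-≤ (b / suc a * suc a) (m%n<n b (suc a)))
    main : x * suc b ≤ (suc b + suc a) * k
    main with ≤-total x k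
    ... | inj₁ x≤k = ≤-trans (*-mono-≤ x≤k (m≤m+n (suc b) (suc a))) (≤-reflexive (*-comm k _))
    ... | inj₂ k≤x with δ , refl ← m≤n⇒∃[o]m+o≡n k≤x = ≤R.begin
      (k + δ) * suc b              ≤R.≡⟨ *-distribʳ-+ (suc b) k δ ⟩
      k * suc b + δ * suc b        ≤R.≤⟨ +-monoʳ-≤ (k * suc b) (*-monoʳ-≤ δ b≤) ⟩
      k * suc b + δ * (e * suc a)  ≤R.≡⟨ cong (k * suc b +_) (trans (sym (*-assoc δ e (suc a))) (cong (_* suc a) (*-comm δ e))) ⟩
      k * suc b + e * δ * suc a    ≤R.≤⟨ +-monoʳ-≤ (k * suc b) (*-monoˡ-≤ (suc a) (+-cancelˡ-≤ (e * k) (e * δ) k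
                                       (≤-trans (≤-reflexive (sym (*-distribˡ-+ e k δ))) (≤-trans ex≤ (≤-reflexive (eq′ e k)))))) ⟩
      k * suc b + k * suc a        ≤R.≡⟨ trans (sym (*-distribˡ-+ k (suc b) (suc a))) (*-comm k _) ⟩
      (suc b + suc a) * k          ≤R.∎
      where
      module ≤R = ≤-Reasoning
      eq′ : ∀ e k → (e + 1) * k ≡ e * k + k
      eq′ = solve-∀

  -- The running time

  module _ {n m : ℕ} (I : Instance n m) .{{_ : NonZero n}} .{{_ : NonZero m}} (H : ℕ) .{{_ : NonZero H}} where

    open Rounding I H

    V≤M₀ : V ≤ M₀
    V≤M₀ = ≤-trans (*-monoˡ-≤ H (m≤m*n L (H * H))) (≤-reflexive (*-comm M H))

    L≤M₀ : L ≤ M₀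
    L≤M₀ = ≤-trans (m≤m*n L H) V≤M₀

    1+H≤M₀ : suc H ≤ M₀
    1+H≤M₀ = ≤-trans (m≤m*n (suc H) (H * H)) L≤M₀

    1≤M₀ : 1 ≤ M₀
    1≤M₀ = ≤-trans (s≤s z≤n) 1+H≤M₀

  -- The left-hand side is `4 + mainCost`, where 4 is the cost of the test for a single client and
  -- `l`, `v`, `s`, `b` stand for `L`, `V`, `suc H`, `M₀`.
  cost-bound : ∀ {n l v s b} → 1 ≤ n → 1 ≤ b → l ≤ b → v ≤ b → s ≤ b →
               4 + (8 + n * 14 + (2 + (6 + (b * 8 + (12 + (l * (16 + n * 34 + v * 8) + (suc b * (s * (8 + n * (40 * l + 32)) + 12) + 3)))))))
               ≤ 400 * (n * (b * b * b))
  cost-bound {suc n} {l} {v} {s} {b′@(suc b)} _ _ l≤ v≤ s≤ =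
    ≤-trans (+-monoʳ-≤ 4 (+-monoʳ-≤ (8 + suc n * 14) (+-monoʳ-≤ 2 (+-monoʳ-≤ 6 (+-monoʳ-≤ (b′ * 8) (+-monoʳ-≤ 12 (+-mono-≤
      (*-mono-≤ l≤ (+-monoʳ-≤ (16 + suc n * 34) (*-monoˡ-≤ 8 v≤)))
      (+-monoˡ-≤ 3 (*-monoʳ-≤ (suc b′) (+-monoˡ-≤ 12 (*-mono-≤ s≤ (+-monoʳ-≤ 8 (*-monoʳ-≤ (suc n) (+-monoˡ-≤ 32 (*-monoʳ-≤ 40 l≤)))))))))))))))
    (≤-trans (m≤m+n _ slack) (≤-reflexive (expansion n b)))
    where
    -- The difference of the two sides once `l`, `v` and `s` are replaced by the larger `b`.
    -- Expressed in the predecessors of `n` and `b` it has no negative coefficient.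
    slack = 101 + 794 * b + 992 * (b * b) + 360 * (b * b * b) + n * (208 + 870 * b + 1008 * (b * b) + 360 * (b * b * b))
    expansion : ∀ n b → 4 + (8 + suc n * 14 + (2 + (6 + (suc b * 8 + (12 + (suc b * (16 + suc n * 34 + suc b * 8) + (suc (suc b) * (suc b * (8 + suc n * (40 * suc b + 32)) + 12) + 3)))))))
             + (101 + 794 * b + 992 * (b * b) + 360 * (b * b * b) + n * (208 + 870 * b + 1008 * (b * b) + 360 * (b * b * b)))
             ≡ 400 * (suc n * (suc b * suc b * suc b))
    expansion = solve-∀

  1≤inverse : ∀ ε → 1 ≤ inverse ε
  1≤inverse (mkℚ ℤ.+[1+ _ ] _ _) = s≤s z≤n
  1≤inverse (mkℚ ℤ.+0       _ _) = s≤s z≤n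
  1≤inverse (mkℚ ℤ.-[1+ _ ] _ _) = s≤s z≤n

  k≤n^k : ∀ {n} → 2 ≤ n → ∀ k → k ≤ n ^ k
  k≤n^k 2≤n zero    = z≤n
  k≤n^k {n} 2≤n (suc k) = begin
    1 + k            ≤⟨ +-mono-≤ (m^n>0 n {{>-nonZero (≤-trans (s≤s z≤n) 2≤n)}} k) (k≤n^k 2≤n k) ⟩
    n ^ k + n ^ k    ≡⟨ cong (n ^ k +_) (sym (+-identityʳ (n ^ k))) ⟩
    2 * n ^ k        ≤⟨ *-monoˡ-≤ (n ^ k) 2≤n ⟩
    n * n ^ k        ∎
    where open ≤-Reasoning

  *-^-distrib : ∀ a b k → (a * b) ^ k ≡ a ^ k * b ^ k
  *-^-distrib a b zero    = refl
  *-^-distrib a b (suc k) = trans (cong (a * b *_) (*-^-distrib a b k)) (CSG.interchange *-commutativeSemigroup a b (a ^ k) (b ^ k))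

  -- Opaque, lest conversion checking unfold products with large literals.
  opaque
    c₀ g₀ : ℕ
    c₀ = 400
    g₀ = 11

    c₀≡400 : c₀ ≡ 400
    c₀≡400 = refl

    g₀≡11 : g₀ ≡ 11
    g₀≡11 = refl

  -- The time is cubic in `M₀`, which is at most the sixth power of `11 * inverse ε`, as
  -- `suc (10 * e) ≤ 11 * e`; this explains `g₀ ^ 18`. In the exponent, `19 = 1 + 18` pays for the
  -- factor `n` and for `inverse ε ^ 18`. The word exponent 3 is needed for `P * V`, a product of a
  -- number of clients, a processing time and a parameter.
  A₀ C₀ d₀ : ℕ
  A₀ = c₀ * g₀ ^ 18
  C₀ = 19
  d₀ = 3

  -- ⌈1/ε⌉ ≤ r ≤ nʳ for r = ratio ε n.
  time-bound : ∀ {ε} .{{_ : Positive ε}} {n b} → 2 ≤ n → b ≤ (g₀ * inverse ε) ^ 6 →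
               c₀ * (n * (b * b * b)) ≤ timeBound A₀ C₀ 0 ε n
  time-bound {ε} {n} {b} 2≤n b≤ = begin
    c₀ * (n * (b * b * b))              ≤⟨ *-monoʳ-≤ c₀ (*-monoʳ-≤ n cube) ⟩
    c₀ * (n * (g₀ ^ 18 * e ^ 18))       ≡⟨ rearrange c₀ n (g₀ ^ 18) (e ^ 18) ⟩
    A₀ * (n * e ^ 18)                   ≤⟨ *-monoʳ-≤ A₀ (*-mono-≤ n≤ (^-monoˡ-≤ 18 e≤)) ⟩
    A₀ * (n ^ r * (n ^ r) ^ 18)         ≡⟨ cong (A₀ *_) (trans (^-*-assoc n r 19) (cong (n ^_) (exponent r))) ⟩
    A₀ * n ^ (19 * (r * 1))             ∎
    where
    open ≤-Reasoning
    e = inverse ε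
    r = ratio ε n
    rearrange : ∀ k n a e → k * (n * (a * e)) ≡ k * a * (n * e)
    rearrange = solve-∀
    exponent : ∀ r → r * 19 ≡ 19 * (r * 1)
    exponent = solve-∀
    e≤ : e ≤ n ^ r
    e≤ = ≤-trans (inverse≤ratio ε n) (k≤n^k 2≤n r)
    n≤ : n ≤ n ^ r
    n≤ = ≤-trans (≤-reflexive (sym (^-identityʳ n)))
           (^-monoʳ-≤ n {{>-nonZero (≤-trans (s≤s z≤n) 2≤n)}} (≤-trans (1≤inverse ε) (inverse≤ratio ε n)))
    cube : b * b * b ≤ g₀ ^ 18 * e ^ 18
    cube = begin
      b * b * b                                         ≤⟨ *-mono-≤ (*-mono-≤ b≤ b≤) b≤ ⟩
      (g₀ * e) ^ 6 * (g₀ * e) ^ 6 * (g₀ * e) ^ 6        ≡⟨ cong (_* (g₀ * e) ^ 6) (sym (^-distribˡ-+-* (g₀ * e) 6 6)) ⟩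
      (g₀ * e) ^ 12 * (g₀ * e) ^ 6                      ≡⟨ sym (^-distribˡ-+-* (g₀ * e) 12 6) ⟩
      (g₀ * e) ^ 18                                     ≡⟨ *-^-distrib g₀ e 18 ⟩
      g₀ ^ 18 * e ^ 18                                  ∎

  M₀≤ : ∀ e → 1 ≤ e → Params.M₀ (10 * e) ≤ (g₀ * e) ^ 6
  M₀≤ e 1≤e = begin
    H * (suc H * (H * H) * (H * H))   ≤⟨ *-mono-≤ H≤g (*-mono-≤ (*-mono-≤ 1+H≤g (*-mono-≤ H≤g H≤g)) (*-mono-≤ H≤g H≤g)) ⟩
    g * (g * (g * g) * (g * g))       ≡⟨ sixth g ⟩
    g ^ 6                             ∎
    where
    open ≤-Reasoning
    H = 10 * e
    g = g₀ * e
    1+H≤g : suc H ≤ g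
    1+H≤g = ≤-trans (+-monoˡ-≤ H 1≤e) (≤-reflexive (cong (_* e) (sym g₀≡11)))
    H≤g : H ≤ g
    H≤g = ≤-trans (n≤1+n H) 1+H≤g
    sixth : ∀ g → g * (g * (g * g) * (g * g)) ≡ g * (g * (g * (g * (g * (g * 1)))))
    sixth = solve-∀

  module _ {n m : ℕ} (I : Instance n m) (T : ℕ) where

    private
      N X : ℕ
      N = n ⊔ m ⊔ max 0 (map (p I) (allFin n))
      X = 2 + (N + T)
      N≤X : N ≤ X
      N≤X = ≤-trans (m≤m+n N T) (m≤n+m (N + T) 2)
      X≤X³ : X * X ≤ X ^ 3
      X≤X³ = *-monoʳ-≤ X (m≤m*n X (X * 1))

    n≤N : n ≤ N
    n≤N = ≤-trans (m≤m⊔n n m) (m≤m⊔n (n ⊔ m) _)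

    m≤wordBound : m ≤ wordBound d₀ T I
    m≤wordBound = ≤-trans (≤-trans (≤-trans (m≤n⊔m n m) (m≤m⊔n (n ⊔ m) _)) N≤X) (≤-trans (m≤m*n X X) X≤X³)

    2≤wordBound : 2 ≤ wordBound d₀ T I
    2≤wordBound = ≤-trans (m≤m+n 2 (N + T)) (≤-trans (m≤m*n X X) X≤X³)

    PV≤wordBound : ∀ {V} → V ≤ T → ∑ (allFin n) (p I) * V ≤ wordBound d₀ T I
    PV≤wordBound {V} V≤T = begin
      ∑ (allFin n) (p I) * V    ≤⟨ *-mono-≤ (∑-≤-const n (p I) N λ j → ≤-trans (≤-max (p I) (∈-allFin j)) (m≤n⊔m (n ⊔ m) _)) V≤T ⟩
      n * N * T                 ≤⟨ *-mono-≤ (*-mono-≤ (≤-trans n≤N N≤X) N≤X) (≤-trans (m≤n+m T N) (m≤n+m (N + T) 2)) ⟩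
      X * X * X                 ≡⟨ trans (*-assoc X X X) (cong (λ x → X * (X * x)) (sym (*-identityʳ X))) ⟩
      X ^ 3                     ∎
      where open ≤-Reasoning

    addr≤wordBound : ∀ {M₀} → suc M₀ ≤ T → n + suc M₀ * suc n ≤ wordBound d₀ T I
    addr≤wordBound {M₀} le = begin
      n + suc M₀ * suc n        ≤⟨ +-monoˡ-≤ (suc M₀ * suc n) (n≤1+n n) ⟩
      suc (suc M₀) * suc n      ≤⟨ *-mono-≤ (≤-trans (s≤s le) (s≤s (≤-trans (m≤n+m T N) (n≤1+n (N + T))))) (≤-trans (s≤s n≤N) (s≤s (≤-trans (m≤m+n N T) (n≤1+n (N + T))))) ⟩
      X * X                     ≤⟨ X≤X³ ⟩
      X ^ 3                     ∎
      where open ≤-Reasoning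

  -- The complete algorithm and the case of a single client

  singleClient : Cmd
  singleClient = store (reg 0) (reg 1) ⨾ store (op add (reg 0) (lit 1)) (lit 0) ⨾ set 1 (lit 1)

  -- A single client needs its own branch, because for `n = 1` the time bound is the constant `A₀`,
  -- independent of `ε`, whereas the running time of `main` grows as `ε` shrinks. All schedules are
  -- equally good there, and one block of `m` days is written.
  algorithm : ℚ → Cmd
  algorithm ε = ifnz (op sub (reg 0) (lit 1)) (Program.main (10 * inverse ε)) singleClient

  Approximates : ∀ {n m} → ℚ → Instance n m → Schedule n m → Set
  Approximates ε I π = (K* : ℕ) → IsOptimum I K* → int (objective I π) ℚ.≤ (1ℚ ℚ.+ ε) ℚ.* int K*

  module _ {m : ℕ} .{{_ : NonZero m}} (I : Instance 1 m) where

    single : Schedule 1 m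
    single _ = Perm.id

    expand≡single : expand ((m , Perm.id) ∷ []) ≡ tabulate single
    expand≡single = trans (++-identityʳ _) (replicate≡tabulate m)
      where
      replicate≡tabulate : ∀ k → replicate k (Perm.id {1}) ≡ tabulate {n = k} (λ _ → Perm.id)
      replicate≡tabulate zero    = refl
      replicate≡tabulate (suc k) = cong (Perm.id ∷_) (replicate≡tabulate k)

    run-singleClient : ∀ W c → 2 ≤ W → m ≤ W → Run W (ifnz (op sub (reg 0) (lit 1)) c singleClient) (input I) 14 (λ s → Outputs s single)
    run-singleClient W c 2≤W m≤W = run-ifnz (1≤W , 1≤W , z≤n) (λ neq → contradiction refl neq) λ _ →
      run-seq {Q = λ s → s ≡ s₁} (run-store 1≤W m≤W refl) λ { _ refl →
      run-seq {Q = λ s → s ≡ s₂} (run-store (1≤W , 1≤W , 2≤W) z≤n refl) λ { _ refl →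
      run-set 1≤W (((m , Perm.id) ∷ []) , refl , (refl , (λ { Fin.zero → refl }) , _) , expand≡single) } }
      where
      1≤W : 1 ≤ W
      1≤W = ≤-trans (s≤s z≤n) 2≤W
      s₁ s₂ : State
      s₁ = ⟨ regs (input I) , mem (input I) [ 1 ↦ m ] ⟩
      s₂ = ⟨ regs s₁ , mem s₁ [ 2 ↦ 0 ] ⟩

    single-optimal : ∀ ρ → objective I single ≡ objective I ρ
    single-optimal ρ = objective-cong I single ρ λ i j → all-equal (single i ⟨$⟩ʳ j) (ρ i ⟨$⟩ʳ j)
      where
      all-equal : ∀ (x y : Fin 1) → x ≡ y
      all-equal Fin.zero Fin.zero = refl

  14≤timeBound : ∀ ε .{{_ : Positive ε}} → 14 ≤ timeBound A₀ C₀ 0 ε 1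
  14≤timeBound ε = begin
    14                                        ≤⟨ m≤m+n 14 386 ⟩
    400                                       ≡⟨ sym c₀≡400 ⟩
    c₀                                        ≤⟨ m≤m*n c₀ (g₀ ^ 18) {{m^n≢0 g₀ 18 {{subst NonZero (sym g₀≡11) _}}}} ⟩
    A₀                                        ≡⟨ sym (*-identityʳ A₀) ⟩
    A₀ * 1                                    ≡⟨ cong (A₀ *_) (sym (^-zeroˡ (softO C₀ 0 (ratio ε 1)))) ⟩
    A₀ * 1 ^ softO C₀ 0 (ratio ε 1)           ∎
    where open ≤-Reasoning

  single-client : ∀ ε .{{_ : Positive ε}} {m} .{{_ : NonZero m}} (I : Instance 1 m) →
                  ∃[ π ] Computes d₀ (timeBound A₀ C₀ 0 ε 1) (algorithm ε) I π × Approximates ε I π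
  single-client ε {m} I = single I , computes run , λ { K* ((ρ , refl) , _) →
    ≤-[1+ε]* ε (objective I (single I)) K* (*-mono-≤ (m≤m+n (10 * inverse ε) 10) (≤-reflexive (single-optimal I ρ))) }
    where
    T : ℕ
    T = timeBound A₀ C₀ 0 ε 1
    run : Run (wordBound d₀ T I) (algorithm ε) (input I) 14 (λ s → Outputs s (single I))
    run = run-singleClient I _ _ (2≤wordBound I T) (m≤wordBound I T)
    computes : Run (wordBound d₀ T I) (algorithm ε) (input I) 14 (λ s → Outputs s (single I)) → Computes d₀ T (algorithm ε) I (single I)
    computes (t , s , d , t≤ , out) = t , s , d , ≤-trans t≤ (14≤timeBound ε) , out

  many-clients : ∀ ε .{{_ : Positive ε}} {n m} .{{_ : NonZero n}} .{{_ : NonZero m}} → 2 ≤ n → (I : Instance n m) →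
                 ∃[ π ] Computes d₀ (timeBound A₀ C₀ 0 ε n) (algorithm ε) I π × Approximates ε I π
  many-clients ε {n} {m} 2≤n I =
    let t , s , d , t≤ , good π outputs optimal = run in
    π , (t , s , d , ≤-trans t≤ cost≤T , outputs) , λ { K* ((ρ , refl) , _) → ≤-[1+ε]* ε (objective I π) K* (optimal ρ) }
    where
    e H T W : ℕ
    e = inverse ε
    H = 10 * e
    T = timeBound A₀ C₀ 0 ε n
    W = wordBound d₀ T I
    instance
      H≢0 : NonZero H
      H≢0 = >-nonZero (*-mono-≤ {1} {10} {1} (s≤s z≤n) (1≤inverse ε))
    open Params H using (M₀; V)
    n≥1 : 1 ≤ n
    n≥1 = ≤-trans (s≤s z≤n) 2≤n
    Z : ℕ
    Z = n * (M₀ * M₀ * M₀)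
    time : 400 * Z ≤ T
    time = ≤-trans (≤-reflexive (cong (_* Z) (sym c₀≡400))) (time-bound {ε} 2≤n (M₀≤ e (1≤inverse ε)))
    -- Literals and addresses involve `M₀`, which need not be bounded by any number in the input; it
    -- fits into a word because the word bound also depends on `T`.
    1+M₀≤T : suc M₀ ≤ T
    1+M₀≤T = begin
      1 + M₀     ≤⟨ +-mono-≤ (≤-trans (1≤M₀ I H) M₀≤Z) M₀≤Z ⟩
      Z + Z      ≡⟨ cong (Z +_) (sym (+-identityʳ Z)) ⟩
      2 * Z      ≤⟨ *-monoˡ-≤ Z (m≤m+n 2 398) ⟩
      400 * Z    ≤⟨ time ⟩
      T          ∎
      where
      open ≤-Reasoning
      M₀≢0 : NonZero M₀
      M₀≢0 = >-nonZero (1≤M₀ I H)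
      M₀≤Z : M₀ ≤ Z
      M₀≤Z = ≤-trans (m≤m*n M₀ M₀ {{M₀≢0}}) (≤-trans (m≤m*n (M₀ * M₀) M₀ {{M₀≢0}}) (m≤n*m (M₀ * M₀ * M₀) n))
    open Machine I H W (addr≤wordBound I T 1+M₀≤T) (m≤wordBound I T) (PV≤wordBound I T (≤-trans (V≤M₀ I H) (<⇒≤ 1+M₀≤T)))
      using (Good; good; mainCost; run-main)
    cost≤T : 4 + mainCost ≤ T
    cost≤T = ≤-trans (cost-bound n≥1 (1≤M₀ I H) (L≤M₀ I H) (V≤M₀ I H) (1+H≤M₀ I H)) time
    run : Run W (algorithm ε) (input I) (4 + mainCost) Good
    run = run-ifnz (fits-sub (input I) (reg 0) (lit 1) n≤W (≤-trans n≥1 n≤W)) (λ _ → run-main) (λ n∸1≡0 → contradiction (m∸n≡0⇒m≤n n∸1≡0) (<⇒≱ 2≤n))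
      where
      n≤W : n ≤ W
      n≤W = ≤-trans (m≤m+n n _) (addr≤wordBound I T 1+M₀≤T)

  approximate : ∀ ε .{{_ : Positive ε}} n m .{{_ : NonZero n}} .{{_ : NonZero m}} (I : Instance n m) →
                ∃[ π ] Computes d₀ (timeBound A₀ C₀ 0 ε n) (algorithm ε) I π × Approximates ε I π
  approximate ε {{ε>0}} n m {{n≢0}} {{m≢0}} I = by-cases (one-or-more n)
    where
    one-or-more : ∀ n .{{_ : NonZero n}} → n ≡ 1 ⊎ 2 ≤ n
    one-or-more 1             = inj₁ refl
    one-or-more (suc (suc _)) = inj₂ (s≤s (s≤s z≤n))
    by-one : ∀ {n} (I : Instance n m) → n ≡ 1 → ∃[ π ] Computes d₀ (timeBound A₀ C₀ 0 ε n) (algorithm ε) I π × Approximates ε I π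
    by-one I refl = single-client ε {{ε>0}} {m} {{m≢0}} I
    by-cases : n ≡ 1 ⊎ 2 ≤ n → ∃[ π ] Computes d₀ (timeBound A₀ C₀ 0 ε n) (algorithm ε) I π × Approximates ε I π
    by-cases (inj₁ n≡1) = by-one I n≡1
    by-cases (inj₂ 2≤n) = many-clients ε {{ε>0}} {n} {m} {{n≢0}} {{m≢0}} 2≤n I

open Scheme using (A₀; C₀; d₀; algorithm; approximate)
open import Data.Integer.Base using (+_)
open import Data.Nat.Base using (ℕ; NonZero)
open import Data.Product.Base using (∃-syntax; _×_)
open import Data.Rational.Base using (ℚ; Positive; 1ℚ; _+_; _*_; _/_; _≤_)

theorem4 : ∃[ A ] ∃[ C ] ∃[ c ] ∃[ d ]
    ((ε : ℚ) .{{_ : Positive ε}} → ∃[ prog ]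
    ((n m : ℕ) .{{_ : NonZero n}} .{{_ : NonZero m}} (I : Instance n m) → ∃[ π ]
    (Computes d (timeBound A C c ε n) prog I π
    × ((K* : ℕ) → IsOptimum I K* → + objective I π / 1 ≤ (1ℚ + ε) * (+ K* / 1)))))
theorem4 = A₀ , C₀ , 0 , d₀ , λ ε {{ε>0}} → algorithm ε , λ n m {{n≢0}} {{m≢0}} → approximate ε {{ε>0}} n m {{n≢0}} {{m≢0}}
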